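{- Let $\mathcal{A}=(\mathbb{G}_a^m,\Phi)$ be an abelian uniformizable $T$-module of dimension $m$. Then there exists a positive integer $j(\mathcal{A})$, depending only on $\mathcal{A}$, such that for every subring $B$ of $A$ with $B\not\subseteq\mathbb{F}_q$, every sub-$B$-module of $\mathcal{A}$ is a sub-$T^{j(\mathcal{A})}$-module of $\mathcal{A}$.
   Context: Let $A=\mathbb{F}_q[T]$, $k=\mathbb{F}_q(T)$, $\mathcal{C}$ the completion of an algebraic closure of $k_\infty$, $\tau$ the Frobenius $z\mapsto z^q$. A $T$-module of dimension $m$ defined over $\mathcal{F}\subset\overline{k}$ is $\mathcal{A}=(\mathbb{G}_a^m,\Phi)$ with $\Phi:A\to\mathcal{F}^{m,m}\{\tau\}$ an $\mathbb{F}_q$-algebra homomorphism, $\Phi(T)=\sum_{i=0}^{\tilde d}a_i\tau^i$, $a_{\tilde d}\ne0$, $a_0=TI_m+N$ with $N$ nilpotent. $\mathcal{A}$ is abelian if $\mathrm{Hom}_{\mathcal{F}}(\mathcal{A},\mathbb{G}_a)\cong\mathcal{F}\{\tau\}^m$, an $\mathcal{F}[T]$-module via $T\cdot f=f\circ\Phi(T)$, has finite rank; it is uniformizable if its exponential map $e:\mathcal{C}^m\to\mathcal{A}(\mathcal{C})$ (the unique $\mathbb{F}_q$-linear entire map with differential the identity at $0$ satisfying $e(d\Phi(T)z)=\Phi(T)(e(z))$) is surjective. For a subring $B\subseteq A$, a sub-$B$-module of $\mathcal{A}$ is a reduced connected algebraic subgroup $\mathcal{B}\subseteq\mathbb{G}_a^m$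 with $\Phi(a)(\mathcal{B})\subseteq\mathcal{B}$ for all $a\in B$. For $a\in A\setminus\mathbb{F}_q$, a sub-$a$-module is a reduced connected algebraic subgroup $\mathcal{B}$ with $\Phi(a)(\mathcal{B})\subseteq\mathcal{B}$; a sub-$T^j$-module is the case $a=T^j$. -}

module Defs where

open import Algebra.Bundles using (CommutativeRing)
open import Algebra.Bundles.Raw using (RawRing)
import Algebra.Definitions.RawMonoid as RawMonoidOps
import Algebra.Definitions.RawSemiring as RawSemiringOps
open import Algebra.Morphism.Structures using (module RingMorphisms)
open import Data.Fin.Base using (Fin; toℕ)
open import Data.Fin.Properties using () renaming (_≟_ to _≟ᶠ_)
open import Data.Integer.Base using (+_) renaming (-_ to -ᶻ_)
open import Data.List.Base using (List; []; _∷_; _∷ʳ_; length; foldr) renaming (map to mapᴸ)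
open import Data.List.Relation.Unary.All using (All)
open import Data.Nat.Base using (ℕ; zero; suc; _≤_)
open import Data.Product.Base using (_×_; _,_; ∃; ∃₂; proj₁; proj₂)
open import Data.Rational.Base using (ℚ; _/_) renaming (_+_ to _+ᵠ_; _≤_ to _≤ᵠ_)
open import Data.Sum.Base using (_⊎_)
open import Data.Vec.Base using (Vec; lookup; replicate; _[_]≔_) renaming ([] to []ⱽ; _∷_ to _∷ⱽ_)
open import Data.Vec.Functional using (Vector)
open import Function.Bundles using (Inverse; _⇔_)
open import Function.Definitions using (Surjective)
open import Level using (Level; _⊔_) renaming (suc to lsuc)
open import Relation.Binary.Construct.Add.Supremum.NonStrict _≤ᵠ_ using (_≤⁺_)
open import Relation.Binary.PropositionalEquality using (_≡_) renaming (setoid to ≡-setoid)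
open import Relation.Nullary using (¬_)
open import Relation.Nullary.Construct.Add.Supremum using (_⁺; [_]; ⊤⁺)
open import Relation.Nullary.Decidable using (does)
open import Data.Bool.Base using (if_then_else_)

-- "Zero or invertible" is the classical field axiom; constructively it
-- makes equality decidable.
record Field (c ℓ : Level) : Set (lsuc (c ⊔ ℓ)) where
  field
    commutativeRing : CommutativeRing c ℓ
  open CommutativeRing commutativeRing public
  open RawSemiringOps (RawRing.rawSemiring rawRing) public using (_^_; sum; product)
  field
    0≉1            : ¬ 0# ≈ 1#
    zeroOrInverse  : ∀ x → x ≈ 0# ⊎ ∃ λ y → x * y ≈ 1#

record FieldHom {c ℓ} (K L : Field c ℓ) : Set (c ⊔ ℓ) where
  private
    module K = Field K
    module L = Field L
  field
    ⟦_⟧               : K.Carrier → L.Carrier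
    isRingHomomorphism : RingMorphisms.IsRingHomomorphism K.rawRing L.rawRing ⟦_⟧

-- Skew polynomials R{τ}, with τ r = σ(r) τ; ordinary polynomials are the
-- case σ = id.  A list a₀ ∷ … ∷ aₙ ∷ [] stands for Σ aᵢ τⁱ, and trailing
-- zeros are disregarded by _≈_.

module Skew {c ℓ} (R : RawRing c ℓ) (σ : RawRing.Carrier R → RawRing.Carrier R) where
  open RawRing R

  Poly : Set c
  Poly = List Carrier

  coeff : Poly → ℕ → Carrier
  coeff []      _       = 0#
  coeff (a ∷ f) zero    = a
  coeff (a ∷ f) (suc i) = coeff f i

  _+ₚ_ : Poly → Poly → Poly
  []      +ₚ g       = g
  (a ∷ f) +ₚ []      = a ∷ f
  (a ∷ f) +ₚ (b ∷ g) = (a + b) ∷ (f +ₚ g)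

  -- (a + f τ) g = a g + f (τ g), and τ (Σ bⱼ τʲ) = Σ σ(bⱼ) τʲ⁺¹.
  _*ₚ_ : Poly → Poly → Poly
  []      *ₚ g = []
  (a ∷ f) *ₚ g = mapᴸ (a *_) g +ₚ (f *ₚ (0# ∷ mapᴸ σ g))

  rawRing : RawRing c ℓ
  rawRing = record
    { Carrier = Poly
    ; _≈_     = λ f g → ∀ i → coeff f i ≈ coeff g i
    ; _+_     = _+ₚ_
    ; _*_     = _*ₚ_
    ; -_      = mapᴸ -_
    ; 0#      = []
    ; 1#      = 1# ∷ []
    }

module _ {c ℓ} (K : Field c ℓ) where
  open Field K

  polyRing : RawRing c ℓ
  polyRing = Skew.rawRing rawRing (λ x → x)

  evalPoly : List Carrier → Carrier → Carrier
  evalPoly []      x = 0#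
  evalPoly (a ∷ f) x = a + x * evalPoly f x

  AlgebraicallyClosed : Set (c ⊔ ℓ)
  AlgebraicallyClosed = ∀ a as b → ¬ b ≈ 0# → ∃ λ x → evalPoly (a ∷ (as ∷ʳ b)) x ≈ 0#

  δ : ∀ {m} → Fin m → Fin m → Carrier
  δ i j = if does (i ≟ᶠ j) then 1# else 0#

  matrixRing : ℕ → RawRing c ℓ
  matrixRing m = record
    { Carrier = Fin m → Fin m → Carrier
    ; _≈_     = λ M N → ∀ i j → M i j ≈ N i j
    ; _+_     = λ M N i j → M i j + N i j
    ; _*_     = λ M N i j → sum (λ l → M i l * N l j)
    ; -_      = λ M i j → - M i j
    ; 0#      = λ _ _ → 0#
    ; 1#      = δ
    }

  scalar : ∀ {m} → Carrier → Fin m → Fin m → Carrier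
  scalar a i j = a * δ i j

  mulVec : ∀ {m} → (Fin m → Fin m → Carrier) → Vector Carrier m → Vector Carrier m
  mulVec M z i = sum (λ j → M i j * z j)

AlgebraicOver : ∀ {c ℓ} {K L : Field c ℓ} → FieldHom K L → Set (c ⊔ ℓ)
AlgebraicOver {K = K} {L} ι = ∀ x → ∃₂ λ as b →
  (¬ Field._≈_ K b (Field.0# K)) ×
  Field._≈_ L (evalPoly L (mapᴸ (FieldHom.⟦_⟧ ι) (as ∷ʳ b)) x) (Field.0# L)

record IsAlgebraicClosure {c ℓ} {K L : Field c ℓ} (ι : FieldHom K L) : Set (c ⊔ ℓ) where
  field
    algebraicallyClosed : AlgebraicallyClosed L
    algebraic           : AlgebraicOver ι

-- Valued fields.  The absolute value is |x| = q^(- v x), with |0| = q^(- ⊤⁺);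
-- rational values suffice for k∞, its algebraic closure, and 𝒞.

_+⁺_ : ℚ ⁺ → ℚ ⁺ → ℚ ⁺
[ x ] +⁺ [ y ] = [ x +ᵠ y ]
[ x ] +⁺ ⊤⁺    = ⊤⁺
⊤⁺    +⁺ _     = ⊤⁺

record Valuation {c ℓ} (K : Field c ℓ) : Set (c ⊔ ℓ) where
  open Field K
  field
    v           : Carrier → ℚ ⁺
    v-cong      : ∀ {x y} → x ≈ y → v x ≡ v y
    v-∞         : ∀ x → v x ≡ ⊤⁺ ⇔ x ≈ 0#
    v-*         : ∀ x y → v (x * y) ≡ v x +⁺ v y
    ultrametric : ∀ r x y → r ≤⁺ v x → r ≤⁺ v y → r ≤⁺ v (x + y)

  Cauchy : (ℕ → Carrier) → Set
  Cauchy s = ∀ (r : ℚ) → ∃ λ N → ∀ m n → N ≤ m → N ≤ n → [ r ] ≤⁺ v (s m - s n)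

  _⟶_ : (ℕ → Carrier) → Carrier → Set
  s ⟶ x = ∀ (r : ℚ) → ∃ λ N → ∀ n → N ≤ n → [ r ] ≤⁺ v (x - s n)

  Complete : Set c
  Complete = ∀ s → Cauchy s → ∃ λ x → s ⟶ x

module _ {c ℓ} {K L : Field c ℓ} (ι : FieldHom K L) (V : Valuation K) (W : Valuation L) where
  private
    module V = Valuation V
    module W = Valuation W
  open FieldHom ι

  Isometric : Set c
  Isometric = ∀ x → W.v ⟦ x ⟧ ≡ V.v x

  record IsCompletion : Set (c ⊔ ℓ) where
    field
      isometric : Isometric
      dense     : ∀ y (r : ℚ) → ∃ λ x → [ r ] ≤⁺ W.v (Field._-_ L y ⟦ x ⟧)
      complete  : W.Complete

-- 𝔽q, A = 𝔽q[T], k = 𝔽q(T), k∞, an algebraic closure of k∞, and its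
-- completion 𝒞.  Each is given by its defining property rather than by a
-- construction.

record FunctionFieldTower (c ℓ : Level) : Set (lsuc (c ⊔ ℓ)) where
  field
    q      : ℕ
    𝔽q     : Field c ℓ
    finite : Inverse (≡-setoid (Fin q)) (Field.setoid 𝔽q)

  module 𝔽q = Field 𝔽q

  A : RawRing c ℓ
  A = polyRing 𝔽q
  module A = RawRing A

  const : 𝔽q.Carrier → A.Carrier
  const a = a ∷ []

  T : A.Carrier
  T = 𝔽q.0# ∷ 𝔽q.1# ∷ []

  field
    k         : Field c ℓ
    A→k       : A.Carrier → Field.Carrier k
    A→k-mono  : RingMorphisms.IsRingMonomorphism A (Field.rawRing k) A→k
  module k = Field k
  field
    fractions : ∀ x → ∃₂ λ a b → (¬ A→k b k.≈ k.0#) × x k.* A→k b k.≈ A→k a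

    v-k       : Valuation k
    v-degree  : ∀ as b → ¬ b 𝔽q.≈ 𝔽q.0# →
                Valuation.v v-k (A→k (as ∷ʳ b)) ≡ [ (-ᶻ (+ length as)) / 1 ]

    k∞           : Field c ℓ
    v-k∞         : Valuation k∞
    k→k∞         : FieldHom k k∞
    isCompletion∞ : IsCompletion k→k∞ v-k v-k∞

    k̄∞        : Field c ℓ
    v-k̄∞      : Valuation k̄∞
    k∞→k̄∞     : FieldHom k∞ k̄∞
    isClosure : IsAlgebraicClosure k∞→k̄∞
    extends   : Isometric k∞→k̄∞ v-k∞ v-k̄∞

    𝒞            : Field c ℓ
    v-𝒞          : Valuation 𝒞
    k̄∞→𝒞         : FieldHom k̄∞ 𝒞
    isCompletion : IsCompletion k̄∞→𝒞 v-k̄∞ v-𝒞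

  module 𝒞 = Field 𝒞

  k→𝒞 : k.Carrier → 𝒞.Carrier
  k→𝒞 x = FieldHom.⟦_⟧ k̄∞→𝒞 (FieldHom.⟦_⟧ k∞→k̄∞ (FieldHom.⟦_⟧ k→k∞ x))

  𝔽q→𝒞 : 𝔽q.Carrier → 𝒞.Carrier
  𝔽q→𝒞 a = k→𝒞 (A→k (const a))

module _ {c ℓ} (𝒦 : FunctionFieldTower c ℓ) where
  open FunctionFieldTower 𝒦

  record Subring (p : Level) : Set (c ⊔ ℓ ⊔ lsuc p) where
    field
      member : A.Carrier → Set p
      ∈-resp : ∀ {a b} → a A.≈ b → member a → member b
      0∈     : member A.0#
      1∈     : member A.1#
      +∈     : ∀ {a b} → member a → member b → member (a A.+ b)
      -∈     : ∀ {a} → member a → member (A.- a)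
      *∈     : ∀ {a b} → member a → member b → member (a A.* b)

  _⊆𝔽q : ∀ {p} → Subring p → Set (c ⊔ ℓ ⊔ p)
  B ⊆𝔽q = ∀ a → Subring.member B a → ∃ λ x → a A.≈ const x

-- A field ℱ with k ⊆ ℱ ⊆ k̄ ⊆ 𝒞, where k̄ is the algebraic closure of k
-- in 𝒞.

record FieldOfDefinition {c ℓ} (𝒦 : FunctionFieldTower c ℓ) : Set (lsuc (c ⊔ ℓ)) where
  open FunctionFieldTower 𝒦
  field
    ℱ          : Field c ℓ
    k→ℱ        : FieldHom k ℱ
    algebraic  : AlgebraicOver k→ℱ
    ℱ→𝒞        : FieldHom ℱ 𝒞
    compatible : ∀ x → FieldHom.⟦_⟧ ℱ→𝒞 (FieldHom.⟦_⟧ k→ℱ x) 𝒞.≈ k→𝒞 x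

  A→ℱ : A.Carrier → Field.Carrier ℱ
  A→ℱ a = FieldHom.⟦_⟧ k→ℱ (A→k a)

module _ {c ℓ} {𝒦 : FunctionFieldTower c ℓ} (𝓓 : FieldOfDefinition 𝒦) where
  open FunctionFieldTower 𝒦
  open FieldOfDefinition 𝓓
  private module ℱ = Field ℱ

  Matℱ : ℕ → RawRing c ℓ
  Matℱ = matrixRing ℱ

  -- ℱ{τ} and ℱ^{m,m}{τ}, with τ the q-power Frobenius (entrywise on matrices)
  module ℱ[τ] = Skew ℱ.rawRing (λ x → x ℱ.^ q)
  module Matℱ[τ] (m : ℕ) = Skew (Matℱ m) (λ M i j → M i j ℱ.^ q)

  record TModule (m : ℕ) : Set (c ⊔ ℓ) where
    private
      module M  = RawRing (Matℱ m)
      module M^ = RawSemiringOps M.rawSemiring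
      module Mτ = RawRing (Matℱ[τ].rawRing m)
    field
      Φ                  : A.Carrier → Mτ.Carrier
      isRingHomomorphism : RingMorphisms.IsRingHomomorphism A (Matℱ[τ].rawRing m) Φ
      𝔽q-linear          : ∀ x → Φ (const x) Mτ.≈ (scalar ℱ (A→ℱ (const x)) ∷ [])

    a₀ : M.Carrier
    a₀ = Matℱ[τ].coeff m (Φ T) 0

    field
      leadingCoeff : ∃₂ λ as a → Φ T Mτ.≈ (as ∷ʳ a) × ¬ a M.≈ M.0#
      N            : M.Carrier
      a₀-form      : a₀ M.≈ (scalar ℱ (A→ℱ T) M.+ N)
      N-nilpotent  : ∃ λ n → (N M^.^ n) M.≈ M.0#

  module _ {m : ℕ} (𝒜 : TModule m) where
    open TModule 𝒜

    -- Hom_ℱ(𝒜, 𝔾ₐ) as ℱ{τ}^m, an ℱ[T]-module via T · f = f ∘ Φ(T)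

    Hom : Set c
    Hom = Vector ℱ[τ].Poly m

    _∘Φ_ : Hom → A.Carrier → Hom
    (f ∘Φ a) j = RawMonoidOps.sum (RawRing.+-rawMonoid ℱ[τ].rawRing)
                   (λ i → f i ℱ[τ].*ₚ mapᴸ (λ M → M i j) (Φ a))

    _·_ : List ℱ.Carrier → Hom → Hom
    ([]      · f) j = []
    ((x ∷ p) · f) j = mapᴸ (x ℱ.*_) (f j) ℱ[τ].+ₚ (p · (f ∘Φ T)) j

    -- Finite rank means finite generation.
    Abelian : Set (c ⊔ ℓ)
    Abelian = ∃₂ λ r (e : Fin r → Hom) → ∀ (f : Hom) →
      ∃ λ (p : Fin r → List ℱ.Carrier) → ∀ j →
        RawRing._≈_ ℱ[τ].rawRing (f j)
          (RawMonoidOps.sum (RawRing.+-rawMonoid ℱ[τ].rawRing) (λ i → (p i · e i) j))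

    Point : Set c
    Point = Vector 𝒞.Carrier m

    _≋_ : Point → Point → Set ℓ
    x ≋ y = ∀ i → x i 𝒞.≈ y i

    Mat→𝒞 : (Fin m → Fin m → ℱ.Carrier) → Fin m → Fin m → 𝒞.Carrier
    Mat→𝒞 M i j = FieldHom.⟦_⟧ ℱ→𝒞 (M i j)

    act : Matℱ[τ].Poly m → Point → Point
    act []      z i = 𝒞.0#
    act (M ∷ P) z i = mulVec 𝒞 (Mat→𝒞 M) z i 𝒞.+ act P (λ j → z j 𝒞.^ q) i

    monomial : Point → Vec ℕ m → 𝒞.Carrier
    monomial z α = 𝒞.product (λ i → z i 𝒞.^ lookup α i)

    -- Σ f α over all α with entries < n
    boxSum : (n d : ℕ) → (Vec ℕ d → 𝒞.Carrier) → 𝒞.Carrier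
    boxSum n zero    f = f []ⱽ
    boxSum n (suc d) f = 𝒞.sum {n} (λ i → boxSum n d (λ α → f (toℕ i ∷ⱽ α)))

    -- Over a non-archimedean field unconditional convergence of Σ u α means
    -- that u α → 0 as α leaves every box; the sum is then the limit over boxes.
    HasSum : (Vec ℕ m → 𝒞.Carrier) → 𝒞.Carrier → Set
    HasSum u w = ∀ (r : ℚ) → ∃ λ n →
      (∀ α → (∃ λ i → n ≤ lookup α i) → [ r ] ≤⁺ v (u α)) ×
      (∀ n′ → n ≤ n′ → [ r ] ≤⁺ v (w 𝒞.- boxSum n′ m u))
      where open Valuation v-𝒞

    record IsExponential (e : Point → Point) : Set (c ⊔ ℓ) where
      field
        e-cong       : ∀ {x y} → x ≋ y → e x ≋ e y
        additive     : ∀ x y → e (λ i → x i 𝒞.+ y i) ≋ λ i → e x i 𝒞.+ e y i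
        homogeneous  : ∀ a x → e (λ i → 𝔽q→𝒞 a 𝒞.* x i) ≋ λ i → 𝔽q→𝒞 a 𝒞.* e x i
        series       : Fin m → Vec ℕ m → 𝒞.Carrier
        entire       : ∀ z i → HasSum (λ α → series i α 𝒞.* monomial z α) (e z i)
        differential : ∀ i j → series i (replicate m 0 [ j ]≔ 1) 𝒞.≈ δ 𝒞 i j
        functional   : ∀ z → e (mulVec 𝒞 (Mat→𝒞 a₀) z) ≋ act (Φ T) (e z)

    -- At most one map is exponential, so this is surjectivity of the
    -- exponential map.
    Uniformizable : Set (c ⊔ ℓ)
    Uniformizable = ∃ λ e → IsExponential e × Surjective _≋_ _≋_ e

    -- Algebraic subgroups of 𝔾ₐ^m.  Reduced closed subschemes over the
    -- algebraically closed field 𝒞 are identified with their sets of points.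

    -- Σ cᵢ X^αᵢ
    MvPoly : Set c
    MvPoly = List (𝒞.Carrier × Vec ℕ m)

    evalMv : MvPoly → Point → 𝒞.Carrier
    evalMv g z = foldr (λ t s → proj₁ t 𝒞.* monomial z (proj₂ t) 𝒞.+ s) 𝒞.0# g

    _∈V_ : Point → List MvPoly → Set (c ⊔ ℓ)
    z ∈V gs = All (λ g → evalMv g z 𝒞.≈ 𝒞.0#) gs

    Connected : List MvPoly → Set (c ⊔ ℓ)
    Connected bs = ∀ gs hs →
      (∀ z → z ∈V bs → z ∈V gs ⊎ z ∈V hs) →
      (∀ z → z ∈V bs → ¬ (z ∈V gs × z ∈V hs)) →
      (∀ z → z ∈V bs → z ∈V gs) ⊎ (∀ z → z ∈V bs → z ∈V hs)

    record ConnectedAlgebraicSubgroup : Set (c ⊔ ℓ) where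
      field
        equations : List MvPoly
      _∋_ : Point → Set (c ⊔ ℓ)
      _∋_ z = z ∈V equations
      field
        0∈        : _∋_ (λ _ → 𝒞.0#)
        +∈        : ∀ {x y} → _∋_ x → _∋_ y → _∋_ (λ i → x i 𝒞.+ y i)
        -∈        : ∀ {x} → _∋_ x → _∋_ (λ i → 𝒞.- x i)
        connected : Connected equations

    StableUnder : ConnectedAlgebraicSubgroup → A.Carrier → Set (c ⊔ ℓ)
    StableUnder ℬ a = ∀ z → ℬ ∋ z → ℬ ∋ act (Φ a) z
      where open ConnectedAlgebraicSubgroup

    IsSub-[_]-module : ∀ {p} → Subring 𝒦 p → ConnectedAlgebraicSubgroup → Set (c ⊔ ℓ ⊔ p)
    IsSub-[ B ]-module ℬ = ∀ a → Subring.member B a → StableUnder ℬ a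

    IsSub-T^[_]-module : ℕ → ConnectedAlgebraicSubgroup → Set (c ⊔ ℓ)
    IsSub-T^[ j ]-module ℬ = StableUnder ℬ (RawSemiringOps._^_ A.rawSemiring T j)

{-# OPTIONS --safe #-}
-- Let p be the characteristic, dΦ(T) = T + N and Nⁿ = 0. The exponent j = pⁿ works because dΦ(Tʲ) = Tʲ is a scalar.
--
-- A connected algebraic subgroup ℬ of 𝔾ₐᵐ is the kernel of an idempotent E of Mat_m(𝒞){σ}, with σ the p-power Frobenius:
-- a nonzero polynomial of least degree vanishing on ℬ is additive, hence a p-polynomial; as 𝒞 is perfect, Euclid's
-- algorithm turns it into a p-polynomial in a single coordinate, and that coordinate is 0 on ℬ by connectedness; and so on.
--
-- Now let a ∈ B be nonconstant, α = Φ(a), D = Φ(Tʲ) and X = E D (1 − E). From E α (1 − E) = 0 one gets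
-- (E α) X = X α (1 − E), and the constant term of X is Tʲ E₀ (1 − E₀) = 0. If X = Xₖ σᵏ + … with k ≥ 1, comparing
-- lowest terms gives (a(T)^(pᵏ) − a(T)) Xₖ = Y Xₖ − Xₖ Y′ with Y and Y′ nilpotent, so Xₖ = 0, because a(T) is not
-- algebraic over 𝔽q. Hence X = 0, i.e. ℬ is stable under Φ(Tʲ).
--
-- Field equality is decidable, so membership in ℬ is ¬¬-stable and the choice of E may be made classically.
module Submission where

import Defs
open import Defs using
  ( Field; FieldHom; Valuation; AlgebraicallyClosed; IsCompletion; FunctionFieldTower; evalPoly; _+⁺_
  ; mulVec; δ; scalar; FieldOfDefinition; TModule; Matℱ; module Matℱ[τ]; Mat→𝒞; act; module Skew
  ; MvPoly; evalMv; ConnectedAlgebraicSubgroup; StableUnder; Abelian; Uniformizable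
  ; Subring; _⊆𝔽q; IsSub-[_]-module; IsSub-T^[_]-module )
open import Algebra.Bundles using (CommutativeRing; Semiring)
open import Algebra.Bundles.Raw using (RawRing)
import Algebra.Definitions.RawMonoid as RawMonoidOps
import Algebra.Definitions.RawSemiring as RawSemiringOps
import Algebra.Morphism.Construct.Composition as Composition
open import Algebra.Morphism.Structures using (module RingMorphisms)
import Algebra.Properties.AbelianGroup as AbelianGroupProperties
import Algebra.Properties.CommutativeMonoid.Sum as CommutativeMonoidSum
import Algebra.Properties.CommutativeSemiring.Exp as CommutativeSemiringExp
import Algebra.Properties.Group as GroupProperties
import Algebra.Properties.Ring as RingProperties
import Algebra.Properties.Semiring.Binomial as SemiringBinomial
import Algebra.Properties.Semiring.Exp as SemiringExp
import Algebra.Properties.Semiring.Mult as SemiringMult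
import Algebra.Properties.Semiring.Sum as SemiringSum
import Algebra.Solver.Ring as RingSolver
open import Algebra.Solver.Ring.AlmostCommutativeRing using (fromCommutativeRing; _-Raw-AlmostCommutative⟶_)
open import Data.Bool.Base using (Bool; true; false; if_then_else_; not; _∧_)
open import Data.Empty using (⊥; ⊥-elim)
open import Data.Fin.Base using (Fin; zero; suc; toℕ; fromℕ; inject₁; fromℕ<; punchIn)
open import Data.Fin.Permutation using (Permutation; permutation)
import Data.Fin.Properties as Fin
import Data.Integer.Base as ℤ
import Data.Integer.Properties as ℤ
open import Data.List.Base using (List; []; _∷_; length; tabulate; _∷ʳ_; replicate; lookup; _++_) renaming (map to mapᴸ)
open import Data.List.Properties using (length-tabulate; tabulate-lookup)
open import Data.List.Relation.Unary.All as All using (All; []; _∷_)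
import Data.List.Relation.Unary.All.Properties as All
open import Data.Maybe.Base using (Maybe; just; nothing)
open import Data.Nat.Base as ℕ using (ℕ; zero; suc; _<_; s≤s; z≤n; _≤_)
open import Data.Nat.Combinatorics using (_C_; nCn≡1; nC1≡n; nCk+nC[k+1]≡[n+1]C[k+1]; k>n⇒nCk≡0)
import Data.Nat.Coprimality as Coprimality
open import Data.Nat.DivMod using (_%_; _/_; m≡m%n+[m/n]*n; m%n<n)
open import Data.Nat.GeneralisedArithmetic using (fold; fold-+)
open import Data.Nat.Induction using (<-rec)
import Data.Nat.Properties as ℕ
open import Data.Nat.Solver using (module +-*-Solver)
open import Data.Product.Base using (_×_; _,_; ∃; proj₁; proj₂; ∃₂)
open import Data.Rational.Base as ℚ using (ℚ; 0ℚ; mkℚ)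
import Data.Rational.Properties as ℚ
open import Data.Sum.Base as Sum using (inj₁; inj₂; _⊎_)
open import Data.Vec.Base as Vec using (Vec; _[_]%=_) renaming (_∷_ to _∷ⱽ_)
open import Data.Vec.Functional using (Vector; updateAt)
open import Data.Vec.Functional.Properties using (updateAt-updates; updateAt-minimal)
import Data.Vec.Functional.Relation.Binary.Equality.Setoid as VectorSetoid
import Function.Base as Function
open import Function.Bundles using (Inverse; Equivalence)
open import Level using (_⊔_) renaming (suc to lsuc)
open import Relation.Binary.Construct.Add.Supremum.NonStrict ℚ._≤_ using (_≤⁺_; [_]; _≤⊤⁺; ≤⁺-trans; [≤]-injective)
open import Relation.Binary.Definitions using (Tri; tri<; tri≈; tri>)
open import Relation.Binary.PropositionalEquality as ≡ using (_≡_; _≢_)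
open import Relation.Nullary using (yes; no; ¬_; Dec; contradiction; does)
open import Relation.Nullary.Construct.Add.Supremum using ([_]; ⊤⁺; []-injective)
open import Relation.Nullary.Decidable using (_×-dec_; ¬?; decidable-stable)

-- Elements of Mat_m(𝒞){σ} are functions that carry an expansion, so their coefficients must be
-- shown to be well defined. This is `∼-unique`: scaling the argument by `θ`, the image of T,
-- separates the powers of σ. An identity between additive maps may then be read on constant terms.
-- To reach the lowest term Xₖ one cancels σ on the right, k times. Moving σ past an operator
-- conjugates it, so the operators to the right of X are twisted while those on the left stay; this
-- is why the eigenvalue a(T) becomes a(T)^(pᵏ) on one side only. The cancellation needs σ to be
-- bijective, i.e. 𝒞 perfect. The powers of a(T) are pairwise distinct because a(T) has a pole at
-- infinity. The idempotent E comes from a change of coordinates by shears x_j + u x_i^(pˢ), the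
-- elementary operations over 𝒞{σ}, after which ℬ is a coordinate subspace; solving for u again
-- takes p-th roots. E is unrelated to N, and E₀ need not commute with dΦ(T); a power of T with
-- scalar differential removes this obstacle at the constant term, the only place where the two
-- eigenvalues agree.

module ℤSolver {c ℓ} (R : CommutativeRing c ℓ) where
  open CommutativeRing R
  open SemiringMult semiring using (×-homo-+; ×-assocˡ; ×-assoc-*; ×-congʳ) renaming (_×_ to _×′_)
  open GroupProperties +-group using (ε⁻¹≈ε; ⁻¹-involutive)
  open AbelianGroupProperties +-abelianGroup using (⁻¹-∙-comm)
  open RingProperties ring using (-‿distribˡ-*; -‿distribʳ-*)
  open import Relation.Binary.Reasoning.Setoid setoid

  -- `con (ℤ.+ 1)` therefore means `1# + 0#`; scalars that have to match a solver equation are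
  -- written in that form further down.
  fromℤ : ℤ.ℤ → Carrier
  fromℤ (ℤ.+ n)      = n ×′ 1#
  fromℤ ℤ.-[1+ n ] = - (suc n ×′ 1#)

  private
    cancel-1+ : ∀ x y → (1# + x) - (1# + y) ≈ x - y
    cancel-1+ x y = begin
      (1# + x) - (1# + y)     ≈⟨ +-congˡ (sym (⁻¹-∙-comm 1# y)) ⟩
      (1# + x) + (- 1# - y)   ≈⟨ +-congʳ (+-comm 1# x) ⟩
      (x + 1#) + (- 1# - y)   ≈⟨ +-assoc x 1# _ ⟩
      x + (1# + (- 1# - y))   ≈⟨ +-congˡ (sym (+-assoc 1# (- 1#) _)) ⟩
      x + ((1# - 1#) - y)     ≈⟨ +-congˡ (+-congʳ (-‿inverseʳ 1#)) ⟩
      x + (0# - y)            ≈⟨ +-congˡ (+-identityˡ _) ⟩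
      x - y                   ∎

    fromℤ-⊖ : ∀ m n → fromℤ (m ℤ.⊖ n) ≈ m ×′ 1# - n ×′ 1#
    fromℤ-⊖ zero    zero    = sym (-‿inverseʳ 0#)
    fromℤ-⊖ zero    (suc n) = sym (+-identityˡ _)
    fromℤ-⊖ (suc m) zero    = sym (trans (+-congˡ ε⁻¹≈ε) (+-identityʳ _))
    fromℤ-⊖ (suc m) (suc n) = begin
      fromℤ (suc m ℤ.⊖ suc n)     ≡⟨ ≡.cong fromℤ (ℤ.[1+m]⊖[1+n]≡m⊖n m n) ⟩
      fromℤ (m ℤ.⊖ n)             ≈⟨ fromℤ-⊖ m n ⟩
      m ×′ 1# - n ×′ 1#             ≈⟨ sym (cancel-1+ _ _) ⟩
      suc m ×′ 1# - suc n ×′ 1#     ∎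

    fromℤ-neg : ∀ i → fromℤ (ℤ.- i) ≈ - fromℤ i
    fromℤ-neg (ℤ.+ zero)    = sym ε⁻¹≈ε
    fromℤ-neg (ℤ.+ (suc n)) = refl
    fromℤ-neg ℤ.-[1+ n ]  = sym (⁻¹-involutive _)

    fromℤ-+ : ∀ i j → fromℤ (i ℤ.+ j) ≈ fromℤ i + fromℤ j
    fromℤ-+ (ℤ.+ m) (ℤ.+ n)           = ×-homo-+ 1# m n
    fromℤ-+ (ℤ.+ m) ℤ.-[1+ n ]      = fromℤ-⊖ m (suc n)
    fromℤ-+ ℤ.-[1+ m ] (ℤ.+ n)      = trans (fromℤ-⊖ n (suc m)) (+-comm _ _)
    fromℤ-+ ℤ.-[1+ m ] ℤ.-[1+ n ] = begin
      - (suc (suc (m ℕ.+ n)) ×′ 1#)       ≡⟨ ≡.cong (λ k → - (k ×′ 1#)) (≡.cong suc (≡.sym (ℕ.+-suc m n))) ⟩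
      - ((suc m ℕ.+ suc n) ×′ 1#)         ≈⟨ -‿cong (×-homo-+ 1# (suc m) (suc n)) ⟩
      - (suc m ×′ 1# + suc n ×′ 1#)        ≈⟨ sym (⁻¹-∙-comm _ _) ⟩
      - (suc m ×′ 1#) - (suc n ×′ 1#)      ∎

    ×-homo-* : ∀ m n → (m ℕ.* n) ×′ 1# ≈ (m ×′ 1#) * (n ×′ 1#)
    ×-homo-* m n = begin
      (m ℕ.* n) ×′ 1#            ≈⟨ sym (×-assocˡ 1# m n) ⟩
      m ×′ (n ×′ 1#)              ≈⟨ ×-congʳ m (sym (*-identityˡ _)) ⟩
      m ×′ (1# * (n ×′ 1#))       ≈⟨ sym (×-assoc-* m _ _) ⟩
      (m ×′ 1#) * (n ×′ 1#)       ∎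

    fromℤ-+* : ∀ m j → fromℤ (ℤ.+ m ℤ.* j) ≈ m ×′ 1# * fromℤ j
    fromℤ-+* m (ℤ.+ n) = begin
      fromℤ (ℤ.+ m ℤ.* ℤ.+ n)    ≡⟨ ≡.cong fromℤ (≡.sym (ℤ.pos-* m n)) ⟩
      (m ℕ.* n) ×′ 1#             ≈⟨ ×-homo-* m n ⟩
      m ×′ 1# * n ×′ 1#            ∎
    fromℤ-+* m ℤ.-[1+ n ] = begin
      fromℤ (ℤ.+ m ℤ.* (ℤ.- ℤ.+ suc n))     ≡⟨ ≡.cong fromℤ (≡.sym (ℤ.neg-distribʳ-* (ℤ.+ m) (ℤ.+ suc n))) ⟩
      fromℤ (ℤ.- (ℤ.+ m ℤ.* ℤ.+ suc n))     ≈⟨ fromℤ-neg (ℤ.+ m ℤ.* ℤ.+ suc n) ⟩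
      - fromℤ (ℤ.+ m ℤ.* ℤ.+ suc n)         ≈⟨ -‿cong (fromℤ-+* m (ℤ.+ suc n)) ⟩
      - (m ×′ 1# * suc n ×′ 1#)               ≈⟨ -‿distribʳ-* _ _ ⟩
      m ×′ 1# * - (suc n ×′ 1#)               ∎

    fromℤ-* : ∀ i j → fromℤ (i ℤ.* j) ≈ fromℤ i * fromℤ j
    fromℤ-* (ℤ.+ m)      j = fromℤ-+* m j
    fromℤ-* ℤ.-[1+ m ] j = begin
      fromℤ ((ℤ.- ℤ.+ suc m) ℤ.* j)   ≡⟨ ≡.cong fromℤ (≡.sym (ℤ.neg-distribˡ-* (ℤ.+ suc m) j)) ⟩
      fromℤ (ℤ.- (ℤ.+ suc m ℤ.* j))   ≈⟨ fromℤ-neg (ℤ.+ suc m ℤ.* j) ⟩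
      - fromℤ (ℤ.+ suc m ℤ.* j)       ≈⟨ -‿cong (fromℤ-+* (suc m) j) ⟩
      - (suc m ×′ 1# * fromℤ j)        ≈⟨ -‿distribˡ-* _ _ ⟩
      - (suc m ×′ 1#) * fromℤ j        ∎

    morphism : ℤ.+-*-rawRing -Raw-AlmostCommutative⟶ fromCommutativeRing R
    morphism = record
      { ⟦_⟧    = fromℤ
      ; +-homo = fromℤ-+
      ; *-homo = fromℤ-*
      ; -‿homo = fromℤ-neg
      ; 0-homo = refl
      ; 1-homo = +-identityʳ 1#
      }

    fromℤ≟ : ∀ i j → Maybe (fromℤ i ≈ fromℤ j)
    fromℤ≟ i j with i ℤ.≟ j
    ... | yes i≡j = just (reflexive (≡.cong fromℤ i≡j))
    ... | no  _   = nothing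

  open RingSolver ℤ.+-*-rawRing (fromCommutativeRing R) morphism fromℤ≟ public
    using (solve; _:=_; _:+_; _:*_; _:-_; :-_; con)

-- Roots of polynomials in one variable.

module FieldProperties {c ℓ} (K : Field c ℓ) where
  open Field K hiding (zero)
  open ℤSolver commutativeRing
  open SemiringSum semiring using (sum-cong-≋; *-distribˡ-sum)
  open import Relation.Binary.Reasoning.Setoid setoid

  0? : ∀ x → Dec (x ≈ 0#)
  0? x with zeroOrInverse x
  ... | inj₁ x≈0        = yes x≈0
  ... | inj₂ (y , xy≈1) = no λ x≈0 → 0≉1 (trans (sym (zeroˡ y)) (trans (*-congʳ (sym x≈0)) xy≈1))

  inverse : ∀ {x} → ¬ x ≈ 0# → ∃ λ y → x * y ≈ 1#
  inverse {x} x≉0 with zeroOrInverse x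
  ... | inj₁ x≈0 = contradiction x≈0 x≉0
  ... | inj₂ inv = inv

  xy≈0⇒y≈0 : ∀ {x y} → ¬ x ≈ 0# → x * y ≈ 0# → y ≈ 0#
  xy≈0⇒y≈0 {x} {y} x≉0 xy≈0 with inverse x≉0
  ... | x⁻¹ , xx⁻¹≈1 = begin
    y               ≈⟨ *-identityˡ y ⟨
    1# * y          ≈⟨ *-congʳ xx⁻¹≈1 ⟨
    x * x⁻¹ * y     ≈⟨ solve 3 (λ x x⁻¹ y → x :* x⁻¹ :* y := x⁻¹ :* (x :* y)) refl x x⁻¹ y ⟩
    x⁻¹ * (x * y)   ≈⟨ *-congˡ xy≈0 ⟩
    x⁻¹ * 0#        ≈⟨ zeroʳ x⁻¹ ⟩
    0#              ∎

  x-y≈0⇒x≈y : ∀ {x y} → x - y ≈ 0# → x ≈ y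
  x-y≈0⇒x≈y {x} {y} x-y≈0 = begin
    x             ≈⟨ solve 2 (λ x y → x := (x :- y) :+ y) refl x y ⟩
    (x - y) + y   ≈⟨ +-congʳ x-y≈0 ⟩
    0# + y        ≈⟨ +-identityˡ y ⟩
    y             ∎

  x≈y⇒x-y≈0 : ∀ {x y} → x ≈ y → x - y ≈ 0#
  x≈y⇒x-y≈0 {x} {y} x≈y = trans (+-congʳ x≈y) (-‿inverseʳ y)

  *-cancelˡ : ∀ {x y z} → ¬ x ≈ 0# → x * y ≈ x * z → y ≈ z
  *-cancelˡ {x} {y} {z} x≉0 xy≈xz = x-y≈0⇒x≈y (xy≈0⇒y≈0 x≉0 (begin
    x * (y - z)       ≈⟨ solve 3 (λ x y z → x :* (y :- z) := x :* y :- x :* z) refl x y z ⟩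
    x * y - x * z     ≈⟨ x≈y⇒x-y≈0 xy≈xz ⟩
    0#                ∎))

  x^n≈0⇒x≈0 : ∀ {x} n → x ^ n ≈ 0# → x ≈ 0#
  x^n≈0⇒x≈0 zero    1≈0 = contradiction (sym 1≈0) 0≉1
  x^n≈0⇒x≈0 {x} (suc n) x^n≈0 with 0? x
  ... | yes x≈0 = x≈0
  ... | no  x≉0 = x^n≈0⇒x≈0 n (xy≈0⇒y≈0 x≉0 x^n≈0)

  eval = evalPoly K

  eval-zero : ∀ {f} x → All (_≈ 0#) f → eval f x ≈ 0#
  eval-zero x []         = refl
  eval-zero x (a≈0 ∷ f≈0) = trans (+-cong a≈0 (trans (*-congˡ (eval-zero x f≈0)) (zeroʳ x))) (+-identityˡ 0#)

  private
    -- The quotient of a ∷ f by X − r does not depend on a.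
    quotient : List Carrier → Carrier → List Carrier
    quotient []      r = []
    quotient (a ∷ f) r = eval (a ∷ f) r ∷ quotient f r

    length-quotient : ∀ f r → length (quotient f r) ≡ length f
    length-quotient []      r = ≡.refl
    length-quotient (a ∷ f) r = ≡.cong suc (length-quotient f r)

    eval-quotient : ∀ a f r x → eval (a ∷ f) x ≈ eval (a ∷ f) r + (x - r) * eval (quotient f r) x
    eval-quotient a [] r x = solve 3 (λ a r x → a :+ x :* con (ℤ.+ 0) := a :+ r :* con (ℤ.+ 0) :+ (x :- r) :* con (ℤ.+ 0)) refl a r x
      where import Data.Integer.Base as ℤ
    eval-quotient a (b ∷ f) r x = begin
      a + x * eval (b ∷ f) x             ≈⟨ +-congˡ (*-congˡ (eval-quotient b f r x)) ⟩
      a + x * (fr + (x - r) * qx)        ≈⟨ solve 5 (λ a r x fr qx → a :+ x :* (fr :+ (x :- r) :* qx) := a :+ r :* fr :+ (x :- r) :* (fr :+ x :* qx)) refl a r x fr qx ⟩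
      a + r * fr + (x - r) * (fr + x * qx) ∎
      where
        fr = eval (b ∷ f) r
        qx = eval (quotient f r) x

    quotient-zero : ∀ f r → All (_≈ 0#) (quotient f r) → All (_≈ 0#) f
    quotient-zero []      r []             = []
    quotient-zero (a ∷ f) r (fr≈0 ∷ q≈0) = a≈0 ∷ f≈0
      where
        f≈0 = quotient-zero f r q≈0
        a≈0 : a ≈ 0#
        a≈0 = begin
          a                    ≈⟨ +-identityʳ a ⟨
          a + 0#               ≈⟨ +-congˡ (trans (*-congˡ (eval-zero r f≈0)) (zeroʳ r)) ⟨
          a + r * eval f r     ≈⟨ fr≈0 ⟩
          0#                   ∎

  -- A list of length n has degree below n. Dividing by X - r₀ shortens it by one and keeps the
  -- other roots, since r i - r₀ is invertible.
  roots⇒zero : ∀ {n} f → length f ≡ n → (r : Fin n → Carrier) → (∀ {i j} → r i ≈ r j → i ≡ j) →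
               (∀ i → eval f (r i) ≈ 0#) → All (_≈ 0#) f
  roots⇒zero {zero}  []      _   r r-inj fr≈0 = []
  roots⇒zero {suc n} (a ∷ f) len r r-inj fr≈0 = a≈0 ∷ f≈0
    where
      r₀ = r zero
      quotient-root : ∀ i → eval (quotient f r₀) (r (suc i)) ≈ 0#
      quotient-root i = xy≈0⇒y≈0 (λ eq → Fin.0≢1+n (≡.sym (r-inj (x-y≈0⇒x≈y eq)))) (begin
        (r (suc i) - r₀) * q                                ≈⟨ +-identityˡ _ ⟨
        0# + (r (suc i) - r₀) * q                           ≈⟨ +-congʳ (fr≈0 zero) ⟨
        eval (a ∷ f) r₀ + (r (suc i) - r₀) * q              ≈⟨ eval-quotient a f r₀ (r (suc i)) ⟨
        eval (a ∷ f) (r (suc i))                            ≈⟨ fr≈0 (suc i) ⟩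
        0#                                                  ∎)
        where q = eval (quotient f r₀) (r (suc i))
      f≈0 = quotient-zero f r₀ (roots⇒zero (quotient f r₀) (≡.trans (length-quotient f r₀) (ℕ.suc-injective len)) (λ i → r (suc i))
              (λ eq → Fin.suc-injective (r-inj eq)) quotient-root)
      a≈0 : a ≈ 0#
      a≈0 = begin
        a                      ≈⟨ +-identityʳ a ⟨
        a + 0#                 ≈⟨ +-congˡ (trans (*-congˡ (eval-zero r₀ f≈0)) (zeroʳ r₀)) ⟨
        a + r₀ * eval f r₀     ≈⟨ fr≈0 zero ⟩
        0#                     ∎

  eval-tabulate : ∀ {n} (a : Fin n → Carrier) x → eval (tabulate a) x ≈ sum (λ i → a i * x ^ toℕ i)
  eval-tabulate {zero}  a x = refl
  eval-tabulate {suc n} a x = +-cong (sym (*-identityʳ _)) (begin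
    x * eval (tabulate (λ i → a (suc i))) x        ≈⟨ *-congˡ (eval-tabulate (λ i → a (suc i)) x) ⟩
    x * sum (λ i → a (suc i) * x ^ toℕ i)          ≈⟨ *-distribˡ-sum x (λ i → a (suc i) * x ^ toℕ i) ⟩
    sum (λ i → x * (a (suc i) * x ^ toℕ i))        ≈⟨ sum-cong-≋ (λ i → solve 3 (λ x a y → x :* (a :* y) := a :* (x :* y)) refl x (a (suc i)) (x ^ toℕ i)) ⟩
    sum (λ i → a (suc i) * (x * x ^ toℕ i))        ∎)

  module Infinite (θ : Carrier) (θ-powers : ∀ i j → θ ^ i ≈ θ ^ j → i ≡ j) where

    -- The powers of `θ` supply as many distinct roots as the degree requires.
    vanishing⇒zero : ∀ {n} (a : Fin n → Carrier) → (∀ x → sum (λ i → a i * x ^ toℕ i) ≈ 0#) → ∀ i → a i ≈ 0#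
    vanishing⇒zero a f≈0 = All.tabulate⁻ (roots⇒zero (tabulate a) (length-tabulate a) (λ i → θ ^ toℕ i)
      (λ eq → Fin.toℕ-injective (θ-powers _ _ eq)) (λ i → trans (eval-tabulate a _) (f≈0 _)))

-- The binomial theorem and additive powers.

module Binomial {c ℓ} (S : Semiring c ℓ) where
  open Semiring S hiding (zero)
  open SemiringMult S renaming (_×_ to _×′_)
  open SemiringExp S
  open SemiringSum S
  open import Relation.Binary.Reasoning.Setoid setoid

  private variable x y : Carrier

  middle : ℕ → Carrier → Carrier → Carrier
  middle k x y = sum {k} λ i → (suc k C suc (toℕ i)) ×′ (x ^ suc (toℕ i) * y ^ (suc k ℕ.∸ suc (toℕ i)))

  expansion : ∀ k → x * y ≈ y * x → (x + y) ^ suc k ≈ y ^ suc k + (middle k x y + x ^ suc k)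
  expansion {x} {y} k xy≈yx = begin
    (x + y) ^ suc k                                         ≈⟨ B.theorem xy≈yx (suc k) ⟩
    term zero + sum (λ i → term (suc i))                    ≈⟨ +-cong (trans (×-homo-1 _) (*-identityˡ _)) (sum-init-last (λ i → term (suc i))) ⟩
    y ^ suc k + (sum (λ i → term (suc (inject₁ i))) + term (suc (fromℕ k))) ≈⟨ +-congˡ (+-cong (sum-cong-≋ {k} init≈) last≈) ⟩
    y ^ suc k + (middle k x y + x ^ suc k)                  ∎
    where
      module B = SemiringBinomial S x y
      term = B.binomialTerm (suc k)
      init≈ : ∀ i → term (suc (inject₁ i)) ≈ (suc k C suc (toℕ i)) ×′ (x ^ suc (toℕ i) * y ^ (suc k ℕ.∸ suc (toℕ i)))
      init≈ i rewrite Fin.toℕ-inject₁ i = refl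
      last≈ : term (suc (fromℕ k)) ≈ x ^ suc k
      last≈ rewrite Fin.toℕ-fromℕ k | nCn≡1 (suc k) | ℕ.n∸n≡0 k = trans (×-homo-1 _) (*-identityʳ _)

  MiddleVanishes : ℕ → Set ℓ
  MiddleVanishes n = ∀ k → 0 < k → k < n → (n C k) ×′ 1# ≈ 0#

  ×-zero : ∀ n z → n ×′ 1# ≈ 0# → n ×′ z ≈ 0#
  ×-zero n z n1≈0 = begin
    n ×′ z          ≈⟨ ×-congʳ n (*-identityˡ z) ⟨
    n ×′ (1# * z)   ≈⟨ ×-assoc-* n 1# z ⟨
    (n ×′ 1#) * z   ≈⟨ *-congʳ n1≈0 ⟩
    0# * z          ≈⟨ zeroˡ z ⟩
    0#              ∎

  -- Stated for commuting elements of a semiring, so that it serves both for elements of a field and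
  -- for a scalar plus a nilpotent linear map.
  ^-additive : ∀ {n} → 0 < n → MiddleVanishes n → x * y ≈ y * x → (x + y) ^ n ≈ x ^ n + y ^ n
  ^-additive {x} {y} {suc k} _ van xy≈yx = begin
    (x + y) ^ suc k                         ≈⟨ expansion k xy≈yx ⟩
    y ^ suc k + (middle k x y + x ^ suc k)  ≈⟨ +-congˡ (+-congʳ (trans (sum-cong-≋ {k} (λ i → ×-zero (suc k C suc (toℕ i)) _ (van _ (s≤s z≤n) (s≤s (Fin.toℕ<n i))))) (sum-replicate-zero k))) ⟩
    y ^ suc k + (0# + x ^ suc k)            ≈⟨ +-congˡ (+-identityˡ _) ⟩
    y ^ suc k + x ^ suc k                   ≈⟨ +-comm _ _ ⟩
    x ^ suc k + y ^ suc k                   ∎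

-- Makes k · C(p,k) a multiple of p, which is how the middle binomial coefficients are shown to
-- vanish in characteristic p.
absorption : ∀ n k → suc k ℕ.* (suc n C suc k) ≡ suc n ℕ.* (n C k)
absorption zero    zero    = ≡.refl
absorption zero    (suc k) = begin
  suc (suc k) ℕ.* (1 C suc (suc k)) ≡⟨ ≡.cong (suc (suc k) ℕ.*_) (k>n⇒nCk≡0 {1} {suc (suc k)} (s≤s (s≤s z≤n))) ⟩
  suc (suc k) ℕ.* 0                 ≡⟨ ℕ.*-zeroʳ (suc (suc k)) ⟩
  0                                 ≡⟨ ≡.cong (1 ℕ.*_) (k>n⇒nCk≡0 {0} {suc k} (s≤s z≤n)) ⟨
  1 ℕ.* (0 C suc k)                 ∎
  where open ≡.≡-Reasoning
absorption (suc n) zero    = begin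
  1 ℕ.* (suc (suc n) C 1)   ≡⟨ ≡.cong (1 ℕ.*_) (nC1≡n (suc (suc n))) ⟩
  1 ℕ.* suc (suc n)         ≡⟨ ℕ.*-comm 1 (suc (suc n)) ⟩
  suc (suc n) ℕ.* 1         ∎
  where open ≡.≡-Reasoning
absorption (suc n) (suc k) = begin
  suc (suc k) ℕ.* (suc (suc n) C suc (suc k))              ≡⟨ ≡.cong (suc (suc k) ℕ.*_) (nCk+nC[k+1]≡[n+1]C[k+1] (suc n) (suc k)) ⟨
  suc (suc k) ℕ.* (a ℕ.+ b)                                ≡⟨ +-*-Solver.solve 3 (λ k a b → (con 1 :+ (con 1 :+ k)) :* (a :+ b) := a :+ ((con 1 :+ k) :* a :+ (con 1 :+ (con 1 :+ k)) :* b)) ≡.refl k a b ⟩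
  a ℕ.+ (suc k ℕ.* a ℕ.+ suc (suc k) ℕ.* b)                ≡⟨ ≡.cong₂ (λ u v → a ℕ.+ (u ℕ.+ v)) (absorption n k) (absorption n (suc k)) ⟩
  a ℕ.+ (suc n ℕ.* (n C k) ℕ.+ suc n ℕ.* (n C suc k))      ≡⟨ ≡.cong (a ℕ.+_) (ℕ.*-distribˡ-+ (suc n) (n C k) (n C suc k)) ⟨
  a ℕ.+ suc n ℕ.* ((n C k) ℕ.+ (n C suc k))                ≡⟨ ≡.cong (λ u → a ℕ.+ suc n ℕ.* u) (nCk+nC[k+1]≡[n+1]C[k+1] n k) ⟩
  suc (suc n) ℕ.* (suc n C suc k)                          ∎
  where
    open ≡.≡-Reasoning
    open +-*-Solver
    a = suc n C suc k
    b = suc n C suc (suc k)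

least : ∀ {ℓ} (P : ℕ → Set ℓ) → (∀ n → Dec (P n)) → ∀ n → P n → ∃ λ m → P m × (∀ i → i < m → ¬ P i)
least P P? n Pn with search n
  where
    search : ∀ n → (∀ i → i < n → ¬ P i) ⊎ ∃ λ m → P m × (∀ i → i < m → ¬ P i)
    search zero    = inj₁ λ _ ()
    search (suc n) with search n
    ... | inj₂ found = inj₂ found
    ... | inj₁ none with P? n
    ... | yes Pn = inj₂ (n , Pn , none)
    ... | no ¬Pn = inj₁ below
      where
        below : ∀ i → i < suc n → ¬ P i
        below i i<1+n Pi with i ℕ.≟ n
        ... | yes ≡.refl = ¬Pn Pi
        ... | no  i≢n    = none i (ℕ.≤∧≢⇒< (ℕ.≤-pred i<1+n) i≢n) Pi
... | inj₂ found = found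
... | inj₁ none with P? n
... | yes Pn = n , Pn , none
... | no ¬Pn = contradiction Pn ¬Pn

-- Characteristic, and the exponents k for which x ↦ x^k is additive.

module Exponents {c ℓ} (K : Field c ℓ) where
  open Field K hiding (zero)
  open FieldProperties K
  open ℤSolver commutativeRing
  open Binomial semiring using (middle; expansion; MiddleVanishes; ^-additive)
  open SemiringMult semiring using (×-congʳ; ×-assoc-*; ×-homo-+; ×-assocˡ; ×-homo-1) renaming (_×_ to _×′_)
  open CommutativeSemiringExp commutativeSemiring using (^-congˡ; ^-assocʳ; ^-distrib-*)
  open SemiringSum semiring using (sum-cong-≋)
  open import Relation.Binary.Reasoning.Setoid setoid

  n×0≈0 : ∀ n → n ×′ 0# ≈ 0#
  n×0≈0 zero    = refl
  n×0≈0 (suc n) = trans (+-identityˡ _) (n×0≈0 n)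

  0^n≈0 : ∀ {n} → 0 < n → 0# ^ n ≈ 0#
  0^n≈0 {suc n} _ = zeroˡ _

  1^n≈1 : ∀ n → 1# ^ n ≈ 1#
  1^n≈1 zero    = refl
  1^n≈1 (suc n) = trans (*-identityˡ _) (1^n≈1 n)

  -- The coefficients of (X+1)^(k+1) - X^(k+1) - 1. The degree is at most k, so k + 1 roots
  -- annihilate it; a field with q = k + 1 elements has exactly that many to offer.
  middleCoeff : ∀ k → Fin (suc k) → Carrier
  middleCoeff k zero    = 0#
  middleCoeff k (suc i) = (suc k C suc (toℕ i)) ×′ 1#

  middle-sum : ∀ k x → sum (λ i → middleCoeff k i * x ^ toℕ i) ≈ middle k x 1#
  middle-sum k x = trans (+-congʳ (zeroˡ _)) (trans (+-identityˡ _) (sum-cong-≋ {k} λ i → begin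
    (n i ×′ 1#) * x ^ suc (toℕ i)                            ≈⟨ ×-assoc-* (n i) 1# _ ⟩
    n i ×′ (1# * x ^ suc (toℕ i))                            ≈⟨ ×-congʳ (n i) (*-comm _ _) ⟩
    n i ×′ (x ^ suc (toℕ i) * 1#)                            ≈⟨ ×-congʳ (n i) (*-congˡ (sym (1^n≈1 (suc k ℕ.∸ suc (toℕ i))))) ⟩
    n i ×′ (x ^ suc (toℕ i) * 1# ^ (suc k ℕ.∸ suc (toℕ i)))  ∎))
    where
      n : Fin k → ℕ
      n i = suc k C suc (toℕ i)

  middle-zero : ∀ k x → (x + 1#) ^ suc k ≈ x ^ suc k + 1# → middle k x 1# ≈ 0#
  middle-zero k x add = begin
    middle k x 1#                                  ≈⟨ solve 3 (λ u m v → m := (u :+ (m :+ v)) :- (v :+ u)) refl 1# (middle k x 1#) (x ^ suc k) ⟩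
    (1# + (middle k x 1# + x ^ suc k)) - (x ^ suc k + 1#)  ≈⟨ +-congʳ (+-congʳ (sym (1^n≈1 (suc k)))) ⟩
    (1# ^ suc k + (middle k x 1# + x ^ suc k)) - (x ^ suc k + 1#)  ≈⟨ +-congʳ (sym (expansion k (*-comm x 1#))) ⟩
    (x + 1#) ^ suc k - (x ^ suc k + 1#)            ≈⟨ x≈y⇒x-y≈0 add ⟩
    0#                                             ∎

  Additive : ℕ → Set _
  Additive k = ∀ x y → (x + y) ^ k ≈ x ^ k + y ^ k

  ×-nonzero-product : ∀ m n → (m ℕ.* n) ×′ 1# ≈ 0# → ¬ m ×′ 1# ≈ 0# → n ×′ 1# ≈ 0#
  ×-nonzero-product m n mn≈0 m≉0 = xy≈0⇒y≈0 m≉0 (begin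
    (m ×′ 1#) * (n ×′ 1#)   ≈⟨ ×-assoc-* m 1# _ ⟩
    m ×′ (1# * (n ×′ 1#))   ≈⟨ ×-congʳ m (*-identityˡ _) ⟩
    m ×′ (n ×′ 1#)          ≈⟨ ×-assocˡ 1# m n ⟩
    (m ℕ.* n) ×′ 1#         ≈⟨ mn≈0 ⟩
    0#                      ∎)

  -- By `absorption`, k · C(p,k) is a multiple of p, and k is invertible for 0 < k < p by minimality
  -- of p, which here does the work of primality.
  minimal⇒middleVanishes : ∀ p → p ×′ 1# ≈ 0# → (∀ i → 0 < i → i < p → ¬ i ×′ 1# ≈ 0#) → MiddleVanishes p
  minimal⇒middleVanishes (suc p) p1≈0 minimal (suc k) _ k<p = ×-nonzero-product (suc k) (suc p C suc k) (begin
    (suc k ℕ.* (suc p C suc k)) ×′ 1#   ≡⟨ ≡.cong (_×′ 1#) (≡.trans (absorption p k) (ℕ.*-comm (suc p) _)) ⟩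
    ((p C k) ℕ.* suc p) ×′ 1#           ≈⟨ ×-assocˡ 1# (p C k) (suc p) ⟨
    (p C k) ×′ (suc p ×′ 1#)            ≈⟨ ×-congʳ (p C k) p1≈0 ⟩
    (p C k) ×′ 0#                       ≈⟨ n×0≈0 (p C k) ⟩
    0#                                  ∎) (minimal (suc k) (s≤s z≤n) k<p)

  record Characteristic (p : ℕ) : Set ℓ where
    field
      positive : 0 < p
      p×1≈0    : p ×′ 1# ≈ 0#
      minimal  : ∀ i → 0 < i → i < p → ¬ i ×′ 1# ≈ 0#

    1<p : 1 < p
    1<p = ℕ.≤∧≢⇒< positive λ { ≡.refl → 0≉1 (trans (sym p×1≈0) (×-homo-1 1#)) }

    n<p^n : ∀ n → n < p ℕ.^ n
    n<p^n zero    = s≤s z≤n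
    n<p^n (suc n) = ℕ.≤-<-trans (n<p^n n) (ℕ.^-monoʳ-< p 1<p (ℕ.n<1+n n))

    middleVanishes : MiddleVanishes p
    middleVanishes = minimal⇒middleVanishes p p×1≈0 minimal

    φ : Carrier → Carrier
    φ x = x ^ p

    φ-additive : Additive p
    φ-additive x y = ^-additive positive middleVanishes (*-comm x y)

    φ-cong : ∀ {x y} → x ≈ y → φ x ≈ φ y
    φ-cong = ^-congˡ p

    φ-* : ∀ x y → φ (x * y) ≈ φ x * φ y
    φ-* x y = ^-distrib-* x y p

    φ-0 : φ 0# ≈ 0#
    φ-0 = 0^n≈0 positive

    φ-neg : ∀ x → φ (- x) ≈ - φ x
    φ-neg x = begin
      φ (- x)                   ≈⟨ solve 2 (λ x y → y := (y :+ x) :- x) refl (φ x) (φ (- x)) ⟩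
      (φ (- x) + φ x) - φ x     ≈⟨ +-congʳ (φ-additive (- x) x) ⟨
      φ (- x + x) - φ x         ≈⟨ +-congʳ (trans (φ-cong (-‿inverseˡ x)) φ-0) ⟩
      0# - φ x                  ≈⟨ +-identityˡ _ ⟩
      - φ x                     ∎

    φ-injective : ∀ {x y} → φ x ≈ φ y → x ≈ y
    φ-injective {x} {y} eq = x-y≈0⇒x≈y (x^n≈0⇒x≈0 p (begin
      φ (x - y)       ≈⟨ φ-additive x (- y) ⟩
      φ x + φ (- y)   ≈⟨ +-congˡ (φ-neg y) ⟩
      φ x - φ y       ≈⟨ x≈y⇒x-y≈0 eq ⟩
      0#              ∎))

    divides : ∀ n → n ×′ 1# ≈ 0# → ∃ λ m → n ≡ m ℕ.* p
    divides n n1≈0 = (n / p) , ≡.trans (m≡m%n+[m/n]*n n p) (≡.cong (ℕ._+ (n / p) ℕ.* p) (remainder (n % p) ≡.refl))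
      where
        instance
          p-nonZero : ℕ.NonZero p
          p-nonZero = ℕ.>-nonZero positive
        remainder : ∀ r → r ≡ n % p → r ≡ 0
        remainder zero    _  = ≡.refl
        remainder (suc r) eq = contradiction (begin
          suc r ×′ 1#                                  ≈⟨ +-identityʳ _ ⟨
          suc r ×′ 1# + 0#                             ≈⟨ +-congˡ (n×0≈0 (n / p)) ⟨
          suc r ×′ 1# + (n / p) ×′ 0#                  ≈⟨ +-congˡ (×-congʳ (n / p) p×1≈0) ⟨
          suc r ×′ 1# + (n / p) ×′ (p ×′ 1#)           ≈⟨ +-congˡ (×-assocˡ 1# (n / p) p) ⟩
          suc r ×′ 1# + ((n / p) ℕ.* p) ×′ 1#          ≈⟨ ×-homo-+ 1# (suc r) _ ⟨
          (suc r ℕ.+ (n / p) ℕ.* p) ×′ 1#              ≡⟨ ≡.cong (λ r → (r ℕ.+ (n / p) ℕ.* p) ×′ 1#) eq ⟩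
          (n % p ℕ.+ (n / p) ℕ.* p) ×′ 1#              ≡⟨ ≡.cong (_×′ 1#) (m≡m%n+[m/n]*n n p) ⟨
          n ×′ 1#                                      ≈⟨ n1≈0 ⟩
          0#                                           ∎) (minimal (suc r) (s≤s z≤n) (≡.subst (_< p) (≡.sym eq) (m%n<n n p)))

    module _ (θ : Carrier) (θ-powers : ∀ i j → θ ^ i ≈ θ ^ j → i ≡ j) where
      open Infinite θ θ-powers

      -- For an additive exponent k + 2 the polynomial (X+1)^(k+2) - X^(k+2) - 1 vanishes
      -- identically, and its coefficient at X is k + 2. Exponent 1 has no middle coefficient, hence
      -- the two successors.
      additive⇒×1≈0 : ∀ k → Additive (suc (suc k)) → suc (suc k) ×′ 1# ≈ 0#
      additive⇒×1≈0 k add = ≡.subst (λ n → n ×′ 1# ≈ 0#) (nC1≡n (suc (suc k)))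
        (vanishing⇒zero (middleCoeff (suc k)) (λ x → trans (middle-sum (suc k) x)
          (middle-zero (suc k) x (trans (add x 1#) (+-congˡ (1^n≈1 (suc (suc k))))))) (suc zero))

      -- Frobenius is additive and injective, so a factor p of the exponent can be cancelled.
      additive-quotient : ∀ m {k} → k ≡ m ℕ.* p → Additive k → Additive m
      additive-quotient m {k} k≡mp add x y = φ-injective (begin
        ((x + y) ^ m) ^ p             ≈⟨ ^-assocʳ (x + y) m p ⟩
        (x + y) ^ (m ℕ.* p)           ≡⟨ ≡.cong ((x + y) ^_) k≡mp ⟨
        (x + y) ^ k                   ≈⟨ add x y ⟩
        x ^ k + y ^ k                 ≡⟨ ≡.cong (λ n → x ^ n + y ^ n) k≡mp ⟩
        x ^ (m ℕ.* p) + y ^ (m ℕ.* p) ≈⟨ +-cong (^-assocʳ x m p) (^-assocʳ y m p) ⟨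
        (x ^ m) ^ p + (y ^ m) ^ p     ≈⟨ φ-additive (x ^ m) (y ^ m) ⟨
        (x ^ m + y ^ m) ^ p           ∎)

      ¬additive-0 : ¬ Additive 0
      ¬additive-0 add = 0≉1 (begin
        0#               ≈⟨ -‿inverseʳ 1# ⟨
        1# - 1#          ≈⟨ +-congʳ (add 0# 0#) ⟩
        (1# + 1#) - 1#   ≈⟨ +-assoc 1# 1# (- 1#) ⟩
        1# + (1# - 1#)   ≈⟨ +-congˡ (-‿inverseʳ 1#) ⟩
        1# + 0#          ≈⟨ +-identityʳ 1# ⟩
        1#               ∎)

      private
        quotient-< : ∀ m {k} → 0 < k → k ≡ m ℕ.* p → m < k
        quotient-< (suc m) _ ≡.refl = ℕ.m<m*n (suc m) p 1<p

      -- An additive exponent above 1 is zero in K, hence divisible by p; dividing by p keeps it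
      -- additive, and the descent ends at 1.
      additive⇒power : ∀ k → Additive k → ∃ λ j → k ≡ p ℕ.^ j
      additive⇒power = <-rec (λ k → Additive k → ∃ λ j → k ≡ p ℕ.^ j) step
        where
          step : ∀ k → (∀ {m} → m < k → Additive m → ∃ λ j → m ≡ p ℕ.^ j) → Additive k → ∃ λ j → k ≡ p ℕ.^ j
          step zero          rec add = contradiction add ¬additive-0
          step (suc zero)    rec add = 0 , ≡.refl
          step (suc (suc k)) rec add =
            let m , k≡mp  = divides (suc (suc k)) (additive⇒×1≈0 k add)
                j , m≡p^j = rec {m} (quotient-< m (s≤s z≤n) k≡mp) (additive-quotient m k≡mp add)
            in suc j , ≡.trans k≡mp (≡.trans (≡.cong (ℕ._* p) m≡p^j) (ℕ.*-comm (p ℕ.^ j) p))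

  characteristic : ∀ n → 0 < n → n ×′ 1# ≈ 0# → ∃ Characteristic
  characteristic n 0<n n1≈0 with least (λ n → 0 < n × n ×′ 1# ≈ 0#) P? n (0<n , n1≈0)
    where
      P? : ∀ n → Dec (0 < n × n ×′ 1# ≈ 0#)
      P? zero    = no λ ()
      P? (suc n) with 0? (suc n ×′ 1#)
      ... | yes n1≈0 = yes (s≤s z≤n , n1≈0)
      ... | no  n1≉0 = no λ { (_ , n1≈0) → n1≉0 n1≈0 }
  ... | p , (0<p , p1≈0) , min = p , record
    { positive = 0<p ; p×1≈0 = p1≈0 ; minimal = λ i 0<i i<p i1≈0 → min i i<p (0<i , i1≈0) }

-- Finite fields: x^q = x.

module FiniteField {c ℓ} (F : Field c ℓ) {q} (enumeration : Inverse (≡.setoid (Fin q)) (Field.setoid F)) where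
  open Field F hiding (zero)
  open FieldProperties F
  open Exponents F
  open ℤSolver commutativeRing
  open Binomial semiring using (MiddleVanishes)
  open CommutativeSemiringExp commutativeSemiring using (^-congˡ)
  open SemiringMult semiring using () renaming (_×_ to _×′_)
  module Π = CommutativeMonoidSum *-commutativeMonoid
  open Inverse enumeration using (to; from; from-cong; strictlyInverseˡ; strictlyInverseʳ)
  open import Relation.Binary.Reasoning.Setoid setoid

  private
    to-injective : ∀ {i j} → to i ≈ to j → i ≡ j
    to-injective {i} {j} eq = ≡.trans (≡.sym (strictlyInverseʳ i)) (≡.trans (from-cong eq) (strictlyInverseʳ j))

    -- With 0 replaced by 1 the product of the nonzero elements runs over all of `Fin q`, on which
    -- multiplication by x is a permutation.
    nonzeroOr1 : Carrier → Carrier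
    nonzeroOr1 y with 0? y
    ... | yes _ = 1#
    ... | no  _ = y

    nonzeroOr1-≉ : ∀ {y} → ¬ y ≈ 0# → nonzeroOr1 y ≈ y
    nonzeroOr1-≉ {y} y≉0 with 0? y
    ... | yes y≈0 = contradiction y≈0 y≉0
    ... | no  _   = refl

    nonzeroOr1-≈ : ∀ {y} → y ≈ 0# → nonzeroOr1 y ≈ 1#
    nonzeroOr1-≈ {y} y≈0 with 0? y
    ... | yes _   = refl
    ... | no  y≉0 = contradiction y≈0 y≉0

    nonzeroOr1-cong : ∀ {y z} → y ≈ z → nonzeroOr1 y ≈ nonzeroOr1 z
    nonzeroOr1-cong {y} {z} y≈z with 0? z
    ... | yes z≈0 = nonzeroOr1-≈ (trans y≈z z≈0)
    ... | no  z≉0 = trans (nonzeroOr1-≉ (λ y≈0 → z≉0 (trans (sym y≈z) y≈0))) y≈z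

    nonzeroOr1-≉0 : ∀ y → ¬ nonzeroOr1 y ≈ 0#
    nonzeroOr1-≉0 y with 0? y
    ... | yes _   = λ 1≈0 → 0≉1 (sym 1≈0)
    ... | no  y≉0 = y≉0

    product-≉0 : ∀ {n} (f : Fin n → Carrier) → (∀ i → ¬ f i ≈ 0#) → ¬ Π.sum f ≈ 0#
    product-≉0 {zero}  f f≉0 1≈0  = 0≉1 (sym 1≈0)
    product-≉0 {suc n} f f≉0 fs≈0 = product-≉0 (λ i → f (suc i)) (λ i → f≉0 (suc i)) (xy≈0⇒y≈0 (f≉0 zero) fs≈0)

    -- The defect of `nonzeroOr1` from commuting with multiplication by x. Only the index of 0
    -- contributes, so the defects multiply to x.
    onlyAtZero : Carrier → Carrier → Carrier
    onlyAtZero x y with 0? y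
    ... | yes _ = x
    ... | no  _ = 1#

    onlyAtZero-≉ : ∀ x {y} → ¬ y ≈ 0# → onlyAtZero x y ≈ 1#
    onlyAtZero-≉ x {y} y≉0 with 0? y
    ... | yes y≈0 = contradiction y≈0 y≉0
    ... | no  _   = refl

    onlyAtZero-≈ : ∀ x {y} → y ≈ 0# → onlyAtZero x y ≈ x
    onlyAtZero-≈ x {y} y≈0 with 0? y
    ... | yes _   = refl
    ... | no  y≉0 = contradiction y≈0 y≉0

    split : ∀ x → ¬ x ≈ 0# → ∀ y → x * nonzeroOr1 y ≈ nonzeroOr1 (x * y) * onlyAtZero x y
    split x x≉0 y with 0? y
    ... | yes y≈0 = trans (*-comm x 1#) (*-congʳ (sym (nonzeroOr1-≈ (trans (*-congˡ y≈0) (zeroʳ x)))))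
    ... | no  y≉0 = trans (sym (nonzeroOr1-≉ (λ xy≈0 → y≉0 (xy≈0⇒y≈0 x≉0 xy≈0)))) (sym (*-identityʳ _))

  module _ (x : Carrier) (x≉0 : ¬ x ≈ 0#) where
    private
      x⁻¹ = proj₁ (inverse x≉0)
      xx⁻¹≈1 = proj₂ (inverse x≉0)

      scaling : Permutation q q
      scaling = permutation (λ i → from (x * to i)) (λ i → from (x⁻¹ * to i))
        (λ i → ≡.trans (from-cong (begin
          x * to (from (x⁻¹ * to i))   ≈⟨ *-congˡ (strictlyInverseˡ _) ⟩
          x * (x⁻¹ * to i)             ≈⟨ *-assoc _ _ _ ⟨
          x * x⁻¹ * to i               ≈⟨ *-congʳ xx⁻¹≈1 ⟩
          1# * to i                    ≈⟨ *-identityˡ _ ⟩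
          to i                         ∎)) (strictlyInverseʳ i))
        (λ i → ≡.trans (from-cong (begin
          x⁻¹ * to (from (x * to i))   ≈⟨ *-congˡ (strictlyInverseˡ _) ⟩
          x⁻¹ * (x * to i)             ≈⟨ solve 3 (λ x x⁻¹ y → x⁻¹ :* (x :* y) := x :* x⁻¹ :* y) refl x x⁻¹ (to i) ⟩
          x * x⁻¹ * to i               ≈⟨ *-congʳ xx⁻¹≈1 ⟩
          1# * to i                    ≈⟨ *-identityˡ _ ⟩
          to i                         ∎)) (strictlyInverseʳ i))

      u = λ i → nonzeroOr1 (to i)
      w = λ i → onlyAtZero x (to i)

      Πw≈x : Π.sum w ≈ x
      Πw≈x = go q to to-injective (from 0#) (strictlyInverseˡ 0#)
        where
          go : ∀ n (to′ : Fin n → Carrier) → (∀ {i j} → to′ i ≈ to′ j → i ≡ j) → ∀ i₀ → to′ i₀ ≈ 0# →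
               Π.sum (λ i → onlyAtZero x (to′ i)) ≈ x
          go (suc n) to′ inj i₀ to′i₀≈0 = begin
            Π.sum w′                                     ≈⟨ Π.sum-remove {n} {i₀} w′ ⟩
            w′ i₀ * Π.sum (λ i → w′ (punchIn i₀ i))      ≈⟨ *-cong (onlyAtZero-≈ x to′i₀≈0) (trans (Π.sum-cong-≋ (λ i → onlyAtZero-≉ x (λ eq → Fin.punchInᵢ≢i i₀ i (inj (trans eq (sym to′i₀≈0)))))) (Π.sum-replicate-zero n)) ⟩
            x * 1#                                       ≈⟨ *-identityʳ x ⟩
            x                                            ∎
            where w′ = λ i → onlyAtZero x (to′ i)

    -- Multiplying every factor of the product by x yields x^q; permuting the factors back leaves
    -- the defect x. The extra factor at 0 is why q appears instead of the usual q - 1.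
    x^q≈x-nonzero : x ^ q ≈ x
    x^q≈x-nonzero = *-cancelˡ (product-≉0 u (λ i → nonzeroOr1-≉0 (to i))) (begin
      Π.sum u * x ^ q                              ≈⟨ *-comm _ _ ⟩
      x ^ q * Π.sum u                              ≈⟨ *-congʳ (Π.sum-replicate q) ⟨
      Π.sum {q} (λ _ → x) * Π.sum u                ≈⟨ Π.∑-distrib-+ {q} (λ _ → x) u ⟨
      Π.sum (λ i → x * u i)                        ≈⟨ Π.sum-cong-≋ (λ i → trans (split x x≉0 (to i)) (*-congʳ (nonzeroOr1-cong (sym (strictlyInverseˡ _))))) ⟩
      Π.sum (λ i → u (from (x * to i)) * w i)      ≈⟨ Π.∑-distrib-+ (λ i → u (from (x * to i))) w ⟩
      Π.sum (λ i → u (from (x * to i))) * Π.sum w  ≈⟨ *-cong (Π.sum-permute u scaling) (sym Πw≈x) ⟨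
      Π.sum u * x                                  ∎)

  0<q : 0 < q
  0<q = ℕ.≤-<-trans z≤n (Fin.toℕ<n (from 0#))

  x^q≈x : ∀ x → x ^ q ≈ x
  x^q≈x x with 0? x
  ... | no x≉0  = x^q≈x-nonzero x x≉0
  ... | yes x≈0 = trans (^-congˡ q x≈0) (trans (0^n≈0 0<q) (sym x≈0))

  1<q : 1 < q
  1<q = ℕ.≤∧≢⇒< 0<q λ 1≡q → 0≉1 (subsingleton 1≡q (from 0#) (from 1#) (strictlyInverseˡ 0#) (strictlyInverseˡ 1#))
    where
      subsingleton : 1 ≡ q → ∀ i j → to i ≈ 0# → to j ≈ 1# → 0# ≈ 1#
      subsingleton 1≡q i j ti tj = trans (sym ti) (trans (reflexive (≡.cong to (Fin.toℕ-injective
        (≡.trans (lt i) (≡.sym (lt j)))))) tj)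
        where
          lt : ∀ (k : Fin q) → toℕ k ≡ 0
          lt k = ℕ.n<1⇒n≡0 (≡.subst (toℕ k <_) (≡.sym 1≡q) (Fin.toℕ<n k))

  -- (X+1)^q - X^q - 1 has degree below q and vanishes at all q elements, because x^q = x. This
  -- gives additivity of the q-th power before q is known to be a power of p.
  q-middleVanishes : MiddleVanishes q
  q-middleVanishes = go q ≡.refl
    where
      go : ∀ n → n ≡ q → MiddleVanishes n
      go (suc n) ≡.refl (suc k) _ (s≤s k<n) = ≡.subst (λ k → (suc n C suc k) ×′ 1# ≈ 0#) (Fin.toℕ-fromℕ< k<n) (coeff≈0 (suc (fromℕ< k<n)))
        where
          coeff≈0 : ∀ i → middleCoeff n i ≈ 0#
          coeff≈0 = All.tabulate⁻ (roots⇒zero (tabulate (middleCoeff n)) (length-tabulate (middleCoeff n)) to to-injective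
            λ i → trans (eval-tabulate (middleCoeff n) (to i)) (trans (middle-sum n (to i))
              (middle-zero n (to i) (trans (x^q≈x (to i + 1#)) (+-congʳ (sym (x^q≈x (to i))))))))

fold-comm : ∀ {a} {A : Set a} (f : A → A) n x → fold (f x) f n ≡ f (fold x f n)
fold-comm f zero    x = ≡.refl
fold-comm f (suc n) x = ≡.cong f (fold-comm f n x)

-- The skew ring Mat_m(K){σ} as a ring of additive maps of K^m.

record PerfectField c ℓ : Set (lsuc (c ⊔ ℓ)) where
  field
    K              : Field c ℓ
  open Field K
  field
    p              : ℕ
    characteristic : Exponents.Characteristic K p
    root           : Carrier → Carrier
    root-^p        : ∀ x → root x ^ p ≈ x
    -- Neither zero nor a root of unity: it makes K infinite in an explicit way and is fixed by no
    -- positive power of Frobenius.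
    θ              : Carrier
    θ-powers       : ∀ i j → θ ^ i ≈ θ ^ j → i ≡ j

module AdditiveMaps {c ℓ} (𝒫 : PerfectField c ℓ) (m : ℕ) where
  open PerfectField 𝒫
  open Field K hiding (zero)
  open FieldProperties K
  open Exponents.Characteristic characteristic
  open ℤSolver commutativeRing
  open VectorSetoid setoid using (_≋_; ≋-setoid)

  Point : Set c
  Point = Vector Carrier m

  Map : Set c
  Map = Point → Point

  infixl 6 _⊕_ _⊖_
  infixr 7 _⊙_

  _⊕_ _⊖_ : Point → Point → Point
  (x ⊕ y) i = x i + y i
  (x ⊖ y) i = x i - y i

  _⊙_ : Carrier → Point → Point
  (a ⊙ x) i = a * x i

  𝟘 : Point
  𝟘 _ = 0#

  ≋-refl : ∀ {x : Point} → x ≋ x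
  ≋-refl i = refl

  ≋-sym : ∀ {x y : Point} → x ≋ y → y ≋ x
  ≋-sym eq i = sym (eq i)

  ≋-trans : ∀ {x y z : Point} → x ≋ y → y ≋ z → x ≋ z
  ≋-trans eq₁ eq₂ i = trans (eq₁ i) (eq₂ i)

  ⊕-cong : ∀ {x x′ y y′ : Point} → x ≋ x′ → y ≋ y′ → x ⊕ y ≋ x′ ⊕ y′
  ⊕-cong eq₁ eq₂ i = +-cong (eq₁ i) (eq₂ i)

  ⊖-cong : ∀ {x x′ y y′ : Point} → x ≋ x′ → y ≋ y′ → x ⊖ y ≋ x′ ⊖ y′
  ⊖-cong eq₁ eq₂ i = +-cong (eq₁ i) (-‿cong (eq₂ i))

  ⊙-cong : ∀ {a b} {x y : Point} → a ≈ b → x ≋ y → a ⊙ x ≋ b ⊙ y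
  ⊙-cong eq₁ eq₂ i = *-cong eq₁ (eq₂ i)

  ⊙-zero : ∀ {a} {x : Point} → ¬ a ≈ 0# → a ⊙ x ≋ 𝟘 → x ≋ 𝟘
  ⊙-zero a≉0 eq i = xy≈0⇒y≈0 a≉0 (eq i)

  x⊖y≋𝟘⇒x≋y : ∀ {x y : Point} → x ⊖ y ≋ 𝟘 → x ≋ y
  x⊖y≋𝟘⇒x≋y eq i = x-y≈0⇒x≈y (eq i)

  ⊕-interchange : ∀ w x y z → (w ⊕ x) ⊕ (y ⊕ z) ≋ (w ⊕ y) ⊕ (x ⊕ z)
  ⊕-interchange w x y z i = solve 4 (λ a b c d → (a :+ b) :+ (c :+ d) := (a :+ c) :+ (b :+ d)) refl (w i) (x i) (y i) (z i)

  ⊕⊖-interchange : ∀ w x y z → (w ⊕ x) ⊖ (y ⊕ z) ≋ (w ⊖ y) ⊕ (x ⊖ z)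
  ⊕⊖-interchange w x y z i = solve 4 (λ a b c d → (a :+ b) :- (c :+ d) := (a :- c) :+ (b :- d)) refl (w i) (x i) (y i) (z i)

  open import Relation.Binary.Reasoning.Setoid (≋-setoid m)

  record Linear (M : Map) : Set (c ⊔ ℓ) where
    field
      cong        : ∀ {x y} → x ≋ y → M x ≋ M y
      additive    : ∀ x y → M (x ⊕ y) ≋ M x ⊕ M y
      homogeneous : ∀ a x → M (a ⊙ x) ≋ a ⊙ M x

    zero-homo : M 𝟘 ≋ 𝟘
    zero-homo = begin
      M 𝟘           ≈⟨ cong (λ i → sym (zeroˡ 0#)) ⟩
      M (0# ⊙ 𝟘)    ≈⟨ homogeneous 0# 𝟘 ⟩
      0# ⊙ M 𝟘      ≈⟨ (λ i → zeroˡ _) ⟩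
      𝟘             ∎

    subtractive : ∀ x y → M (x ⊖ y) ≋ M x ⊖ M y
    subtractive x y = begin
      M (x ⊖ y)              ≈⟨ cong (λ i → solve 2 (λ x y → x :- y := x :+ (:- con (ℤ.+ 1)) :* y) refl (x i) (y i)) ⟩
      M (x ⊕ - one ⊙ y)      ≈⟨ additive x (- one ⊙ y) ⟩
      M x ⊕ M (- one ⊙ y)    ≈⟨ ⊕-cong ≋-refl (homogeneous (- one) y) ⟩
      M x ⊕ - one ⊙ M y      ≈⟨ (λ i → solve 2 (λ x y → x :+ (:- con (ℤ.+ 1)) :* y := x :- y) refl (M x i) (M y i)) ⟩
      M x ⊖ M y              ∎
      where one = 1# + 0#

  open Linear

  zeroMap : Map
  zeroMap _ = 𝟘

  zeroMap-linear : Linear zeroMap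
  zeroMap-linear = record
    { cong        = λ _ → ≋-refl
    ; additive    = λ _ _ i → sym (+-identityʳ 0#)
    ; homogeneous = λ a _ i → sym (zeroʳ a)
    }

  id-linear : Linear (λ z → z)
  id-linear = record { cong = λ eq → eq ; additive = λ _ _ → ≋-refl ; homogeneous = λ _ _ → ≋-refl }

  ∘-linear : ∀ {M N} → Linear M → Linear N → Linear (λ z → M (N z))
  ∘-linear {M} {N} lM lN = record
    { cong        = λ eq → cong lM (cong lN eq)
    ; additive    = λ x y → ≋-trans (cong lM (additive lN x y)) (additive lM (N x) (N y))
    ; homogeneous = λ a x → ≋-trans (cong lM (homogeneous lN a x)) (homogeneous lM a (N x))
    }

  ⊕-linear : ∀ {M N} → Linear M → Linear N → Linear (λ z → M z ⊕ N z)
  ⊕-linear {M} {N} lM lN = record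
    { cong        = λ eq → ⊕-cong (cong lM eq) (cong lN eq)
    ; additive    = λ x y → ≋-trans (⊕-cong (additive lM x y) (additive lN x y))
        (⊕-interchange (M x) (M y) (N x) (N y))
    ; homogeneous = λ a x → ≋-trans (⊕-cong (homogeneous lM a x) (homogeneous lN a x)) (λ i → sym (distribˡ a _ _))
    }

  ⊙-linear : ∀ {M} a → Linear M → Linear (λ z → a ⊙ M z)
  ⊙-linear {M} a lM = record
    { cong        = λ eq → ⊙-cong refl (cong lM eq)
    ; additive    = λ x y → ≋-trans (⊙-cong refl (additive lM x y)) (λ i → distribˡ a _ _)
    ; homogeneous = λ b x → ≋-trans (⊙-cong refl (homogeneous lM b x))
        (λ i → solve 3 (λ a b x → a :* (b :* x) := b :* (a :* x)) refl a b (M x i))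
    }

  ⊖-linear : ∀ {M N} → Linear M → Linear N → Linear (λ z → M z ⊖ N z)
  ⊖-linear {M} {N} lM lN = record
    { cong        = λ eq → ⊖-cong (cong lM eq) (cong lN eq)
    ; additive    = λ x y → ≋-trans (⊖-cong (additive lM x y) (additive lN x y))
        (⊕⊖-interchange (M x) (M y) (N x) (N y))
    ; homogeneous = λ a x → ≋-trans (⊖-cong (homogeneous lM a x) (homogeneous lN a x))
        (λ i → solve 3 (λ a x y → a :* x :- a :* y := a :* (x :- y)) refl a (M x i) (N x i))
    }

  fold-linear : ∀ {M} → Linear M → ∀ n → Linear (λ z → fold z M n)
  fold-linear lM zero    = id-linear
  fold-linear lM (suc n) = ∘-linear lM (fold-linear lM n)

  F F⁻¹ : Map
  F z i   = φ (z i)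
  F⁻¹ z i = root (z i)

  root-cong : ∀ {x y} → x ≈ y → root x ≈ root y
  root-cong x≈y = φ-injective (trans (root-^p _) (trans x≈y (sym (root-^p _))))

  root-φ : ∀ x → root (φ x) ≈ x
  root-φ x = φ-injective (root-^p (φ x))

  F-cong : ∀ {x y} → x ≋ y → F x ≋ F y
  F-cong eq i = φ-cong (eq i)

  F-⊕ : ∀ x y → F (x ⊕ y) ≋ F x ⊕ F y
  F-⊕ x y i = φ-additive (x i) (y i)

  F-⊙ : ∀ a x → F (a ⊙ x) ≋ φ a ⊙ F x
  F-⊙ a x i = φ-* a (x i)

  F-𝟘 : F 𝟘 ≋ 𝟘
  F-𝟘 i = φ-0

  FF⁻¹ : ∀ z → F (F⁻¹ z) ≋ z
  FF⁻¹ z i = root-^p (z i)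

  F⁻¹F : ∀ z → F⁻¹ (F z) ≋ z
  F⁻¹F z i = root-φ (z i)

  F-injective : ∀ {x y} → F x ≋ F y → x ≋ y
  F-injective eq i = φ-injective (eq i)

  F⁻¹-cong : ∀ {x y} → x ≋ y → F⁻¹ x ≋ F⁻¹ y
  F⁻¹-cong eq i = root-cong (eq i)

  F⁻¹-⊕ : ∀ x y → F⁻¹ (x ⊕ y) ≋ F⁻¹ x ⊕ F⁻¹ y
  F⁻¹-⊕ x y = F-injective (≋-trans (FF⁻¹ _) (≋-sym (≋-trans (F-⊕ _ _) (⊕-cong (FF⁻¹ x) (FF⁻¹ y)))))

  F⁻¹-⊙ : ∀ a x → F⁻¹ (a ⊙ x) ≋ root a ⊙ F⁻¹ x
  F⁻¹-⊙ a x = F-injective (≋-trans (FF⁻¹ _) (≋-sym (≋-trans (F-⊙ _ _) (⊙-cong (root-^p a) (FF⁻¹ x)))))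

  -- The automorphism G ↦ σ G σ⁻¹. It is characterised by `conj G` ∘ `F` = `F` ∘ G and thus lets `F`
  -- move to the right of any map.
  conj : Map → Map
  conj G z = F (G (F⁻¹ z))

  conj-linear : ∀ {M} → Linear M → Linear (conj M)
  conj-linear {M} lM = record
    { cong        = λ eq → F-cong (cong lM (F⁻¹-cong eq))
    ; additive    = λ x y → ≋-trans (F-cong (≋-trans (cong lM (F⁻¹-⊕ x y)) (additive lM _ _))) (F-⊕ _ _)
    ; homogeneous = λ a x → ≋-trans (F-cong (≋-trans (cong lM (F⁻¹-⊙ a x)) (homogeneous lM _ _)))
        (≋-trans (F-⊙ _ _) (⊙-cong (root-^p a) ≋-refl))
    }

  -- AP n G: the map G is Mₙ₋₁ Fⁿ⁻¹ + … + M₁ F + M₀ with linear Mᵢ.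

  data AP : ℕ → Map → Set (c ⊔ ℓ) where
    nil  : ∀ {G} → (∀ z → G z ≋ 𝟘) → AP zero G
    cons : ∀ {n G M G′} → Linear M → AP n G′ → (∀ z → G z ≋ M z ⊕ G′ (F z)) → AP (suc n) G

  IsAP : Map → Set (c ⊔ ℓ)
  IsAP G = ∃ λ n → AP n G

  AP-resp : ∀ {n G H} → (∀ z → H z ≋ G z) → AP n G → AP n H
  AP-resp eq (nil G≋)       = nil λ z → ≋-trans (eq z) (G≋ z)
  AP-resp eq (cons lM g G≋) = cons lM g λ z → ≋-trans (eq z) (G≋ z)

  AP-cong : ∀ {n G} → AP n G → ∀ {x y} → x ≋ y → G x ≋ G y
  AP-cong (nil G≋)       eq = ≋-trans (G≋ _) (≋-sym (G≋ _))
  AP-cong (cons lM g G≋) eq = ≋-trans (G≋ _) (≋-trans (⊕-cong (cong lM eq) (AP-cong g (F-cong eq))) (≋-sym (G≋ _)))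

  AP-additive : ∀ {n G} → AP n G → ∀ x y → G (x ⊕ y) ≋ G x ⊕ G y
  AP-additive (nil G≋) x y = ≋-trans (G≋ _) (≋-trans (λ i → sym (+-identityʳ 0#)) (⊕-cong (≋-sym (G≋ x)) (≋-sym (G≋ y))))
  AP-additive {G = G} (cons {M = M} {G′} lM g G≋) x y = begin
    G (x ⊕ y)                               ≈⟨ G≋ (x ⊕ y) ⟩
    M (x ⊕ y) ⊕ G′ (F (x ⊕ y))              ≈⟨ ⊕-cong (additive lM x y) (≋-trans (AP-cong g (F-⊕ x y)) (AP-additive g (F x) (F y))) ⟩
    (M x ⊕ M y) ⊕ (G′ (F x) ⊕ G′ (F y))     ≈⟨ ⊕-interchange (M x) (M y) (G′ (F x)) (G′ (F y)) ⟩
    (M x ⊕ G′ (F x)) ⊕ (M y ⊕ G′ (F y))     ≈⟨ ⊕-cong (≋-sym (G≋ x)) (≋-sym (G≋ y)) ⟩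
    G x ⊕ G y                               ∎

  AP-𝟘 : ∀ {n G} → AP n G → G 𝟘 ≋ 𝟘
  AP-𝟘 (nil G≋)       = G≋ 𝟘
  AP-𝟘 (cons lM g G≋) = ≋-trans (G≋ 𝟘) (≋-trans (⊕-cong (zero-homo lM) (≋-trans (AP-cong g F-𝟘) (AP-𝟘 g))) (λ i → +-identityʳ 0#))

  AP-⊕ : ∀ {n G H} → AP n G → AP n H → AP n (λ z → G z ⊕ H z)
  AP-⊕ (nil G≋)       (nil H≋)       = nil λ z → ≋-trans (⊕-cong (G≋ z) (H≋ z)) (λ i → +-identityʳ 0#)
  AP-⊕ (cons {M = M} {G′} lM g G≋) (cons {M = N} {H′} lN h H≋) = cons (⊕-linear lM lN) (AP-⊕ g h) λ z →
    ≋-trans (⊕-cong (G≋ z) (H≋ z)) (⊕-interchange (M z) (G′ (F z)) (N z) (H′ (F z)))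

  AP-pad : ∀ {n G} → AP n G → AP (suc n) G
  AP-pad (nil G≋)       = cons zeroMap-linear (nil (λ _ → ≋-refl)) λ z → ≋-trans (G≋ z) (λ i → sym (+-identityʳ 0#))
  AP-pad (cons lM g G≋) = cons lM (AP-pad g) G≋

  AP-pads : ∀ {n G} k → AP n G → AP (k ℕ.+ n) G
  AP-pads zero    g = g
  AP-pads (suc k) g = AP-pad (AP-pads k g)

  IsAP-⊕ : ∀ {G H} → IsAP G → IsAP H → IsAP (λ z → G z ⊕ H z)
  IsAP-⊕ {G} {H} (n , g) (k , h) = k ℕ.+ n , AP-⊕ (AP-pads k g) (≡.subst (λ n → AP n H) (ℕ.+-comm n k) (AP-pads n h))

  AP-scale : ∀ {n G} a b → AP n G → AP n (λ z → a ⊙ G (b ⊙ z))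
  AP-scale a b (nil G≋)       = nil λ z → ≋-trans (⊙-cong refl (G≋ _)) (λ i → zeroʳ a)
  AP-scale a b (cons {M = M} {G′} lM g G≋) = cons (⊙-linear (a * b) lM) (AP-scale a (φ b) g) λ z →
    ≋-trans (⊙-cong refl (≋-trans (G≋ (b ⊙ z)) (⊕-cong (homogeneous lM b z) (AP-cong g (F-⊙ b z)))))
      (λ i → solve 4 (λ a b x y → a :* (b :* x :+ y) := a :* b :* x :+ a :* y) refl a b (M z i) (G′ (φ b ⊙ F z) i))

  AP-⊖ : ∀ {n G H} → AP n G → AP n H → AP n (λ z → G z ⊖ H z)
  AP-⊖ {G = G} {H} g h = AP-resp (λ z i → trans (+-congˡ (-‿cong (AP-cong h (λ i → sym (*-identityˡ (z i))) i)))
    (solve 2 (λ x y → x :- y := x :+ :- con (ℤ.+ 1) :* y) refl (G z i) (H (1# ⊙ z) i))) (AP-⊕ g (AP-scale (- (1# + 0#)) 1# h))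

  IsAP-⊖ : ∀ {G H} → IsAP G → IsAP H → IsAP (λ z → G z ⊖ H z)
  IsAP-⊖ {G} {H} (n , g) (k , h) = k ℕ.+ n , AP-⊖ (AP-pads k g) (≡.subst (λ n → AP n H) (ℕ.+-comm n k) (AP-pads n h))

  linear∘AP : ∀ {n M G} → Linear M → AP n G → AP n (λ z → M (G z))
  linear∘AP lM (nil G≋)       = nil λ z → ≋-trans (cong lM (G≋ z)) (zero-homo lM)
  linear∘AP lM (cons lN g G≋) = cons (∘-linear lM lN) (linear∘AP lM g) λ z → ≋-trans (cong lM (G≋ z)) (additive lM _ _)

  linear⇒AP : ∀ {M} → Linear M → IsAP M
  linear⇒AP lM = 1 , cons lM (nil λ _ → ≋-refl) λ z i → sym (+-identityʳ _)

  IsAP-F : ∀ {G} → IsAP G → IsAP (λ z → G (F z))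
  IsAP-F (n , g) = suc n , cons zeroMap-linear g λ z i → sym (+-identityˡ _)

  fold-F : ∀ k z i → fold z F k i ≡ fold (z i) φ k
  fold-F zero    z i = ≡.refl
  fold-F (suc k) z i = ≡.cong φ (fold-F k z i)

  IsAP-Fᵏ : ∀ k {G} → IsAP G → IsAP (λ z → G (fold z F k))
  IsAP-Fᵏ zero    G = G
  IsAP-Fᵏ (suc k) G = IsAP-Fᵏ k (IsAP-F G)

  AP-conj : ∀ {n G} → AP n G → AP n (conj G)
  AP-conj (nil G≋)                       = nil λ z → ≋-trans (F-cong (G≋ _)) F-𝟘
  AP-conj (cons {G′ = G′} lM g G≋) = cons (conj-linear lM) (AP-conj g) λ z → ≋-trans (F-cong (G≋ _)) (≋-trans (F-⊕ _ _)
    (⊕-cong ≋-refl (F-cong (AP-cong g (≋-trans (FF⁻¹ z) (≋-sym (F⁻¹F z)))))))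

  IsAP-conj : ∀ {G} → IsAP G → IsAP (conj G)
  IsAP-conj (n , g) = n , AP-conj g

  IsAP-resp : ∀ {G H} → (∀ z → H z ≋ G z) → IsAP G → IsAP H
  IsAP-resp eq (n , g) = n , AP-resp eq g

  -- (M + G′ F) H = M H + G′ (`conj H`) F, which has `F` on the right again.
  AP∘IsAP : ∀ {n G H} → AP n G → IsAP H → IsAP (λ z → G (H z))
  AP∘IsAP (nil G≋) h = 0 , nil λ z → G≋ _
  AP∘IsAP {G = G} {H} (cons {M = M} {G′} lM g G≋) (k , h) = IsAP-resp
    (λ z → ≋-trans (G≋ (H z)) (⊕-cong ≋-refl (AP-cong g (F-cong (AP-cong h (≋-sym (F⁻¹F z)))))))
    (IsAP-⊕ (k , linear∘AP lM h) (IsAP-F (AP∘IsAP g (IsAP-conj (k , h)))))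

  IsAP-∘ : ∀ {G H} → IsAP G → IsAP H → IsAP (λ z → G (H z))
  IsAP-∘ (_ , g) h = AP∘IsAP g h

  private
    _^φ_ : Carrier → ℕ → Carrier
    a ^φ k = fold a φ k

    fold-F-⊙ : ∀ k a z → fold (a ⊙ z) F k ≋ (a ^φ k) ⊙ fold z F k
    fold-F-⊙ zero    a z = ≋-refl
    fold-F-⊙ (suc k) a z = ≋-trans (F-cong (fold-F-⊙ k a z)) (F-⊙ _ _)

  open SemiringExp semiring using (^-assocʳ; ^-congʳ)

  fold-φ : ∀ a k → fold a φ k ≈ a ^ (p ℕ.^ k)
  fold-φ a zero    = sym (*-identityʳ a)
  fold-φ a (suc k) = trans (φ-cong (fold-φ a k)) (trans (^-assocʳ a (p ℕ.^ k) p) (^-congʳ a (ℕ.*-comm (p ℕ.^ k) p)))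

  -- x = x^(p^(k+1)) would identify the exponents 1 and p^(k+1) > 1. It is applied to `θ` here and
  -- later to a(T).
  not-fixed : ∀ {x} → (∀ i j → x ^ i ≈ x ^ j → i ≡ j) → ∀ k → ¬ x ≈ fold x φ (suc k)
  not-fixed {x} powers k x≈ = ℕ.<⇒≢ (ℕ.≤-<-trans (s≤s z≤n) (n<p^n (suc k)))
    (powers 1 (p ℕ.^ suc k) (trans (*-identityʳ x) (trans x≈ (fold-φ x (suc k)))))

  -- Subtracting F(θ z) from a multiple of F(z) kills one term of the expansion, by θ ≠ θ^(p^k).
  independent : ∀ {n M G} k → Linear M → AP n G → (∀ z → M z ⊕ G (fold z F (suc k)) ≋ 𝟘) → ∀ z → M z ≋ 𝟘
  independent {M = M} k lM (nil G≋) eq z = ≋-trans (λ i → sym (+-identityʳ _)) (≋-trans (⊕-cong ≋-refl (≋-sym (G≋ _))) (eq z))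
  independent {M = M} {G} k lM (cons {M = N} {G′} lN g G≋) eq z =
    ⊙-zero (λ eq → not-fixed θ-powers k (x-y≈0⇒x≈y eq)) (independent (suc k) (⊙-linear (θ - θ′) lM) (AP-⊖ (AP-resp (λ w i → sym (*-identityˡ _)) (AP-scale 1# θ″ g)) (AP-resp (λ w → ⊙-cong refl (AP-cong g (λ i → sym (*-identityˡ _)))) (AP-scale θ′ 1# g)))
      eq′ z)
    where
      θ′ θ″ : Carrier
      θ′ = fold θ φ (suc k)
      θ″ = fold θ φ (suc (suc k))
      eq′ : ∀ z → (θ - θ′) ⊙ M z ⊕ (G′ (θ″ ⊙ fold z F (suc (suc k))) ⊖ θ′ ⊙ G′ (fold z F (suc (suc k)))) ≋ 𝟘
      eq′ z = begin
        (θ - θ′) ⊙ M z ⊕ (g₁ ⊖ θ′ ⊙ g₂)                              ≈⟨ (λ i → solve 6 (λ θ θ′ x y g₁ g₂ → (θ :- θ′) :* x :+ (g₁ :- θ′ :* g₂) := (θ :* x :+ (θ′ :* y :+ g₁)) :- θ′ :* (x :+ (y :+ g₂))) refl θ θ′ (M z i) (N w i) (g₁ i) (g₂ i)) ⟩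
        (θ ⊙ M z ⊕ (θ′ ⊙ N w ⊕ g₁)) ⊖ θ′ ⊙ (M z ⊕ (N w ⊕ g₂))        ≈⟨ ⊖-cong (⊕-cong (≋-sym (homogeneous lM θ z)) (≋-sym Gθz)) (⊙-cong refl (⊕-cong ≋-refl (≋-sym (G≋ w)))) ⟩
        (M (θ ⊙ z) ⊕ G (fold (θ ⊙ z) F (suc k))) ⊖ θ′ ⊙ (M z ⊕ G w)  ≈⟨ ⊖-cong (eq (θ ⊙ z)) (⊙-cong refl (eq z)) ⟩
        𝟘 ⊖ θ′ ⊙ 𝟘                                                   ≈⟨ (λ i → solve 1 (λ θ → con (ℤ.+ 0) :- θ :* con (ℤ.+ 0) := con (ℤ.+ 0)) refl θ′) ⟩
        𝟘                                                            ∎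
        where
          w = fold z F (suc k)
          g₁ = G′ (θ″ ⊙ F w)
          g₂ = G′ (F w)
          Gθz : G (fold (θ ⊙ z) F (suc k)) ≋ θ′ ⊙ N w ⊕ g₁
          Gθz = begin
            G (fold (θ ⊙ z) F (suc k))   ≈⟨ AP-cong (cons lN g G≋) (fold-F-⊙ (suc k) θ z) ⟩
            G (θ′ ⊙ w)                   ≈⟨ G≋ _ ⟩
            N (θ′ ⊙ w) ⊕ G′ (F (θ′ ⊙ w)) ≈⟨ ⊕-cong (homogeneous lN θ′ w) (AP-cong g (F-⊙ θ′ w)) ⟩
            θ′ ⊙ N w ⊕ g₁                ∎

  -- M is the coefficient of σ⁰ in G, in other words the differential of G at 0.
  record _∼_ (G M : Map) : Set (c ⊔ ℓ) where
    constructor linearPart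
    field
      {tail}   : Map
      linear   : Linear M
      tail-AP  : IsAP tail
      equation : ∀ z → G z ≋ M z ⊕ tail (F z)

  open _∼_ public

  ∼⇒IsAP : ∀ {G M} → G ∼ M → IsAP G
  ∼⇒IsAP (linearPart lM (n , g) eq) = suc n , cons lM g eq

  IsAP⇒∼ : ∀ {G} → IsAP G → ∃ λ M → G ∼ M
  IsAP⇒∼ (_ , nil G≋)       = zeroMap , linearPart zeroMap-linear (0 , nil λ _ → ≋-refl) λ z → ≋-trans (G≋ z) (λ i → sym (+-identityʳ 0#))
  IsAP⇒∼ (_ , cons lM g G≋) = _ , linearPart lM (_ , g) G≋

  -- The difference has an expansion that is identically zero, so its constant term vanishes by
  -- `independent`. Every equation between additive maps passes to differentials through this lemma.
  ∼-unique : ∀ {G H M N} → G ∼ M → H ∼ N → (∀ z → G z ≋ H z) → ∀ z → M z ≋ N z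
  ∼-unique {G} {H} {M} {N} (linearPart {G′} lM g G≋) (linearPart {H′} lN h H≋) G≋H z =
    x⊖y≋𝟘⇒x≋y (independent 0 (⊖-linear lM lN) (proj₂ (IsAP-⊖ g h)) eq z)
    where
      eq : ∀ z → (M z ⊖ N z) ⊕ (G′ (F z) ⊖ H′ (F z)) ≋ 𝟘
      eq z = begin
        (M z ⊖ N z) ⊕ (G′ (F z) ⊖ H′ (F z))   ≈⟨ ⊕⊖-interchange (M z) (G′ (F z)) (N z) (H′ (F z)) ⟨
        (M z ⊕ G′ (F z)) ⊖ (N z ⊕ H′ (F z))   ≈⟨ ⊖-cong (≋-sym (G≋ z)) (≋-sym (H≋ z)) ⟩
        G z ⊖ H z                             ≈⟨ (λ i → x≈y⇒x-y≈0 (G≋H z i)) ⟩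
        𝟘                                     ∎

  -- The maps without constant term form a two-sided ideal, since `F` H = (`conj H`) `F`; hence
  -- constant terms multiply.
  ∼-∘ : ∀ {G H M N} → G ∼ M → H ∼ N → (λ z → G (H z)) ∼ (λ z → M (N z))
  ∼-∘ {G} {H} {M} {N} (linearPart {G′} lM g G≋) H∼N@(linearPart {H′} lN (k , h) H≋) = linearPart (∘-linear lM lN)
    (IsAP-⊕ (k , linear∘AP lM h) (IsAP-∘ g (IsAP-conj (∼⇒IsAP H∼N))))
    λ z → begin
      G (H z)                                                   ≈⟨ G≋ (H z) ⟩
      M (H z) ⊕ G′ (F (H z))                                    ≈⟨ ⊕-cong (≋-trans (cong lM (H≋ z)) (additive lM _ _)) (AP-cong (proj₂ g) (F-cong (AP-cong (proj₂ (∼⇒IsAP H∼N)) (≋-sym (F⁻¹F z))))) ⟩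
      (M (N z) ⊕ M (H′ (F z))) ⊕ G′ (conj H (F z))              ≈⟨ (λ i → +-assoc _ _ _) ⟩
      M (N z) ⊕ (M (H′ (F z)) ⊕ G′ (conj H (F z)))              ∎

  linear∼ : ∀ {M} → Linear M → M ∼ M
  linear∼ lM = linearPart lM (0 , nil λ _ → ≋-refl) λ z i → sym (+-identityʳ _)

  ∼-⊕ : ∀ {G H M N} → G ∼ M → H ∼ N → (λ z → G z ⊕ H z) ∼ (λ z → M z ⊕ N z)
  ∼-⊕ {M = M} {N} (linearPart {G′} lM g G≋) (linearPart {H′} lN h H≋) = linearPart (⊕-linear lM lN) (IsAP-⊕ g h) λ z →
    ≋-trans (⊕-cong (G≋ z) (H≋ z)) (⊕-interchange (M z) (G′ (F z)) (N z) (H′ (F z)))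

  ∼-⊖ : ∀ {G H M N} → G ∼ M → H ∼ N → (λ z → G z ⊖ H z) ∼ (λ z → M z ⊖ N z)
  ∼-⊖ {M = M} {N} (linearPart {G′} lM g G≋) (linearPart {H′} lN h H≋) = linearPart (⊖-linear lM lN) (IsAP-⊖ g h) λ z →
    ≋-trans (⊖-cong (G≋ z) (H≋ z)) (⊕⊖-interchange (M z) (G′ (F z)) (N z) (H′ (F z)))

  ∼-conj : ∀ {G M} → G ∼ M → conj G ∼ conj M
  ∼-conj (linearPart lM g G≋) = linearPart (conj-linear lM) (IsAP-conj g) λ z → ≋-trans (F-cong (G≋ _)) (≋-trans (F-⊕ _ _)
    (⊕-cong ≋-refl (F-cong (AP-cong (proj₂ g) (≋-trans (FF⁻¹ z) (≋-sym (F⁻¹F z)))))))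

  ∼-resp : ∀ {G H M} → (∀ z → H z ≋ G z) → G ∼ M → H ∼ M
  ∼-resp eq (linearPart lM g G≋) = linearPart lM g λ z → ≋-trans (eq z) (G≋ z)

  ∼-respʳ : ∀ {G M N} → (∀ z → M z ≋ N z) → Linear N → G ∼ M → G ∼ N
  ∼-respʳ eq lN (linearPart lM g G≋) = linearPart lN g λ z → ≋-trans (G≋ z) (⊕-cong (eq z) ≋-refl)

-- Intertwiners between operators with different eigenvalues vanish.

module Intertwining {c ℓ} (𝒫 : PerfectField c ℓ) (m : ℕ) where
  open PerfectField 𝒫
  open Field K hiding (zero)
  open FieldProperties K
  open Exponents.Characteristic characteristic
  open ℤSolver commutativeRing
  open VectorSetoid setoid using (_≋_; ≋-setoid)
  open AdditiveMaps 𝒫 m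
  open Linear
  open import Relation.Binary.Reasoning.Setoid (≋-setoid m)

  -- Downward induction on k and b through a Aᵏ M Bᵇ = Aᵏ⁺¹ M Bᵇ − Aᵏ M Bᵇ⁺¹.
  sylvester : ∀ {A B M : Map} {a} n → Linear A → Linear M → ¬ a ≈ 0# →
    (∀ v → a ⊙ M v ≋ A (M v) ⊖ M (B v)) →
    (∀ v → fold (M v) A n ≋ 𝟘) → (∀ v → M (fold v B n) ≋ 𝟘) → ∀ v → M v ≋ 𝟘
  sylvester {A} {B} {M} {a} n lA lM a≉0 eq An≋0 Bn≋0 v = outer n 0 (ℕ.+-identityʳ n) v
    where
      eqᵏ : ∀ k v → a ⊙ fold (M v) A k ≋ fold (M v) A (suc k) ⊖ fold (M (B v)) A k
      eqᵏ k v = begin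
        a ⊙ fold (M v) A k                              ≈⟨ homogeneous lAᵏ a (M v) ⟨
        fold (a ⊙ M v) A k                              ≈⟨ cong lAᵏ (eq v) ⟩
        fold (A (M v) ⊖ M (B v)) A k                    ≈⟨ subtractive lAᵏ _ _ ⟩
        fold (A (M v)) A k ⊖ fold (M (B v)) A k         ≡⟨ ≡.cong (_⊖ fold (M (B v)) A k) (fold-comm A k (M v)) ⟩
        fold (M v) A (suc k) ⊖ fold (M (B v)) A k       ∎
        where lAᵏ = fold-linear lA k

      outer : ∀ i k → i ℕ.+ k ≡ n → ∀ v → fold (M v) A k ≋ 𝟘
      outer zero    k ≡.refl v = An≋0 v
      outer (suc i) k i+k≡n  v = inner n 0 (ℕ.+-identityʳ n)
        where
          inner : ∀ j b → j ℕ.+ b ≡ n → fold (M (fold v B b)) A k ≋ 𝟘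
          inner zero    b ≡.refl = ≋-trans (cong (fold-linear lA k) (Bn≋0 v)) (zero-homo (fold-linear lA k))
          inner (suc j) b j+b≡n  = ⊙-zero a≉0 (begin
            a ⊙ fold (M u) A k                              ≈⟨ eqᵏ k u ⟩
            fold (M u) A (suc k) ⊖ fold (M (B u)) A k       ≈⟨ ⊖-cong (outer i (suc k) (≡.trans (ℕ.+-suc i k) i+k≡n) u) (inner j (suc b) (≡.trans (ℕ.+-suc j b) j+b≡n)) ⟩
            𝟘 ⊖ 𝟘                                           ≈⟨ (λ i → -‿inverseʳ 0#) ⟩
            𝟘                                               ∎)
            where u = fold v B b

  fold-respects : ∀ {M N : Map} → Linear N → (∀ z → M z ≋ N z) → ∀ n z → fold z M n ≋ fold z N n
  fold-respects lN eq zero    z = ≋-refl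
  fold-respects lN eq (suc n) z = ≋-trans (eq _) (cong lN (fold-respects lN eq n z))

  shifted : Map → Carrier → Map
  shifted α a v = α v ⊖ a ⊙ v

  shifted-linear : ∀ {α a} → Linear α → Linear (shifted α a)
  shifted-linear {α} {a} lα = ⊖-linear lα (⊙-linear a id-linear)

  -- The data to the right of X, all of which change under conjugation. A has `a` as its only
  -- eigenvalue at the level of differentials, and `invariant` says that the image of the projection
  -- G₀ is stable under A₀. In the application G is 1 - E or a conjugate of it.
  record Unipotent (n : ℕ) (A G : Map) (a : Carrier) : Set (c ⊔ ℓ) where
    field
      {A₀ G₀}    : Map
      A∼         : A ∼ A₀
      G∼         : G ∼ G₀
      idempotent : ∀ z → G₀ (G₀ z) ≋ G₀ z
      invariant  : ∀ z → G₀ (A₀ (G₀ z)) ≋ A₀ (G₀ z)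
      nilpotent  : ∀ z → fold z (shifted A₀ a) n ≋ 𝟘

    A₀-linear = linear A∼
    G₀-linear = linear G∼
    Y-linear = shifted-linear {a = a} A₀-linear

  Unipotent-conj : ∀ {n A G a} → Unipotent n A G a → Unipotent n (conj A) (conj G) (φ a)
  Unipotent-conj {n} {A} {G} {a} U = record
    { A∼ = ∼-conj A∼
    ; G∼ = ∼-conj G∼
    ; idempotent = λ z → F-cong (≋-trans (cong G₀-linear (F⁻¹F _)) (idempotent _))
    ; invariant  = λ z → F-cong (≋-trans (cong G₀-linear (≋-trans (F⁻¹F _) (cong A₀-linear (F⁻¹F _))))
                     (≋-trans (invariant _) (cong A₀-linear (≋-sym (F⁻¹F _)))))
    ; nilpotent  = λ z → ≋-trans (conj-fold n z) (≋-trans (F-cong (nilpotent _)) F-𝟘)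
    }
    where
      open Unipotent U
      conj-fold : ∀ k z → fold z (shifted (conj A₀) (φ a)) k ≋ F (fold (F⁻¹ z) (shifted A₀ a) k)
      conj-fold zero    z = ≋-sym (FF⁻¹ z)
      conj-fold (suc k) z = begin
        shifted (conj A₀) (φ a) (fold z (shifted (conj A₀) (φ a)) k)  ≈⟨ cong (shifted-linear {a = φ a} (conj-linear A₀-linear)) (conj-fold k z) ⟩
        shifted (conj A₀) (φ a) (F u)                                 ≈⟨ ⊖-cong (F-cong (cong A₀-linear (F⁻¹F u))) ≋-refl ⟩
        F (A₀ u) ⊖ φ a ⊙ F u                                          ≈⟨ (λ i → sym (trans (φ-additive _ _) (+-congˡ (trans (φ-neg _) (-‿cong (φ-* _ _)))))) ⟩
        F (A₀ u ⊖ a ⊙ u)                                              ∎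
        where u = fold (F⁻¹ z) (shifted A₀ a) k

  -- X = E X G carries the operator A on the image of G to the operator E α on the image of E, which
  -- is α acting on the quotient by ker E.
  record Intertwines (E α X A G : Map) : Set (c ⊔ ℓ) where
    field
      left  : ∀ z → E (X z) ≋ X z
      right : ∀ z → X (G z) ≋ X z
      both  : ∀ z → E (α (X z)) ≋ X (A (G z))

  -- As `F` is bijective, X = X′ `F` gives X′ = X `F⁻¹`. The operators on the left of X are
  -- untouched, those on the right are conjugated.
  untwist : ∀ {E α X A G X′} → IsAP E → IsAP α → IsAP A → IsAP X → IsAP X′ → (∀ z → X z ≋ X′ (F z)) →
    Intertwines E α X A G → Intertwines E α X′ (conj A) (conj G)
  untwist {E} {α} {X} {A} {G} {X′} (_ , E-AP) (_ , α-AP) (_ , A-AP) (_ , x) (_ , x′) X≋X′F I = record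
    { left  = λ u → begin
        E (X′ u)                ≈⟨ AP-cong E-AP (X′≋ u) ⟩
        E (X (F⁻¹ u))           ≈⟨ left _ ⟩
        X (F⁻¹ u)               ≈⟨ X′≋ u ⟨
        X′ u                    ∎
    ; right = λ u → begin
        X′ (conj G u)           ≈⟨ X≋X′F _ ⟨
        X (G (F⁻¹ u))           ≈⟨ right _ ⟩
        X (F⁻¹ u)               ≈⟨ X′≋ u ⟨
        X′ u                    ∎
    ; both  = λ u → begin
        E (α (X′ u))                 ≈⟨ AP-cong E-AP (AP-cong α-AP (X′≋ u)) ⟩
        E (α (X (F⁻¹ u)))            ≈⟨ both _ ⟩
        X (A (G (F⁻¹ u)))            ≈⟨ AP-cong x (AP-cong A-AP (≋-sym (F⁻¹F _))) ⟩
        X (A (F⁻¹ (conj G u)))       ≈⟨ X≋X′F _ ⟩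
        X′ (conj A (conj G u))       ∎
    }
    where
      open Intertwines I
      X′≋ : ∀ u → X′ u ≋ X (F⁻¹ u)
      X′≋ u = ≋-trans (AP-cong x′ (≋-sym (FF⁻¹ u))) (≋-sym (X≋X′F _))

  -- E, α and the eigenvalue e stay fixed throughout the descent; only A, G and a are conjugated.
  -- `E₀α₀E₀` expresses that ker E₀ is stable under α₀.
  module _ {n : ℕ} {E α E₀ α₀ : Map} {e : Carrier} (E∼ : E ∼ E₀) (α∼ : α ∼ α₀)
      (E₀E₀ : ∀ z → E₀ (E₀ z) ≋ E₀ z) (E₀α₀E₀ : ∀ z → E₀ (α₀ (E₀ z)) ≋ E₀ (α₀ z))
      (nil₀ : ∀ z → fold z (shifted α₀ e) n ≋ 𝟘) where
    private
      lE = linear E∼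
      lα = linear α∼
      Y = shifted α₀ e
      lY = shifted-linear {a = e} lα

    -- With Y = α₀ - e and Y′ = A₀ - a the constant terms satisfy (a - e) M = (E₀ Y) M - M (Y′ G₀).
    -- Here E₀ Y is nilpotent on the image of E₀, as ker E₀ is Y-stable, and Y′ G₀ is nilpotent on
    -- the image of G₀, which is Y′-stable. So `sylvester` applies.
    intertwiner-linearPart : ∀ {X A G a M} → Unipotent n A G a → ¬ e ≈ a → X ∼ M →
      Intertwines E α X A G → ∀ z → M z ≋ 𝟘
    intertwiner-linearPart {X} {A} {G} {a} {M} U e≉a X∼ I = sylvester n (∘-linear lE lY) lM
      (λ eq → e≉a (sym (x-y≈0⇒x≈y eq))) equation′ left-nilpotent right-nilpotent
      where
        open Unipotent U
        open Intertwines I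
        lM = linear X∼
        Y′ = shifted A₀ a
        B = λ v → Y′ (G₀ v)

        E₀M : ∀ v → E₀ (M v) ≋ M v
        E₀M = ∼-unique (∼-∘ E∼ X∼) X∼ left

        MG₀ : ∀ v → M (G₀ v) ≋ M v
        MG₀ = ∼-unique (∼-∘ X∼ G∼) X∼ right

        E₀α₀M : ∀ v → E₀ (α₀ (M v)) ≋ M (A₀ (G₀ v))
        E₀α₀M = ∼-unique (∼-∘ E∼ (∼-∘ α∼ X∼)) (∼-∘ X∼ (∼-∘ A∼ G∼)) both

        E₀Y : ∀ v → E₀ (Y v) ≋ E₀ (α₀ v) ⊖ e ⊙ E₀ v
        E₀Y v = ≋-trans (subtractive lE _ _) (⊖-cong ≋-refl (homogeneous lE e v))

        equation′ : ∀ v → (a - e) ⊙ M v ≋ E₀ (Y (M v)) ⊖ M (B v)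
        equation′ v = begin
          (a - e) ⊙ M v                                               ≈⟨ (λ i → solve 4 (λ a e x y → (a :- e) :* x := (y :- e :* x) :- (y :- a :* x)) refl a e (M v i) (M (A₀ (G₀ v)) i)) ⟩
          (M (A₀ (G₀ v)) ⊖ e ⊙ M v) ⊖ (M (A₀ (G₀ v)) ⊖ a ⊙ M v)       ≈⟨ ⊖-cong (⊖-cong (≋-sym (E₀α₀M v)) (⊙-cong refl (≋-sym (E₀M v)))) (⊖-cong ≋-refl (⊙-cong refl (≋-sym (MG₀ v)))) ⟩
          (E₀ (α₀ (M v)) ⊖ e ⊙ E₀ (M v)) ⊖ (M (A₀ (G₀ v)) ⊖ a ⊙ M (G₀ v))  ≈⟨ ⊖-cong (≋-sym (E₀Y (M v))) (⊖-cong ≋-refl (≋-sym (homogeneous lM a (G₀ v)))) ⟩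
          E₀ (Y (M v)) ⊖ (M (A₀ (G₀ v)) ⊖ M (a ⊙ G₀ v))               ≈⟨ ⊖-cong ≋-refl (≋-sym (subtractive lM _ _)) ⟩
          E₀ (Y (M v)) ⊖ M (B v)                                      ∎

        E₀YE₀ : ∀ v → E₀ (Y (E₀ v)) ≋ E₀ (Y v)
        E₀YE₀ v = ≋-trans (E₀Y (E₀ v)) (≋-trans (⊖-cong (E₀α₀E₀ v) (⊙-cong refl (E₀E₀ v))) (≋-sym (E₀Y v)))

        left-fold : ∀ k v → fold (E₀ v) (λ u → E₀ (Y u)) k ≋ E₀ (fold v Y k)
        left-fold zero    v = ≋-refl
        left-fold (suc k) v = ≋-trans (cong (∘-linear lE lY) (left-fold k v)) (E₀YE₀ _)

        left-nilpotent : ∀ v → fold (M v) (λ u → E₀ (Y u)) n ≋ 𝟘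
        left-nilpotent v = begin
          fold (M v) (λ u → E₀ (Y u)) n        ≈⟨ cong (fold-linear (∘-linear lE lY) n) (≋-sym (E₀M v)) ⟩
          fold (E₀ (M v)) (λ u → E₀ (Y u)) n   ≈⟨ left-fold n (M v) ⟩
          E₀ (fold (M v) Y n)                  ≈⟨ cong lE (nil₀ (M v)) ⟩
          E₀ 𝟘                                 ≈⟨ zero-homo lE ⟩
          𝟘                                    ∎

        G₀B : ∀ v → G₀ (B v) ≋ B v
        G₀B v = begin
          G₀ (A₀ (G₀ v) ⊖ a ⊙ G₀ v)           ≈⟨ subtractive G₀-linear _ _ ⟩
          G₀ (A₀ (G₀ v)) ⊖ G₀ (a ⊙ G₀ v)      ≈⟨ ⊖-cong (invariant v) (≋-trans (homogeneous G₀-linear a _) (⊙-cong refl (idempotent v))) ⟩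
          A₀ (G₀ v) ⊖ a ⊙ G₀ v                ∎

        right-fold : ∀ k v → G₀ (fold v B k) ≋ fold (G₀ v) Y′ k
        right-fold zero    v = ≋-refl
        right-fold (suc k) v = ≋-trans (G₀B _) (cong Y-linear (right-fold k v))

        right-nilpotent : ∀ v → M (fold v B n) ≋ 𝟘
        right-nilpotent v = begin
          M (fold v B n)              ≈⟨ MG₀ _ ⟨
          M (G₀ (fold v B n))         ≈⟨ cong lM (≋-trans (right-fold n v) (nilpotent _)) ⟩
          M 𝟘                         ≈⟨ zero-homo lM ⟩
          𝟘                           ∎

    -- Induction on the number of terms of X: the constant term vanishes, X is divided by `F`, and
    -- the eigenvalue on the right becomes a^p, still different from e.
    intertwiner-zero : ∀ {d X A G a} → AP d X → Unipotent n A G a → (∀ k → ¬ e ≈ fold a φ k) →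
      Intertwines E α X A G → ∀ z → X z ≋ 𝟘
    intertwiner-zero (nil X≋) U e≉ I z = X≋ z
    intertwiner-zero {a = a} x@(cons lM x′ X≋) U e≉ I z =
      ≋-trans (X≋X′F z) (intertwiner-zero x′ (Unipotent-conj U) (λ k eq → e≉ (suc k) (trans eq (reflexive (fold-comm φ k a))))
        (untwist (∼⇒IsAP E∼) (∼⇒IsAP α∼) (∼⇒IsAP A∼) (_ , x) (_ , x′) X≋X′F I) (F z))
      where
        open Unipotent U
        M≋𝟘 = intertwiner-linearPart U (e≉ 0) (linearPart lM (_ , x′) X≋) I
        X≋X′F = λ z → ≋-trans (X≋ z) (≋-trans (⊕-cong (M≋𝟘 z) ≋-refl) (λ i → +-identityˡ _))

  AP-subtractive : ∀ {n G} → AP n G → ∀ x y → G (x ⊖ y) ≋ G x ⊖ G y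
  AP-subtractive {G = G} g x y = begin
    G (x ⊖ y)                   ≈⟨ (λ i → solve 2 (λ a b → a := (a :+ b) :- b) refl (G (x ⊖ y) i) (G y i)) ⟩
    (G (x ⊖ y) ⊕ G y) ⊖ G y     ≈⟨ ⊖-cong (≋-sym (AP-additive g (x ⊖ y) y)) ≋-refl ⟩
    G ((x ⊖ y) ⊕ y) ⊖ G y       ≈⟨ ⊖-cong (AP-cong g (λ i → solve 2 (λ a b → (a :- b) :+ b := a) refl (x i) (y i))) ≋-refl ⟩
    G x ⊖ G y                   ∎

  -- X = E D (1 − E) intertwines the actions of α on the quotient by ker E and on ker E. As D has a scalar linear part,
  -- X has none, so X factors through F.
  kernel-stable : ∀ {n E α D α₀ e s} → IsAP E → α ∼ α₀ → D ∼ (s ⊙_) →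
    (∀ z → E (E z) ≋ E z) → (∀ z → E (α (z ⊖ E z)) ≋ 𝟘) → (∀ z → α (D z) ≋ D (α z)) →
    (∀ z → fold z (shifted α₀ e) n ≋ 𝟘) → (∀ k → ¬ e ≈ fold e φ (suc k)) →
    ∀ z → E (D (z ⊖ E z)) ≋ 𝟘
  kernel-stable {n} {E} {α} {D} {α₀} {e} {s} E-AP α∼ D∼ EE EαG αD nil₀ e≉ z =
    ≋-trans (X≋X₁F z) (intertwiner-zero E∼ α∼ E₀E₀ E₀α₀E₀ nil₀ (proj₂ (tail-AP X∼)) (Unipotent-conj U)
      (λ k eq → e≉ k (trans eq (reflexive (fold-comm φ k e))))
      (untwist E-AP (∼⇒IsAP α∼) (∼⇒IsAP α∼) (∼⇒IsAP X∼) (tail-AP X∼) X≋X₁F I) (F z))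
    where
      E₀ = proj₁ (IsAP⇒∼ E-AP)
      E∼ = proj₂ (IsAP⇒∼ E-AP)
      lE = linear E∼

      G G₀ X : Map
      G z = z ⊖ E z
      G₀ z = z ⊖ E₀ z
      X z = E (D (G z))

      G∼ : G ∼ G₀
      G∼ = ∼-⊖ (linear∼ id-linear) E∼

      E-cong : ∀ {x y} → x ≋ y → E x ≋ E y
      E-cong = AP-cong (proj₂ E-AP)

      α-cong : ∀ {x y} → x ≋ y → α x ≋ α y
      α-cong = AP-cong (proj₂ (∼⇒IsAP α∼))

      D-cong : ∀ {x y} → x ≋ y → D x ≋ D y
      D-cong = AP-cong (proj₂ (∼⇒IsAP D∼))

      x⊖𝟘 : ∀ {x y} → y ≋ 𝟘 → x ⊖ y ≋ x
      x⊖𝟘 {x} y≋𝟘 i = trans (+-congˡ (-‿cong (y≋𝟘 i))) (solve 1 (λ x → x :- con (ℤ.+ 0) := x) refl (x i))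

      EG : ∀ z → E (G z) ≋ 𝟘
      EG z = ≋-trans (AP-subtractive (proj₂ E-AP) z (E z)) (λ i → x≈y⇒x-y≈0 (sym (EE z i)))

      GG : ∀ z → G (G z) ≋ G z
      GG z = x⊖𝟘 (EG z)

      EαE : ∀ z → E (α (E z)) ≋ E (α z)
      EαE z = ≋-sym (x⊖y≋𝟘⇒x≋y (begin
        E (α z) ⊖ E (α (E z))     ≈⟨ AP-subtractive (proj₂ E-AP) _ _ ⟨
        E (α z ⊖ α (E z))         ≈⟨ E-cong (AP-subtractive (proj₂ (∼⇒IsAP α∼)) _ _) ⟨
        E (α (G z))               ≈⟨ EαG z ⟩
        𝟘                         ∎))

      E₀E₀ = ∼-unique (∼-∘ E∼ E∼) E∼ EE
      E₀α₀E₀ = ∼-unique (∼-∘ E∼ (∼-∘ α∼ E∼)) (∼-∘ E∼ α∼) EαE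

      U : Unipotent n α G e
      U = record
        { A∼         = α∼
        ; G∼         = G∼
        ; idempotent = ∼-unique (∼-∘ G∼ G∼) G∼ GG
        ; invariant  = ∼-unique (∼-∘ G∼ (∼-∘ α∼ G∼)) (∼-∘ α∼ G∼) (λ z → x⊖𝟘 (EαG z))
        ; nilpotent  = nil₀
        }

      X∼ : X ∼ (λ z → E₀ (s ⊙ G₀ z))
      X∼ = ∼-∘ E∼ (∼-∘ D∼ G∼)

      X₀≋𝟘 : ∀ z → E₀ (s ⊙ G₀ z) ≋ 𝟘
      X₀≋𝟘 z = begin
        E₀ (s ⊙ G₀ z)      ≈⟨ homogeneous lE s _ ⟩
        s ⊙ E₀ (G₀ z)      ≈⟨ ⊙-cong refl (∼-unique (∼-∘ E∼ G∼) (linear∼ zeroMap-linear) EG z) ⟩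
        s ⊙ 𝟘              ≈⟨ (λ i → zeroʳ s) ⟩
        𝟘                  ∎

      X≋X₁F : ∀ z → X z ≋ tail X∼ (F z)
      X≋X₁F z = ≋-trans (equation X∼ z) (≋-trans (⊕-cong (X₀≋𝟘 z) ≋-refl) (λ i → +-identityˡ _))

      I : Intertwines E α X α G
      I = record
        { left  = λ z → EE _
        ; right = λ z → E-cong (D-cong (GG z))
        ; both  = λ z → begin
            E (α (E (D (G z))))      ≈⟨ EαE _ ⟩
            E (α (D (G z)))          ≈⟨ E-cong (αD _) ⟩
            E (D (α (G z)))          ≈⟨ E-cong (D-cong (x⊖𝟘 (EαG z))) ⟨
            E (D (G (α (G z))))      ∎
        }

-- Field homomorphisms and valuations.

module Homomorphism {c ℓ} {K L : Field c ℓ} (ι : FieldHom K L) where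
  open FieldHom ι public using (⟦_⟧)
  open RingMorphisms.IsRingHomomorphism (FieldHom.isRingHomomorphism ι) public
    using (⟦⟧-cong; +-homo; *-homo; 0#-homo; 1#-homo; -‿homo)
  private
    module K = Field K
    module L = Field L
    module K× = RawMonoidOps K.+-rawMonoid
    module L× = RawMonoidOps L.+-rawMonoid

  ^-homo : ∀ x n → ⟦ x K.^ n ⟧ L.≈ ⟦ x ⟧ L.^ n
  ^-homo x zero    = 1#-homo
  ^-homo x (suc n) = L.trans (*-homo x _) (L.*-congˡ (^-homo x n))

  ×-homo : ∀ n x → ⟦ n K×.× x ⟧ L.≈ n L×.× ⟦ x ⟧
  ×-homo zero    x = 0#-homo
  ×-homo (suc n) x = L.trans (+-homo x _) (L.+-congˡ (×-homo n x))

  sum-homo : ∀ {n} (f : Fin n → K.Carrier) → ⟦ K.sum f ⟧ L.≈ L.sum (λ i → ⟦ f i ⟧)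
  sum-homo {zero}  f = 0#-homo
  sum-homo {suc n} f = L.trans (+-homo _ _) (L.+-congˡ (sum-homo (λ i → f (suc i))))

  injective : ∀ {x y} → ⟦ x ⟧ L.≈ ⟦ y ⟧ → x K.≈ y
  injective {x} {y} eq with K.zeroOrInverse (x K.- y)
  ... | inj₁ x-y≈0 = FieldProperties.x-y≈0⇒x≈y K x-y≈0
  ... | inj₂ (z , inv) = contradiction (begin
    L.0#                               ≈⟨ L.zeroˡ _ ⟨
    L.0# L.* ⟦ z ⟧                     ≈⟨ L.*-congʳ (FieldProperties.x≈y⇒x-y≈0 L eq) ⟨
    (⟦ x ⟧ L.- ⟦ y ⟧) L.* ⟦ z ⟧        ≈⟨ L.*-congʳ (L.+-congˡ (-‿homo y)) ⟨
    (⟦ x ⟧ L.+ ⟦ K.- y ⟧) L.* ⟦ z ⟧    ≈⟨ L.*-congʳ (+-homo x _) ⟨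
    ⟦ x K.- y ⟧ L.* ⟦ z ⟧              ≈⟨ *-homo _ z ⟨
    ⟦ (x K.- y) K.* z ⟧                ≈⟨ ⟦⟧-cong inv ⟩
    ⟦ K.1# ⟧                           ≈⟨ 1#-homo ⟩
    L.1#                               ∎) L.0≉1
    where open import Relation.Binary.Reasoning.Setoid L.setoid

_∘ʰ_ : ∀ {c ℓ} {K L M : Field c ℓ} → FieldHom L M → FieldHom K L → FieldHom K M
_∘ʰ_ {M = M} g f = record
  { ⟦_⟧ = λ x → FieldHom.⟦_⟧ g (FieldHom.⟦_⟧ f x)
  ; isRingHomomorphism = Composition.isRingHomomorphism (Field.trans M)
      (FieldHom.isRingHomomorphism f) (FieldHom.isRingHomomorphism g)
  }

open RawMonoidOps ℚ.+-0-rawMonoid using () renaming (_×_ to _·_)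

·-negative : ∀ {r} → r ℚ.< 0ℚ → ∀ {i j} → i < j → j · r ℚ.< i · r
·-negative {r} r<0 {i} {suc j} (s≤s i≤j) with ℕ.m≤n⇒m<n∨m≡n i≤j
... | inj₂ ≡.refl = ≡.subst (suc i · r ℚ.<_) (ℚ.+-identityˡ (i · r)) (ℚ.+-monoˡ-< (i · r) r<0)
... | inj₁ i<j    = ℚ.<-trans (≡.subst (suc j · r ℚ.<_) (ℚ.+-identityˡ (j · r)) (ℚ.+-monoˡ-< (j · r) r<0)) (·-negative r<0 i<j)

·-mono-≤ : ∀ {s r} n → s ℚ.≤ r → n · s ℚ.≤ n · r
·-mono-≤ zero    s≤r = ℚ.≤-refl
·-mono-≤ (suc n) s≤r = ℚ.+-mono-≤ s≤r (·-mono-≤ n s≤r)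

·-mono-< : ∀ {s r n} → 0 < n → s ℚ.< r → n · s ℚ.< n · r
·-mono-< {n = suc n} _ s<r = ℚ.+-mono-<-≤ s<r (·-mono-≤ n (ℚ.<⇒≤ s<r))

·-nonNegative : ∀ {t} n → 0ℚ ℚ.≤ t → 0ℚ ℚ.≤ n · t
·-nonNegative zero    0≤t = ℚ.≤-refl
·-nonNegative {t} (suc n) 0≤t = ℚ.≤-trans (ℚ.≤-reflexive (≡.sym (ℚ.+-identityʳ 0ℚ))) (ℚ.+-mono-≤ 0≤t (·-nonNegative n 0≤t))

t≤n·t : ∀ {t n} → 0 < n → 0ℚ ℚ.≤ t → t ℚ.≤ n · t
t≤n·t {t} {suc n} _ 0≤t = ≡.subst (ℚ._≤ suc n · t) (ℚ.+-identityʳ t) (ℚ.+-monoʳ-≤ t (·-nonNegative n 0≤t))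

-- Written with `mkℚ` so that numerator and denominator compute and comparisons reduce to integers.
natℚ : ℕ → ℚ
natℚ n = mkℚ (ℤ.+ n) 0 (Coprimality.sym (Coprimality.1-coprimeTo n))

0≤natℚ : ∀ n → 0ℚ ℚ.≤ natℚ n
0≤natℚ n = ℚ.*≤* (≡.subst₂ ℤ._≤_ (≡.sym (ℤ.*-identityʳ (ℤ.+ 0))) (≡.sym (ℤ.*-identityʳ (ℤ.+ n))) (ℤ.+≤+ z≤n))

archimedean : ∀ r → ∃ λ N → ∀ n → N ≤ n → r ℚ.≤ natℚ n
archimedean (mkℚ a d _) = ℤ.∣ a ∣ , λ n ∣a∣≤n → ℚ.*≤* (ℤ.≤-trans (bound a) (ℤ.≤-trans (ℤ.+≤+ ∣a∣≤n) (grow n)))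
  where
    bound : ∀ a → a ℤ.* ℤ.+ 1 ℤ.≤ ℤ.+ ℤ.∣ a ∣
    bound a = ≡.subst (ℤ._≤ ℤ.+ ℤ.∣ a ∣) (≡.sym (ℤ.*-identityʳ a)) (below a)
      where
        below : ∀ a → a ℤ.≤ ℤ.+ ℤ.∣ a ∣
        below (ℤ.+ n)    = ℤ.≤-refl
        below ℤ.-[1+ n ] = ℤ.-≤+
    grow : ∀ n → ℤ.+ n ℤ.≤ ℤ.+ n ℤ.* ℤ.+ suc d
    grow n = ≡.subst (ℤ.+ n ℤ.≤_) (ℤ.pos-* n (suc d)) (ℤ.+≤+ (ℕ.m≤m*n n (suc d)))

module ValuationProperties {c ℓ} {K : Field c ℓ} (V : Valuation K) where
  open Field K hiding (zero)
  open FieldProperties K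
  open Valuation V
  open RawMonoidOps +-rawMonoid using () renaming (_×_ to _×′_)

  v-1 : v 1# ≡ [ 0ℚ ]
  v-1 with v 1# in eq
  ... | ⊤⁺    = contradiction (sym (Equivalence.to (v-∞ 1#) eq)) 0≉1
  ... | [ a ] = ≡.cong [_] (≡.sym (GroupProperties.∙-cancelˡ ℚ.+-0-group a 0ℚ a (≡.trans (ℚ.+-identityʳ a) ([]-injective
    (≡.trans (≡.sym eq) (≡.trans (v-cong (sym (*-identityˡ 1#))) (≡.trans (v-* 1# 1#) (≡.cong₂ _+⁺_ eq eq))))))))

  v-^ : ∀ {x r} n → v x ≡ [ r ] → v (x ^ n) ≡ [ n · r ]
  v-^ zero    eq = v-1
  v-^ (suc n) eq = ≡.trans (v-* _ _) (≡.cong₂ _+⁺_ eq (v-^ n eq))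

  power-≤ : ∀ {n r x} → 0 < n → [ n · r ] ≤⁺ v (x ^ n) → [ r ] ≤⁺ v x
  power-≤ {n} {r} {x} 0<n le = lemma (v x) ≡.refl
    where
      lemma : ∀ w → v x ≡ w → [ r ] ≤⁺ w
      lemma ⊤⁺    eq = [ r ] ≤⊤⁺
      lemma [ s ] eq with r ℚ.≤? s
      ... | yes r≤s = [ r≤s ]
      ... | no  r≰s = contradiction (ℚ.<-≤-trans (·-mono-< 0<n (ℚ.≰⇒> r≰s)) ([≤]-injective (≡.subst ([ n · r ] ≤⁺_) (v-^ n eq) le))) (ℚ.<-irrefl ≡.refl)

  ≤-power : ∀ {n r x} → 0 < n → 0ℚ ℚ.≤ r → [ r ] ≤⁺ v x → [ r ] ≤⁺ v (x ^ n)
  ≤-power {n} {r} {x} 0<n 0≤r r≤vx = lemma (v x) ≡.refl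
    where
      lemma : ∀ w → v x ≡ w → [ r ] ≤⁺ v (x ^ n)
      lemma ⊤⁺    eq = ≡.subst ([ r ] ≤⁺_) (≡.sym (Equivalence.from (v-∞ (x ^ n)) (trans (^-congˡ n (Equivalence.to (v-∞ x) eq)) (Exponents.0^n≈0 K 0<n)))) ([ r ] ≤⊤⁺)
        where open CommutativeSemiringExp commutativeSemiring using (^-congˡ)
      lemma [ s ] eq = ≡.subst ([ r ] ≤⁺_) (≡.sym (v-^ n eq)) [ ℚ.≤-trans r≤s (t≤n·t 0<n (ℚ.≤-trans 0≤r r≤s)) ]
        where r≤s = [≤]-injective (≡.subst ([ r ] ≤⁺_) eq r≤vx)

  -- For an element with a pole, v(x^i) = i · v(x) is strictly decreasing in i.
  powers-distinct : ∀ {x r} → v x ≡ [ r ] → r ℚ.< 0ℚ → ∀ i j → x ^ i ≈ x ^ j → i ≡ j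
  powers-distinct {x} {r} vx≡r r<0 i j eq = lemma (ℕ.<-cmp i j)
    where
      same : i · r ≡ j · r
      same = []-injective (≡.trans (≡.sym (v-^ i vx≡r)) (≡.trans (v-cong eq) (v-^ j vx≡r)))
      lemma : Tri (i < j) (i ≡ j) (j < i) → i ≡ j
      lemma (tri< i<j _ _) = contradiction (·-negative r<0 i<j) (ℚ.<-irrefl (≡.sym same))
      lemma (tri≈ _ i≡j _) = i≡j
      lemma (tri> _ _ j<i) = contradiction (·-negative r<0 j<i) (ℚ.<-irrefl same)

  v-× : ∀ {r x} n → [ r ] ≤⁺ v x → [ r ] ≤⁺ v (n ×′ x)
  v-× {r} zero    le = ≡.subst ([ r ] ≤⁺_) (≡.sym (Equivalence.from (v-∞ 0#) refl)) ([ r ] ≤⊤⁺)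
  v-× {r} (suc n) le = ultrametric [ r ] _ _ le (v-× n le)

  unbounded⇒zero : ∀ {x} → (∀ n → [ natℚ n ] ≤⁺ v x) → x ≈ 0#
  unbounded⇒zero {x} large = Equivalence.to (v-∞ x) (lemma (v x) large)
    where
      lemma : ∀ w → (∀ n → [ natℚ n ] ≤⁺ w) → w ≡ ⊤⁺
      lemma ⊤⁺    _     = ≡.refl
      lemma [ s ] large with archimedean (s ℚ.+ ℚ.1ℚ)
      ... | N , s+1≤N = contradiction (ℚ.<-≤-trans s<s+1 (ℚ.≤-trans (s+1≤N N ℕ.≤-refl) ([≤]-injective (large N)))) (ℚ.<-irrefl ≡.refl)
        where
          s<s+1 : s ℚ.< s ℚ.+ ℚ.1ℚ
          s<s+1 = ≡.subst (ℚ._< s ℚ.+ ℚ.1ℚ) (ℚ.+-identityʳ s) (ℚ.+-monoʳ-< s (ℚ.positive⁻¹ ℚ.1ℚ))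

-- The p-th roots of a sequence in K converging to x ∈ L form a Cauchy sequence, because Frobenius is additive.
module CompletionPerfect {c ℓ} {K L : Field c ℓ} (ι : FieldHom K L) {V : Valuation K} {W : Valuation L}
    (closed : AlgebraicallyClosed K) (completion : IsCompletion ι V W)
    {p : ℕ} (characteristic : Exponents.Characteristic L p) where
  open IsCompletion completion
  open Valuation W
  open ValuationProperties W
  open Homomorphism ι
  open Exponents.Characteristic characteristic
  open FieldProperties L
  private
    module K = Field K
    module KP = FieldProperties K
  open Field L hiding (zero)
  open ℤSolver commutativeRing
  open RawMonoidOps +-rawMonoid using () renaming (_×_ to _×′_)
  open import Relation.Binary.Reasoning.Setoid setoid

  private
    eval-monomial : ∀ n x → evalPoly K (replicate n K.0# ∷ʳ K.1#) x K.≈ x K.^ n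
    eval-monomial zero    x = K.trans (K.+-congˡ (K.zeroʳ x)) (K.+-identityʳ K.1#)
    eval-monomial (suc n) x = K.trans (K.+-identityˡ _) (K.*-congˡ (eval-monomial n x))

    root-K : ∀ {n} → 0 < n → ∀ a → ∃ λ y → y K.^ n K.≈ a
    root-K {suc n} _ a =
      let y , fy≈0 = closed (K.- a) (replicate n K.0#) K.1# (λ 1≈0 → K.0≉1 (K.sym 1≈0))
      in y , KP.x-y≈0⇒x≈y (K.trans (K.+-comm _ _) (K.trans (K.+-congˡ (K.*-congˡ (K.sym (eval-monomial n y)))) fy≈0))

    -- In characteristic p the element -x is the multiple (p - 1) x, and multiples do not lower the
    -- bound.
    v-neg : ∀ {r x} → [ r ] ≤⁺ v x → [ r ] ≤⁺ v (- x)
    v-neg {r} {x} r≤vx = ≡.subst ([ r ] ≤⁺_) (v-cong (begin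
      ℕ.pred p ×′ x                              ≈⟨ solve 2 (λ x y → y := (x :+ y) :- x) refl x (ℕ.pred p ×′ x) ⟩
      suc (ℕ.pred p) ×′ x - x                    ≡⟨ ≡.cong (λ n → n ×′ x - x) (ℕ.suc-pred p {{ℕ.>-nonZero positive}}) ⟩
      p ×′ x - x                                 ≈⟨ +-congʳ (Binomial.×-zero semiring p x p×1≈0) ⟩
      0# - x                                     ≈⟨ +-identityˡ _ ⟩
      - x                                        ∎)) (v-× (ℕ.pred p) r≤vx)

    φ-- : ∀ x y → φ (x - y) ≈ φ x - φ y
    φ-- x y = trans (φ-additive x (- y)) (+-congˡ (φ-neg y))

  module _ (x : Carrier) where
    private
      approx : ℕ → K.Carrier
      approx n = proj₁ (dense x (natℚ n))

      approx-close : ∀ n → [ natℚ n ] ≤⁺ v (x - ⟦ approx n ⟧)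
      approx-close n = proj₂ (dense x (natℚ n))

      y : ℕ → Carrier
      y n = ⟦ proj₁ (root-K positive (approx n)) ⟧

      φy : ∀ n → φ (y n) ≈ ⟦ approx n ⟧
      φy n = trans (sym (^-homo _ p)) (⟦⟧-cong (proj₂ (root-K positive (approx n))))

      cauchy : Cauchy y
      -- Roots agree to precision r as soon as their p-th powers agree to precision p · r.
      cauchy r = let N , N-large = archimedean (p · r) in N , λ i j N≤i N≤j →
        power-≤ positive (≡.subst ([ p · r ] ≤⁺_) (v-cong (begin
          (x - ⟦ approx j ⟧) + - (x - ⟦ approx i ⟧)   ≈⟨ solve 3 (λ x a b → (x :- b) :+ (:- (x :- a)) := a :- b) refl x ⟦ approx i ⟧ ⟦ approx j ⟧ ⟩
          ⟦ approx i ⟧ - ⟦ approx j ⟧                 ≈⟨ +-cong (φy i) (-‿cong (φy j)) ⟨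
          φ (y i) - φ (y j)                           ≈⟨ φ-- (y i) (y j) ⟨
          φ (y i - y j)                               ∎))
          (ultrametric [ p · r ] _ _
            (≤⁺-trans ℚ.≤-trans [ N-large j N≤j ] (approx-close j))
            (v-neg (≤⁺-trans ℚ.≤-trans [ N-large i N≤i ] (approx-close i)))))

      limit : Carrier
      limit = proj₁ (complete y cauchy)

    root : Carrier
    root = limit

    root-^p : root ^ p ≈ x
    root-^p = x-y≈0⇒x≈y (unbounded⇒zero λ n → close n)
      where
        close : ∀ n → [ natℚ n ] ≤⁺ v (φ limit - x)
        close n =
          let N , N-close = proj₂ (complete y cauchy) (natℚ n)
              -- Beyond N the root y k is close to the limit, beyond n its p-th power is close to x;
              -- both bounds enter through φ(limit) - x = φ(limit - y k) - (x - φ(y k)).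
              k = n ℕ.⊔ N
          in ≡.subst ([ natℚ n ] ≤⁺_) (v-cong (begin
            φ (limit - y k) + - (x - ⟦ approx k ⟧)        ≈⟨ +-cong (φ-- limit (y k)) (-‿cong (+-congˡ (-‿cong (sym (φy k))))) ⟩
            (φ limit - φ (y k)) + - (x - φ (y k))         ≈⟨ solve 3 (λ a b x → (a :- b) :+ (:- (x :- b)) := a :- x) refl (φ limit) (φ (y k)) x ⟩
            φ limit - x                                   ∎))
            (ultrametric [ natℚ n ] _ _
              (≤-power positive (0≤natℚ n) (N-close k (ℕ.m≤n⊔m n N)))
              (v-neg (≤⁺-trans ℚ.≤-trans [ natℚ-mono (ℕ.m≤m⊔n n N) ] (approx-close k))))
          where
            natℚ-mono : ∀ {i j} → i ≤ j → natℚ i ℚ.≤ natℚ j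
            natℚ-mono i≤j = ℚ.*≤* (≡.subst₂ ℤ._≤_ (≡.sym (ℤ.*-identityʳ _)) (≡.sym (ℤ.*-identityʳ _)) (ℤ.+≤+ i≤j))

-- The field 𝒞 is perfect, and q is a power of its characteristic.

module TowerProperties {c ℓ} (𝒦 : FunctionFieldTower c ℓ) where
  open FunctionFieldTower 𝒦

  k↪𝒞 : FieldHom k 𝒞
  k↪𝒞 = k̄∞→𝒞 ∘ʰ (k∞→k̄∞ ∘ʰ k→k∞)

  module A→k = RingMorphisms.IsRingMonomorphism A→k-mono
  module k→𝒞 = Homomorphism k↪𝒞
  module F = FiniteField 𝔽q finite

  𝔽q↪𝒞 : FieldHom 𝔽q 𝒞
  𝔽q↪𝒞 = k↪𝒞 ∘ʰ record
    { ⟦_⟧ = λ x → A→k (const x)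
    ; isRingHomomorphism = record
      { isSemiringHomomorphism = record
        { isNearSemiringHomomorphism = record
          { +-isMonoidHomomorphism = record
            { isMagmaHomomorphism = record
              { isRelHomomorphism = record { cong = λ x≈y → A→k.⟦⟧-cong (const-cong x≈y) }
              ; homo = λ x y → A→k.+-homo (const x) (const y)
              }
            ; ε-homo = k.trans (A→k.⟦⟧-cong const-0) A→k.0#-homo
            }
          ; *-homo = λ x y → A→k.*-homo (const x) (const y)
          }
        ; 1#-homo = A→k.1#-homo
        }
      ; -‿homo = λ x → A→k.-‿homo (const x)
      }
    }
    where
      const-cong : ∀ {x y} → x 𝔽q.≈ y → const x A.≈ const y
      const-cong x≈y zero    = x≈y
      const-cong x≈y (suc i) = 𝔽q.refl
      const-0 : const 𝔽q.0# A.≈ A.0#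
      const-0 zero    = 𝔽q.refl
      const-0 (suc i) = 𝔽q.refl

  module 𝔽q→𝒞 = Homomorphism 𝔽q↪𝒞

  q-middleVanishes : Binomial.MiddleVanishes 𝒞.semiring q
  q-middleVanishes i 0<i i<q = 𝒞.trans (𝒞×.×-congʳ (q C i) (𝒞.sym 𝔽q→𝒞.1#-homo)) (𝒞.trans (𝒞.sym (𝔽q→𝒞.×-homo (q C i) 𝔽q.1#))
    (𝒞.trans (𝔽q→𝒞.⟦⟧-cong (F.q-middleVanishes i 0<i i<q)) 𝔽q→𝒞.0#-homo))
    where module 𝒞× = SemiringMult 𝒞.semiring

  private
    degree-negative : ∀ d → ℤ.- (ℤ.+ suc d) ℚ./ 1 ℚ.< 0ℚ
    degree-negative d = ℚ.neg-antimono-< (ℚ.positive⁻¹ _ {{ℚ.normalize-pos (suc d) 1}})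

  -- The valuation at infinity is minus the degree, hence negative.
  nonconstant-powers : ∀ a as b → ¬ b 𝔽q.≈ 𝔽q.0# → ∀ i j →
    A→k (a ∷ as ∷ʳ b) k.^ i k.≈ A→k (a ∷ as ∷ʳ b) k.^ j → i ≡ j
  nonconstant-powers a as b b≉0 = ValuationProperties.powers-distinct v-k (v-degree (a ∷ as) b b≉0) (degree-negative (length as))

  θ : 𝒞.Carrier
  θ = k→𝒞 (A→k T)

  θ-powers : ∀ i j → θ 𝒞.^ i 𝒞.≈ θ 𝒞.^ j → i ≡ j
  θ-powers i j eq = nonconstant-powers 𝔽q.0# [] 𝔽q.1# (λ 1≈0 → 𝔽q.0≉1 (𝔽q.sym 1≈0)) i j
    (k→𝒞.injective (𝒞.trans (k→𝒞.^-homo _ i) (𝒞.trans eq (𝒞.sym (k→𝒞.^-homo _ j)))))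

  private
    characteristic′ : ∃ (Exponents.Characteristic 𝒞)
    -- C(q,1) = q is a middle coefficient because q > 1, so q is zero in 𝒞.
    characteristic′ = Exponents.characteristic 𝒞 q F.0<q (≡.subst (λ n → n 𝒞×.× 𝒞.1# 𝒞.≈ 𝒞.0#) (nC1≡n q) (q-middleVanishes 1 (s≤s z≤n) F.1<q))
      where module 𝒞× = SemiringMult 𝒞.semiring

  𝒞-perfect : PerfectField c ℓ
  𝒞-perfect = record
    { K = 𝒞
    ; p = proj₁ characteristic′
    ; characteristic = proj₂ characteristic′
    ; root = root
    ; root-^p = root-^p
    ; θ = θ
    ; θ-powers = θ-powers
    }
    where open CompletionPerfect k̄∞→𝒞 (Defs.IsAlgebraicClosure.algebraicallyClosed isClosure) isCompletion (proj₂ characteristic′)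

  open PerfectField 𝒞-perfect using (p; characteristic)

  -- The q-th power map is additive on the infinite field 𝒞, which leaves only powers of p; q > 1
  -- excludes p⁰. The positive exponent guarantees that τ contains at least one factor σ.
  q-power : ∃ λ e → q ≡ p ℕ.^ suc e
  q-power with Exponents.Characteristic.additive⇒power characteristic θ θ-powers q (λ x y → Binomial.^-additive 𝒞.semiring F.0<q q-middleVanishes (𝒞.*-comm x y))
  ... | zero  , q≡1 = contradiction (≡.subst (1 <_) q≡1 F.1<q) (ℕ.<-irrefl ≡.refl)
  ... | suc e , q≡p^1+e = e , q≡p^1+e

-- Polynomial functions on K^m and p-polynomials.

module Polynomials {c ℓ} (𝒫 : PerfectField c ℓ) (m : ℕ) where
  open PerfectField 𝒫
  open Field K hiding (zero)
  open FieldProperties K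
  open Exponents K using (Additive)
  open Exponents.Characteristic characteristic
  open Infinite θ θ-powers
  open ℤSolver commutativeRing
  open CommutativeSemiringExp commutativeSemiring using (^-congˡ; ^-distrib-*)
  open SemiringSum semiring using (sum-cong-≋; ∑-distrib-+)
  open VectorSetoid setoid using (_≋_)
  open AdditiveMaps 𝒫 m using (Point; Map; _⊕_; fold-φ)
  open import Relation.Binary.Reasoning.Setoid setoid

  -- Pol d f: f is a polynomial function of degree < d.

  data Pol : ℕ → (Point → Carrier) → Set (c ⊔ ℓ) where
    zer : ∀ {d f} → (∀ z → f z ≈ 0#) → Pol d f
    con : ∀ {d f} a → (∀ z → f z ≈ a) → Pol (suc d) f
    var : ∀ {d f g} i → Pol d g → (∀ z → f z ≈ z i * g z) → Pol (suc d) f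
    add : ∀ {d f g h} → Pol d g → Pol d h → (∀ z → f z ≈ g z + h z) → Pol d f

  Pol-cong : ∀ {d f} → Pol d f → ∀ {x y} → x ≋ y → f x ≈ f y
  Pol-cong (zer f≈)     x≋y = trans (f≈ _) (sym (f≈ _))
  Pol-cong (con a f≈)   x≋y = trans (f≈ _) (sym (f≈ _))
  Pol-cong (var i g f≈) x≋y = trans (f≈ _) (trans (*-cong (x≋y i) (Pol-cong g x≋y)) (sym (f≈ _)))
  Pol-cong (add g h f≈) x≋y = trans (f≈ _) (trans (+-cong (Pol-cong g x≋y) (Pol-cong h x≋y)) (sym (f≈ _)))

  Pol-resp : ∀ {d f g} → (∀ z → g z ≈ f z) → Pol d f → Pol d g
  Pol-resp eq (zer f≈)     = zer λ z → trans (eq z) (f≈ z)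
  Pol-resp eq (con a f≈)   = con a λ z → trans (eq z) (f≈ z)
  Pol-resp eq (var i g f≈) = var i g λ z → trans (eq z) (f≈ z)
  Pol-resp eq (add g h f≈) = add g h λ z → trans (eq z) (f≈ z)

  Pol-suc : ∀ {d f} → Pol d f → Pol (suc d) f
  Pol-suc (zer f≈)     = zer f≈
  Pol-suc (con a f≈)   = con a f≈
  Pol-suc (var i g f≈) = var i (Pol-suc g) f≈
  Pol-suc (add g h f≈) = add (Pol-suc g) (Pol-suc h) f≈

  Pol-+ˡ : ∀ {d f} k → Pol d f → Pol (k ℕ.+ d) f
  Pol-+ˡ zero    f = f
  Pol-+ˡ (suc k) f = Pol-suc (Pol-+ˡ k f)

  Pol-scale : ∀ {d f} a → Pol d f → Pol d (λ z → a * f z)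
  Pol-scale a (zer f≈)             = zer λ z → trans (*-congˡ (f≈ z)) (zeroʳ a)
  Pol-scale a (con b f≈)           = con (a * b) λ z → *-congˡ (f≈ z)
  Pol-scale a (var {g = g} i g′ f≈) = var i (Pol-scale a g′) λ z → trans (*-congˡ (f≈ z))
    (solve 3 (λ a x y → a :* (x :* y) := x :* (a :* y)) refl a (z i) (g z))
  Pol-scale a (add g h f≈)         = add (Pol-scale a g) (Pol-scale a h) λ z → trans (*-congˡ (f≈ z)) (distribˡ a _ _)

  Pol0⇒zero : ∀ {f} → Pol 0 f → ∀ z → f z ≈ 0#
  Pol0⇒zero (zer f≈)     z = f≈ z
  Pol0⇒zero (add g h f≈) z = trans (f≈ z) (trans (+-cong (Pol0⇒zero g z) (Pol0⇒zero h z)) (+-identityʳ 0#))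

  Pol-translate : ∀ {d f} y → Pol d f → Pol d (λ x → f (x ⊕ y))
  Pol-translate y (zer f≈)             = zer λ z → f≈ _
  Pol-translate y (con a f≈)           = con a λ z → f≈ _
  Pol-translate y (var {g = g} i g′ f≈) = add (var i (Pol-translate y g′) (λ _ → refl)) (Pol-suc (Pol-scale (y i) (Pol-translate y g′)))
    λ z → trans (f≈ _) (distribʳ _ (z i) (y i))
  Pol-translate y (add g h f≈)         = add (Pol-translate y g) (Pol-translate y h) λ z → f≈ _

  -- A difference loses the top degree: for f = x_i g it equals x_i (g(x+y) - g(x)) + y_i g(x+y).
  -- This drop is what makes a relation of least degree additive.
  Pol-difference : ∀ {d f} y → Pol (suc d) f → Pol d (λ x → f (x ⊕ y) - f x)
  Pol-difference y (zer f≈)   = zer λ z → trans (+-cong (f≈ _) (-‿cong (f≈ _))) (-‿inverseʳ 0#)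
  Pol-difference y (con a f≈) = zer λ z → trans (+-cong (f≈ _) (-‿cong (f≈ _))) (-‿inverseʳ a)
  Pol-difference {zero}  y (var i g f≈) = zer λ z → trans (+-cong (zero-at _) (-‿cong (zero-at _))) (-‿inverseʳ 0#)
    where zero-at = λ z → trans (f≈ z) (trans (*-congˡ (Pol0⇒zero g z)) (zeroʳ (z i)))
  Pol-difference {suc d} y (var {g = g} i g′ f≈) =
    add (var i (Pol-difference y g′) (λ _ → refl)) (Pol-scale (y i) (Pol-translate y g′)) λ z →
      trans (+-cong (f≈ _) (-‿cong (f≈ _)))
        (solve 4 (λ x y u v → (x :+ y) :* u :- x :* v := x :* (u :- v) :+ y :* u) refl (z i) (y i) (g (z ⊕ y)) (g z))
  Pol-difference y (add {g = g} {h} g′ h′ f≈) = add (Pol-difference y g′) (Pol-difference y h′) λ z →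
    trans (+-cong (f≈ _) (-‿cong (f≈ _)))
      (solve 4 (λ a b c d → (a :+ b) :- (c :+ d) := (a :- c) :+ (b :- d)) refl (g (z ⊕ y)) (h (z ⊕ y)) (g z) (h z))

  IsPol : (Point → Carrier) → Set (c ⊔ ℓ)
  IsPol f = ∃ λ d → Pol d f

  IsPol-resp : ∀ {f g} → (∀ z → g z ≈ f z) → IsPol f → IsPol g
  IsPol-resp eq (d , f) = d , Pol-resp eq f

  IsPol-const : ∀ a → IsPol (λ _ → a)
  IsPol-const a = 1 , con a λ _ → refl

  IsPol-var : ∀ {f} i → IsPol f → IsPol (λ z → z i * f z)
  IsPol-var i (d , f) = suc d , var i f λ _ → refl

  IsPol-coordinate : ∀ i → IsPol (λ z → z i)
  IsPol-coordinate i = 2 , var i (con 1# (λ _ → refl)) λ z → sym (*-identityʳ _)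

  IsPol-+ : ∀ {f g} → IsPol f → IsPol g → IsPol (λ z → f z + g z)
  IsPol-+ {f} {g} (d , f′) (e , g′) = e ℕ.+ d , add (Pol-+ˡ e f′) (≡.subst (λ n → Pol n g) (ℕ.+-comm d e) (Pol-+ˡ d g′)) λ _ → refl

  IsPol-scale : ∀ {f} a → IsPol f → IsPol (λ z → a * f z)
  IsPol-scale a (d , f) = d , Pol-scale a f

  Pol-* : ∀ {d f g} → Pol d f → IsPol g → IsPol (λ z → f z * g z)
  Pol-* (zer f≈)             g = 0 , zer λ z → trans (*-congʳ (f≈ z)) (zeroˡ _)
  Pol-* (con a f≈)           g = IsPol-resp (λ z → *-congʳ (f≈ z)) (IsPol-scale a g)
  Pol-* (var i f f≈)         g = IsPol-resp (λ z → trans (*-congʳ (f≈ z)) (*-assoc _ _ _)) (IsPol-var i (Pol-* f g))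
  Pol-* (add f f′ f≈)        g = IsPol-resp (λ z → trans (*-congʳ (f≈ z)) (distribʳ _ _ _)) (IsPol-+ (Pol-* f g) (Pol-* f′ g))

  IsPol-* : ∀ {f g} → IsPol f → IsPol g → IsPol (λ z → f z * g z)
  IsPol-* (_ , f) g = Pol-* f g

  IsPol-^ : ∀ {f} → IsPol f → ∀ n → IsPol (λ z → f z ^ n)
  IsPol-^ f zero    = IsPol-const 1#
  IsPol-^ f (suc n) = IsPol-* f (IsPol-^ f n)

  PolyMap : Map → Set (c ⊔ ℓ)
  PolyMap V = ∀ i → IsPol (λ z → V z i)

  Pol-∘ : ∀ {d f V} → Pol d f → PolyMap V → IsPol (λ z → f (V z))
  Pol-∘ (zer f≈)     V = 0 , zer λ z → f≈ _
  Pol-∘ (con a f≈)   V = 1 , con a λ z → f≈ _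
  Pol-∘ (var i g f≈) V = IsPol-resp (λ z → f≈ _) (IsPol-* (V i) (Pol-∘ g V))
  Pol-∘ (add g h f≈) V = IsPol-resp (λ z → f≈ _) (IsPol-+ (Pol-∘ g V) (Pol-∘ h V))

  IsPol-∘ : ∀ {f V} → IsPol f → PolyMap V → IsPol (λ z → f (V z))
  IsPol-∘ (_ , f) V = Pol-∘ f V

  mask : (Fin m → Bool) → Map
  mask S z i = if S i then z i else 0#

  Pol-mask : ∀ {d f} S → Pol d f → Pol d (λ z → f (mask S z))
  Pol-mask S (zer f≈)     = zer λ z → f≈ _
  Pol-mask S (con a f≈)   = con a λ z → f≈ _
  Pol-mask S (add g h f≈) = add (Pol-mask S g) (Pol-mask S h) λ z → f≈ _
  Pol-mask {suc d} {f} S (var i g f≈) = masked (S i) ≡.refl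
    where
      mask-i : ∀ {b} → S i ≡ b → ∀ z → mask S z i ≈ (if b then z i else 0#)
      mask-i eq z = reflexive (≡.cong (if_then z i else 0#) eq)
      masked : ∀ b → S i ≡ b → Pol (suc d) (λ z → f (mask S z))
      masked true  eq = var i (Pol-mask S g) λ z → trans (f≈ _) (*-congʳ (mask-i eq z))
      masked false eq = zer λ z → trans (f≈ _) (trans (*-congʳ (mask-i eq z)) (zeroˡ _))

  axis : Fin m → Carrier → Point
  axis i t j = if does (i Fin.≟ j) then t else 0#

  eval-+ : ∀ f g → ∃ λ h → ∀ t → eval h t ≈ eval f t + eval g t
  eval-+ []      g       = g , λ _ → sym (+-identityˡ _)
  eval-+ (a ∷ f) []      = a ∷ f , λ _ → sym (+-identityʳ _)
  eval-+ (a ∷ f) (b ∷ g) with eval-+ f g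
  ... | h , eq = (a + b) ∷ h , λ t → trans (+-congˡ (*-congˡ (eq t)))
    (solve 5 (λ a b t x y → (a :+ b) :+ t :* (x :+ y) := (a :+ t :* x) :+ (b :+ t :* y)) refl a b t (eval f t) (eval g t))

  Pol-axis : ∀ {d f} i → Pol d f → ∃ λ l → ∀ t → f (axis i t) ≈ eval l t
  Pol-axis i (zer f≈)     = [] , λ t → f≈ _
  Pol-axis i (con a f≈)   = a ∷ [] , λ t → trans (f≈ _) (trans (sym (+-identityʳ a)) (+-congˡ (sym (zeroʳ t))))
  Pol-axis i (add g h f≈) with Pol-axis i g | Pol-axis i h
  ... | l , g≈ | l′ , h≈ = let k , eq = eval-+ l l′ in k , λ t → trans (f≈ _) (trans (+-cong (g≈ t) (h≈ t)) (sym (eq t)))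
  Pol-axis i (var j g f≈) with Pol-axis i g | i Fin.≟ j | f≈
  ... | l , g≈ | yes ≡.refl | _ = 0# ∷ l , λ t → trans (f≈ _) (trans (*-cong (reflexive (axis-same i t)) (g≈ t)) (sym (+-identityˡ _)))
    where
      axis-same : ∀ i t → axis i t i ≡ t
      axis-same i t with i Fin.≟ i
      ... | yes _ = ≡.refl
      ... | no i≢i = contradiction ≡.refl i≢i
  ... | l , g≈ | no i≢j | _ = [] , λ t → trans (f≈ _) (trans (*-congʳ (reflexive (axis-other t))) (zeroˡ _))
    where
      axis-other : ∀ t → axis i t j ≡ 0#
      axis-other t with i Fin.≟ j
      ... | yes i≡j = contradiction i≡j i≢j
      ... | no _ = ≡.refl

  -- Replace s and t by x s and x t and read the equation as a polynomial in x. Its coefficient at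
  -- x^i is lᵢ ((s+t)^i - s^i - t^i), which must vanish.
  additive-coefficients : ∀ l → (∀ s t → eval l (s + t) ≈ eval l s + eval l t) →
    ∀ i → ¬ lookup l i ≈ 0# → Additive (toℕ i)
  additive-coefficients l l-additive i lᵢ≉0 s t = x-y≈0⇒x≈y (xy≈0⇒y≈0 lᵢ≉0 (vanishing⇒zero coeff vanishes i))
    where
      n = length l
      coeff : Fin n → Carrier
      coeff i = lookup l i * ((s + t) ^ toℕ i - (s ^ toℕ i + t ^ toℕ i))

      eval≈sum : ∀ x → eval l x ≈ sum (λ i → lookup l i * x ^ toℕ i)
      eval≈sum x = trans (reflexive (≡.cong (λ l → eval l x) (≡.sym (tabulate-lookup l)))) (eval-tabulate (lookup l) x)

      split : ∀ x i → lookup l i * (x * (s + t)) ^ toℕ i ≈ coeff i * x ^ toℕ i + (lookup l i * (x * s) ^ toℕ i + lookup l i * (x * t) ^ toℕ i)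
      split x i = trans (*-congˡ (^-distrib-* x (s + t) (toℕ i))) (trans
        (solve 5 (λ a x u v w → a :* (x :* u) := a :* (u :- (v :+ w)) :* x :+ (a :* (x :* v) :+ a :* (x :* w))) refl
          (lookup l i) (x ^ toℕ i) ((s + t) ^ toℕ i) (s ^ toℕ i) (t ^ toℕ i))
        (+-congˡ (+-cong (*-congˡ (sym (^-distrib-* x s (toℕ i)))) (*-congˡ (sym (^-distrib-* x t (toℕ i)))))))

      vanishes : ∀ x → sum (λ i → coeff i * x ^ toℕ i) ≈ 0#
      vanishes x = begin
        sum c′                                      ≈⟨ solve 2 (λ a b → a := (a :+ b) :- b) refl (sum c′) (sum (λ i → a i + b i)) ⟩
        (sum c′ + sum (λ i → a i + b i)) - sum (λ i → a i + b i)  ≈⟨ +-congʳ (sym (∑-distrib-+ c′ (λ i → a i + b i))) ⟩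
        sum (λ i → c′ i + (a i + b i)) - sum (λ i → a i + b i)    ≈⟨ +-cong (sym (sum-cong-≋ (split x))) (-‿cong (∑-distrib-+ a b)) ⟩
        sum (λ i → lookup l i * (x * (s + t)) ^ toℕ i) - (sum a + sum b)  ≈⟨ +-cong (sym (eval≈sum _)) (-‿cong (+-cong (sym (eval≈sum _)) (sym (eval≈sum _)))) ⟩
        eval l (x * (s + t)) - (eval l (x * s) + eval l (x * t))  ≈⟨ x≈y⇒x-y≈0 (trans (eval-cong l (distribˡ x s t)) (l-additive (x * s) (x * t))) ⟩
        0#                                          ∎
        where
          c′ a b : Fin n → Carrier
          c′ i = coeff i * x ^ toℕ i
          a i = lookup l i * (x * s) ^ toℕ i
          b i = lookup l i * (x * t) ^ toℕ i
          eval-cong : ∀ l {x y} → x ≈ y → eval l x ≈ eval l y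
          eval-cong []      x≈y = refl
          eval-cong (a ∷ l) x≈y = +-congˡ (*-cong x≈y (eval-cong l x≈y))

  -- PP n f: f is a p-polynomial aₙ₋₁ t^(pⁿ⁻¹) + … + a₀ t; the leading term comes first.

  data PP : ℕ → (Carrier → Carrier) → Set (c ⊔ ℓ) where
    zer : ∀ {f} → (∀ t → f t ≈ 0#) → PP 0 f
    top : ∀ {n f f′} a → PP n f′ → (∀ t → f t ≈ a * fold t φ n + f′ t) → PP (suc n) f

  PP0⇒zero : ∀ {f} → PP 0 f → ∀ t → f t ≈ 0#
  PP0⇒zero (zer f≈) = f≈

  PP-resp : ∀ {n f g} → (∀ t → g t ≈ f t) → PP n f → PP n g
  PP-resp eq (zer f≈)     = zer λ t → trans (eq t) (f≈ t)
  PP-resp eq (top a f f≈) = top a f λ t → trans (eq t) (f≈ t)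

  PP-suc : ∀ {n f} → PP n f → PP (suc n) f
  PP-suc f = top 0# f λ t → sym (trans (+-congʳ (zeroˡ _)) (+-identityˡ _))

  PP-≤ : ∀ {n k f} → n ≤ k → PP n f → PP k f
  PP-≤ {n} {k} n≤k f = ≡.subst (λ k → PP k _) (ℕ.m∸n+n≡m n≤k) (pads (k ℕ.∸ n) f)
    where
      pads : ∀ {n f} k → PP n f → PP (k ℕ.+ n) f
      pads zero    f = f
      pads (suc k) f = PP-suc (pads k f)

  PP-zero : ∀ {n f} → (∀ t → f t ≈ 0#) → PP n f
  PP-zero f≈ = PP-≤ z≤n (zer f≈)

  PP-+ : ∀ {n f g} → PP n f → PP n g → PP n (λ t → f t + g t)
  PP-+ (zer f≈)      (zer g≈)     = zer λ t → trans (+-cong (f≈ t) (g≈ t)) (+-identityʳ 0#)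
  PP-+ (top {n} {f′ = f′} a f f≈) (top {f′ = g′} b g g≈) = top (a + b) (PP-+ f g) λ t → trans (+-cong (f≈ t) (g≈ t))
    (solve 5 (λ a b t x y → (a :* t :+ x) :+ (b :* t :+ y) := (a :+ b) :* t :+ (x :+ y)) refl a b (fold t φ n) (f′ t) (g′ t))

  PP-sum : ∀ {n k} (g : Fin k → Carrier → Carrier) → (∀ i → PP n (g i)) → PP n (λ t → sum (λ i → g i t))
  PP-sum {k = zero}  g g-PP = PP-zero λ _ → refl
  PP-sum {k = suc k} g g-PP = PP-+ (g-PP zero) (PP-sum (λ i → g (suc i)) (λ i → g-PP (suc i)))

  fold-φ-* : ∀ x y n → fold (x * y) φ n ≈ fold x φ n * fold y φ n
  fold-φ-* x y zero    = refl
  fold-φ-* x y (suc n) = trans (φ-cong (fold-φ-* x y n)) (φ-* _ _)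

  fold-φ-+ : ∀ x y n → fold (x + y) φ n ≈ fold x φ n + fold y φ n
  fold-φ-+ x y zero    = refl
  fold-φ-+ x y (suc n) = trans (φ-cong (fold-φ-+ x y n)) (φ-additive _ _)

  fold-φ-0 : ∀ n → fold 0# φ n ≈ 0#
  fold-φ-0 zero    = refl
  fold-φ-0 (suc n) = trans (φ-cong (fold-φ-0 n)) φ-0

  fold-φ-cong : ∀ n {x y} → x ≈ y → fold x φ n ≈ fold y φ n
  fold-φ-cong zero    x≈y = x≈y
  fold-φ-cong (suc n) x≈y = φ-cong (fold-φ-cong n x≈y)

  fold-φ-root : ∀ x n → fold (fold x root n) φ n ≈ x
  fold-φ-root x zero    = refl
  fold-φ-root x (suc n) = trans (reflexive (≡.sym (fold-comm φ n (root (fold x root n))))) (trans (fold-φ-cong n (root-^p _)) (fold-φ-root x n))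

  -- Right multiplication by u σˢ in K{σ}: a term a σⁿ becomes a u^(pⁿ) σ^(n+s).
  PP-twist : ∀ {n f} u s → PP n f → PP (n ℕ.+ s) (λ t → f (u * fold t φ s))
  PP-twist u s (zer f≈) = PP-zero λ t → f≈ _
  PP-twist u s (top {n} a f f≈) = top (a * fold u φ n) (PP-twist u s f) λ t → trans (f≈ _) (+-congʳ
    (trans (*-congˡ (trans (fold-φ-* u (fold t φ s) n) (*-congˡ (reflexive (≡.sym (fold-+ t φ n)))))) (sym (*-assoc _ _ _))))

  -- The length of the list is a generous bound for the p-degree: a term t^(p^j) in it satisfies j <
  -- p^j < length.
  list⇒PP : ∀ l → (∀ i → ¬ lookup l i ≈ 0# → ∃ λ j → toℕ i ≡ p ℕ.^ j) → PP (length l) (eval l)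
  list⇒PP l powers = PP-resp (λ t → trans (reflexive (≡.cong (λ l → eval l t) (≡.sym (tabulate-lookup l)))) (eval-tabulate (lookup l) t))
    (PP-sum _ monomial)
    where
      monomial : ∀ i → PP (length l) (λ t → lookup l i * t ^ toℕ i)
      monomial i with 0? (lookup l i)
      ... | yes lᵢ≈0 = PP-zero λ t → trans (*-congʳ lᵢ≈0) (zeroˡ _)
      ... | no  lᵢ≉0 with powers i lᵢ≉0
      ... | j , i≡p^j = PP-≤ (ℕ.≤-trans (ℕ.≤-trans (n<p^n j) (ℕ.≤-reflexive (≡.sym i≡p^j))) (ℕ.<⇒≤ (Fin.toℕ<n i)))
        (top {n = j} (lookup l i) (PP-zero {f = λ _ → 0#} λ _ → refl)
          λ t → trans (*-congˡ (trans (reflexive (≡.cong (t ^_) i≡p^j)) (sym (fold-φ t j)))) (sym (+-identityʳ _)))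

  PreservesPol : (Carrier → Carrier) → Set (c ⊔ ℓ)
  PreservesPol e = ∀ {h} → IsPol h → IsPol (λ z → e (h z))

  fold-φ-Pol : ∀ n {h} → IsPol h → IsPol (λ z → fold (h z) φ n)
  fold-φ-Pol zero    h = h
  fold-φ-Pol (suc n) h = IsPol-^ (fold-φ-Pol n h) p

  -- In the uses, e is the monomial t^(pⁿ - pʳ), assembled from the factors (t^(pⁱ))^(p-1) with r ≤
  -- i < n.
  Quotient : ℕ → ℕ → Set (c ⊔ ℓ)
  Quotient r n = ∃ λ e → PreservesPol e × (∀ {t} → t ≈ 0# → e t ≈ 0#) × (∀ t → fold t φ n ≈ fold t φ r * e t)

  φ-quotient-suc : ∀ n → Quotient n (suc n)
  φ-quotient-suc n = (λ t → fold t φ n ^ ℕ.pred p) , (λ h → IsPol-^ (fold-φ-Pol n h) (ℕ.pred p)) , vanish ,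
    λ t → reflexive (≡.cong (fold t φ n ^_) (≡.sym (ℕ.suc-pred p)))
    where
      instance
        p-nonZero : ℕ.NonZero p
        p-nonZero = ℕ.>-nonZero positive
      vanish : ∀ {t} → t ≈ 0# → fold t φ n ^ ℕ.pred p ≈ 0#
      vanish t≈0 = trans (^-congˡ (ℕ.pred p) (trans (fold-φ-cong n t≈0) (fold-φ-0 n)))
        (Exponents.0^n≈0 K (ℕ.≤-pred (≡.subst (1 <_) (≡.sym (ℕ.suc-pred p)) 1<p)))

  φ-quotient : ∀ {r n} → r < n → Quotient r n
  φ-quotient {r} {suc n} (s≤s r≤n) with ℕ.m≤n⇒m<n∨m≡n r≤n
  ... | inj₂ ≡.refl = φ-quotient-suc n
  ... | inj₁ r<n =
    let e  , e-Pol  , e0  , e-quotient  = φ-quotient r<n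
        e′ , e′-Pol , e′0 , e′-quotient = φ-quotient-suc n
    in (λ t → e t * e′ t) ,
      (λ h → IsPol-* (e-Pol h) (e′-Pol h)) ,
      (λ t≈0 → trans (*-congʳ (e0 t≈0)) (zeroˡ _)) ,
      (λ t → trans (e′-quotient t) (trans (*-congʳ (e-quotient t)) (*-assoc _ _ _)))

  -- The lowest power is taken out: a is the lowest nonzero coefficient and e collects the higher
  -- terms, so e(0) = 0. The two factors then have no common zero, as connectedness will require.
  -- Since `top` puts the leading term first, the recursion meets the lowest term before the others.
  PP-factor : ∀ {n f} → PP n f → (∀ t → f t ≈ 0#) ⊎
    (∃₂ λ r a → ∃ λ e → r < n × ¬ a ≈ 0# × PreservesPol e × (∀ {t} → t ≈ 0# → e t ≈ 0#) × (∀ t → f t ≈ fold t φ r * (a + e t)))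
  PP-factor (zer f≈) = inj₁ f≈
  PP-factor (top {n} b f f≈) with PP-factor f | 0? b
  ... | inj₁ f≈0 | yes b≈0 = inj₁ λ t → trans (f≈ t) (trans (+-cong (trans (*-congʳ b≈0) (zeroˡ _)) (f≈0 t)) (+-identityʳ 0#))
  ... | inj₁ f≈0 | no  b≉0 = inj₂ (n , b , (λ _ → 0#) , ℕ.≤-refl , b≉0 , (λ _ → IsPol-const 0#) , (λ _ → refl) ,
    λ t → trans (f≈ t) (trans (+-congˡ (f≈0 t)) (trans (+-identityʳ _) (trans (*-comm _ _) (*-congˡ (sym (+-identityʳ b)))))))
  ... | inj₂ (r , a , e , r<n , a≉0 , e-Pol , e0 , factor) | _ =
    let q , q-Pol , q0 , quotient = φ-quotient r<n in
    inj₂ (r , a , (λ t → b * q t + e t) , ℕ.m<n⇒m<1+n r<n , a≉0 , (λ h → IsPol-+ (IsPol-scale b (q-Pol h)) (e-Pol h)) ,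
    (λ t≈0 → trans (+-cong (trans (*-congˡ (q0 t≈0)) (zeroʳ b)) (e0 t≈0)) (+-identityʳ 0#)) ,
    λ t → trans (f≈ t) (trans (+-cong (*-congˡ (quotient t)) (factor t))
      (solve 5 (λ a b x u v → b :* (x :* u) :+ x :* (a :+ v) := x :* (a :+ (b :* u :+ v))) refl a b (fold t φ r) (q t) (e t))))

-- Connected algebraic subgroups are kernels of idempotents.

total : ∀ {k} → (Fin k → ℕ) → ℕ
total {zero}  n = 0
total {suc k} n = n zero ℕ.+ total (λ i → n (suc i))

total-≤ : ∀ {k} {n n′ : Fin k → ℕ} → (∀ i → n′ i ≤ n i) → total n′ ≤ total n
total-≤ {zero}  le = z≤n
total-≤ {suc k} le = ℕ.+-mono-≤ (le zero) (total-≤ (λ i → le (suc i)))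

total-< : ∀ {k} {n n′ : Fin k → ℕ} → (∀ i → n′ i ≤ n i) → ∀ i → n′ i < n i → total n′ < total n
total-< le zero    lt = ℕ.+-mono-<-≤ lt (total-≤ (λ i → le (suc i)))
total-< le (suc i) lt = ℕ.+-mono-≤-< (le zero) (total-< (λ i → le (suc i)) i lt)

-- For an undecidable P a least witness exists only classically; a refutation may nevertheless
-- assume one.
¬¬-least : ∀ {ℓ} (P : ℕ → Set ℓ) → (∀ d → P d → (∀ d′ → d′ < d → ¬ P d′) → ⊥) → ∀ n → ¬ P n
¬¬-least P none-least = <-rec (λ n → ¬ P n) λ n below Pn → none-least n Pn λ d′ d′<n → below d′<n

module NormalForm {c ℓ} (𝒫 : PerfectField c ℓ) (m : ℕ) where
  open PerfectField 𝒫
  open Field K hiding (zero)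
  open FieldProperties K
  open Exponents.Characteristic characteristic
  open ℤSolver commutativeRing
  open SemiringSum semiring using (sum-cong-≋; sum-replicate-zero)
  open VectorSetoid setoid using (_≋_)
  open AdditiveMaps 𝒫 m
  open Polynomials 𝒫 m
  open Linear
  open import Relation.Binary.Reasoning.Setoid setoid

  -- `connected` is phrased for two hypersurfaces g = 0 and h = 0, the shape in which `PP-factor`
  -- presents ℬ as a disjoint union.
  record ConnectedSubgroup r : Set (c ⊔ ℓ ⊔ lsuc r) where
    field
      _∈            : Point → Set r
      equations     : List (Point → Carrier)
      equations-Pol : All IsPol equations
      ∈⇒            : ∀ {z} → z ∈ → All (λ b → b z ≈ 0#) equations
      ⇒∈            : ∀ {z} → All (λ b → b z ≈ 0#) equations → z ∈
      0∈            : 𝟘 ∈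
      +∈            : ∀ {x y} → x ∈ → y ∈ → (x ⊕ y) ∈
      connected     : ∀ {g h} → IsPol g → IsPol h → (∀ z → z ∈ → g z ≈ 0# ⊎ h z ≈ 0#) →
                      (∀ z → z ∈ → ¬ (g z ≈ 0# × h z ≈ 0#)) →
                      (∀ z → z ∈ → g z ≈ 0#) ⊎ (∀ z → z ∈ → h z ≈ 0#)

    ∈-resp : ∀ {x y} → x ≋ y → x ∈ → y ∈
    ∈-resp x≋y x∈ = ⇒∈ (All.zipWith (λ { ((_ , b) , bx≈0) → trans (Pol-cong b (λ i → sym (x≋y i))) bx≈0 }) (equations-Pol , ∈⇒ x∈))

  if-zero : ∀ b t → t ≈ 0# → (if b then t else 0#) ≈ 0#
  if-zero true  t t≈0 = t≈0
  if-zero false t t≈0 = refl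

  axis-same : ∀ i t → axis i t i ≈ t
  axis-same i t with i Fin.≟ i
  ... | yes _  = refl
  ... | no i≢i = contradiction ≡.refl i≢i

  axis-other : ∀ {i j} t → i ≢ j → axis i t j ≈ 0#
  axis-other {i} {j} t i≢j with i Fin.≟ j
  ... | yes i≡j = contradiction i≡j i≢j
  ... | no _    = refl

  axis-zero : ∀ {i t} → t ≈ 0# → axis i t ≋ 𝟘
  axis-zero {i} t≈0 j = if-zero (does (i Fin.≟ j)) _ t≈0

  axis-cong : ∀ i {s t} → s ≈ t → axis i s ≋ axis i t
  axis-cong i s≈t j with does (i Fin.≟ j)
  ... | true  = s≈t
  ... | false = refl

  axis-+ : ∀ i s t → axis i (s + t) ≋ axis i s ⊕ axis i t
  axis-+ i s t j with does (i Fin.≟ j)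
  ... | true  = refl
  ... | false = sym (+-identityʳ 0#)

  sum-axis : ∀ {k} (x : Fin k → Carrier) i → sum (λ l → if does (l Fin.≟ i) then x l else 0#) ≈ x i
  sum-axis {suc k} x zero    = trans (+-congˡ (sum-replicate-zero k)) (+-identityʳ _)
  sum-axis {suc k} x (suc i) = trans (+-identityˡ _) (sum-axis (λ l → x (suc l)) i)

  record AdditiveForm (f : Point → Carrier) : Set (c ⊔ ℓ) where
    field
      f-cong : ∀ {x y} → x ≋ y → f x ≈ f y
      f-⊕    : ∀ x y → f (x ⊕ y) ≈ f x + f y

    f-𝟘 : f 𝟘 ≈ 0#
    f-𝟘 = begin
      f 𝟘                   ≈⟨ solve 1 (λ a → a := (a :+ a) :- a) refl (f 𝟘) ⟩
      (f 𝟘 + f 𝟘) - f 𝟘     ≈⟨ x≈y⇒x-y≈0 (trans (sym (f-⊕ 𝟘 𝟘)) (f-cong (λ i → +-identityʳ 0#))) ⟩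
      0#                    ∎

    f-sum : ∀ {k} (g : Fin k → Point) → f (λ i → sum (λ l → g l i)) ≈ sum (λ l → f (g l))
    f-sum {zero}  g = f-𝟘
    f-sum {suc k} g = trans (f-⊕ _ _) (+-congˡ (f-sum (λ l → g (suc l))))

    vanishes-on-axes : ∀ y → (∀ l → f (axis l (y l)) ≈ 0#) → f y ≈ 0#
    vanishes-on-axes y zero-on-axes = begin
      f y                                         ≈⟨ f-cong (λ i → sym (sum-axis y i)) ⟩
      f (λ i → sum (λ l → axis l (y l) i))        ≈⟨ f-sum (λ l → axis l (y l)) ⟩
      sum (λ l → f (axis l (y l)))                ≈⟨ trans (sum-cong-≋ zero-on-axes) (sum-replicate-zero m) ⟩
      0#                                          ∎

    concentrated : ∀ i → (∀ l → l ≢ i → ∀ t → f (axis l t) ≈ 0#) → ∀ x → f x ≈ f (axis i (x i))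
    concentrated i zero-off x = begin
      f x                                 ≈⟨ f-cong (λ l → solve 2 (λ a b → a := b :+ (a :- b)) refl (x l) (axis i (x i) l)) ⟩
      f (axis i (x i) ⊕ y)                ≈⟨ f-⊕ _ _ ⟩
      f (axis i (x i)) + f y              ≈⟨ +-congˡ (vanishes-on-axes y zero-on-axes) ⟩
      f (axis i (x i)) + 0#               ≈⟨ +-identityʳ _ ⟩
      f (axis i (x i))                    ∎
      where
        y = x ⊖ axis i (x i)
        zero-on-axes : ∀ l → f (axis l (y l)) ≈ 0#
        zero-on-axes l with l Fin.≟ i
        ... | no l≢i = zero-off l l≢i _
        ... | yes ≡.refl = trans (f-cong (axis-zero {l} (x≈y⇒x-y≈0 (sym (axis-same l (x l)))))) f-𝟘

  Supported : (Fin m → Bool) → Point → Set ℓ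
  Supported S x = ∀ l → S l ≡ false → x l ≈ 0#

  mask-supported : ∀ S x → Supported S (mask S x)
  mask-supported S x l Sl = reflexive (≡.cong (if_then x l else 0#) Sl)

  mask-id : ∀ {S x} → Supported S x → mask S x ≋ x
  mask-id {S} {x} x∈S l = lemma (S l) ≡.refl
    where
      lemma : ∀ b → S l ≡ b → mask S x l ≈ x l
      lemma true  Sl = reflexive (≡.cong (if_then x l else 0#) Sl)
      lemma false Sl = trans (mask-supported S x l Sl) (sym (x∈S l Sl))

  mask-cong : ∀ S {x y} → x ≋ y → mask S x ≋ mask S y
  mask-cong S x≋y l with S l
  ... | true  = x≋y l
  ... | false = refl

  mask-linear : ∀ S → Linear (mask S)
  mask-linear S = record { cong = mask-cong S ; additive = additive′ ; homogeneous = homogeneous′ }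
    where
      additive′ : ∀ x y → mask S (x ⊕ y) ≋ mask S x ⊕ mask S y
      additive′ x y l with S l
      ... | true  = refl
      ... | false = sym (+-identityʳ 0#)
      homogeneous′ : ∀ a x → mask S (a ⊙ x) ≋ a ⊙ mask S x
      homogeneous′ a x l with S l
      ... | true  = refl
      ... | false = sym (zeroʳ a)

  -- The elementary operation x_j ↦ x_j + u x_i^(pˢ) over K{σ}, with inverse the shear by -u because
  -- x_i is unchanged.
  module Shear (i j : Fin m) (i≢j : i ≢ j) (s : ℕ) where

    shear : Carrier → Map
    shear u x = x ⊕ axis j (u * fold (x i) φ s)

    shear-AP : ∀ u → IsAP (shear u)
    shear-AP u = IsAP-⊕ (linear⇒AP id-linear) (IsAP-resp (λ z → axis-cong j (*-congˡ (reflexive (≡.sym (fold-F s z i))))) (IsAP-Fᵏ s (linear⇒AP entry-linear)))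
      where
        entry-linear : Linear (λ w → axis j (u * w i))
        entry-linear = record
          { cong        = λ eq → axis-cong j (*-congˡ (eq i))
          ; additive    = λ x y → ≋-trans (axis-cong j (distribˡ u _ _)) (axis-+ j _ _)
          ; homogeneous = homogeneous′
          }
          where
            homogeneous′ : ∀ a x → axis j (u * (a * x i)) ≋ a ⊙ axis j (u * x i)
            homogeneous′ a x l with does (j Fin.≟ l)
            ... | true  = solve 3 (λ u a x → u :* (a :* x) := a :* (u :* x)) refl u a (x i)
            ... | false = sym (zeroʳ a)

    shear-Pol : ∀ u → PolyMap (shear u)
    shear-Pol u l = IsPol-+ (IsPol-coordinate l) axis-Pol
      where
        axis-Pol : IsPol (λ z → axis j (u * fold (z i) φ s) l)
        axis-Pol with does (j Fin.≟ l)
        ... | true  = IsPol-scale u (fold-φ-Pol s (IsPol-coordinate i))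
        ... | false = IsPol-const 0#

    shear-i : ∀ u x → shear u x i ≈ x i
    shear-i u x = trans (+-congˡ (axis-other _ (λ j≡i → i≢j (≡.sym j≡i)))) (+-identityʳ _)

    shear-inverse : ∀ {u v} → u + v ≈ 0# → ∀ x → shear u (shear v x) ≋ x
    shear-inverse {u} {v} u+v≈0 x l = begin
      (x l + axis j (v * w) l) + axis j (u * fold (shear v x i) φ s) l   ≈⟨ +-congˡ (axis-cong j (*-congˡ (fold-φ-cong s (shear-i v x))) l) ⟩
      (x l + axis j (v * w) l) + axis j (u * w) l                        ≈⟨ +-assoc _ _ _ ⟩
      x l + (axis j (v * w) l + axis j (u * w) l)                        ≈⟨ +-congˡ (axis-+ j (v * w) (u * w) l) ⟨
      x l + axis j (v * w + u * w) l                                     ≈⟨ +-congˡ (axis-zero {j} (trans (sym (distribʳ w v u)) (trans (*-congʳ (trans (+-comm v u) u+v≈0)) (zeroˡ w))) l) ⟩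
      x l + 0#                                                           ≈⟨ +-identityʳ _ ⟩
      x l                                                                ∎
      where w = fold (x i) φ s

  module Reduction {r} (ℬ : ConnectedSubgroup r) where
    open ConnectedSubgroup ℬ

    record Splitting : Set (c ⊔ ℓ ⊔ r) where
      field
        E            : Map
        E-AP         : IsAP E
        E-idempotent : ∀ z → E (E z) ≋ E z
        ∈⇒E          : ∀ {z} → z ∈ → E z ≋ 𝟘
        E⇒∈          : ∀ {z} → E z ≋ 𝟘 → z ∈

    -- Polynomial coordinates V on K^m in which ℬ lies in the subspace with coordinates in S.
    record Coordinates (S : Fin m → Bool) : Set (c ⊔ ℓ ⊔ r) where
      field
        V W       : Map
        V-AP      : IsAP V
        W-AP      : IsAP W
        V-Pol     : PolyMap V
        W-Pol     : PolyMap W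
        VW        : ∀ z → V (W z) ≋ z
        WV        : ∀ z → W (V z) ≋ z
        supported : ∀ {z} → z ∈ → Supported S (W z)

      V-cong : ∀ {x y} → x ≋ y → V x ≋ V y
      V-cong = AP-cong (proj₂ V-AP)

      W-cong : ∀ {x y} → x ≋ y → W x ≋ W y
      W-cong = AP-cong (proj₂ W-AP)

    -- In these coordinates ℬ is a full coordinate subspace; the projection onto the complementary
    -- coordinates, transported back by V, has ℬ as its kernel.
    full⇒splitting : ∀ {S} (𝒱 : Coordinates S) → (∀ x → Supported S x → (Coordinates.V 𝒱 x) ∈) → Splitting
    full⇒splitting {S} 𝒱 full = record
      { E = λ z → V (mask S′ (W z))
      ; E-AP = IsAP-∘ V-AP (IsAP-∘ (linear⇒AP (mask-linear S′)) W-AP)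
      ; E-idempotent = λ z → V-cong (≋-trans (mask-cong S′ (WV _)) (mask-id (mask-supported S′ (W z))))
      ; ∈⇒E = λ {z} z∈ → ≋-trans (V-cong (complement (supported z∈))) (AP-𝟘 (proj₂ V-AP))
      ; E⇒∈ = λ {z} Ez≋𝟘 → ∈-resp (VW z) (full (W z) (off-complement (V-injective₀ Ez≋𝟘)))
      }
      where
        open Coordinates 𝒱
        S′ : Fin m → Bool
        S′ l = not (S l)
        complement : ∀ {x} → Supported S x → mask S′ x ≋ 𝟘
        complement {x} x∈S l = lemma (S l) ≡.refl
          where
            lemma : ∀ b → S l ≡ b → mask S′ x l ≈ 0#
            lemma true  Sl = mask-supported S′ x l (≡.cong not Sl)
            lemma false Sl = if-zero (S′ l) (x l) (x∈S l Sl)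
        off-complement : ∀ {x} → mask S′ x ≋ 𝟘 → Supported S x
        off-complement {x} eq l Sl = trans (reflexive (≡.cong (λ b → if not b then x l else 0#) (≡.sym Sl))) (eq l)
        V-injective₀ : ∀ {x} → V x ≋ 𝟘 → x ≋ 𝟘
        V-injective₀ {x} eq = ≋-trans (≋-sym (WV x)) (≋-trans (W-cong eq) (AP-𝟘 (proj₂ W-AP)))

    size : (Fin m → Bool) → ℕ
    size S = total (λ l → if S l then 1 else 0)

    remove : (Fin m → Bool) → Fin m → (Fin m → Bool)
    remove S i l = S l ∧ not (does (i Fin.≟ l))

    size-remove : ∀ {S i} → S i ≡ true → size (remove S i) < size S
    size-remove {S} {i} Si = total-< le i lt
      where
        le : ∀ l → (if remove S i l then 1 else 0) ≤ (if S l then 1 else 0)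
        le l with S l | does (i Fin.≟ l)
        ... | true  | true  = z≤n
        ... | true  | false = s≤s z≤n
        ... | false | _     = z≤n
        lt : (if remove S i i then 1 else 0) < (if S i then 1 else 0)
        lt with i Fin.≟ i
        ... | yes _  rewrite Si = s≤s z≤n
        ... | no i≢i = contradiction ≡.refl i≢i

    -- f is read in the coordinates 𝒱: it is f ∘ W that vanishes on ℬ, and f has p-degree < nₗ in the l-th coordinate.
    record Relation {S} (𝒱 : Coordinates S) : Set (c ⊔ ℓ ⊔ r) where
      open Coordinates 𝒱
      field
        f        : Point → Carrier
        additive-form : AdditiveForm f
        nonzero  : ∃ λ x → ¬ f x ≈ 0#
        vanishes : ∀ {z} → z ∈ → f (W z) ≈ 0#
        n        : Fin m → ℕ
        f-PP     : ∀ l → PP (n l) (λ t → f (axis l t))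
        outside  : ∀ l → S l ≡ false → n l ≡ 0
      open AdditiveForm additive-form public

      inside : ∀ {i} → 0 < n i → S i ≡ true
      inside {i} 0<nᵢ = lemma (S i) ≡.refl
        where
          lemma : ∀ b → S i ≡ b → S i ≡ true
          lemma true  Si = Si
          lemma false Si = contradiction (outside i Si) (ℕ.>⇒≢ 0<nᵢ)

    -- The coefficient `a` may be zero, as n l only bounds the p-degree; that case is the task of
    -- `drop-leading`.
    record Leading (k : ℕ) (g : Carrier → Carrier) : Set (c ⊔ ℓ) where
      constructor leading
      field
        {d}      : ℕ
        {g′}     : Carrier → Carrier
        k≡1+d    : k ≡ suc d
        a        : Carrier
        g′-PP    : PP d g′
        expansion : ∀ t → g t ≈ a * fold t φ d + g′ t

    leadingTerm : ∀ {k g} → PP k g → 0 < k → Leading k g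
    leadingTerm (top a g′ eq) _ = leading ≡.refl a g′ eq

    Smaller : ∀ {S} {𝒱 : Coordinates S} → Relation 𝒱 → Set (c ⊔ ℓ ⊔ r)
    Smaller {S} R = ∃₂ λ (𝒱′ : Coordinates S) (R′ : Relation 𝒱′) → total (Relation.n R′) < total (Relation.n R)

    module _ {S} {𝒱 : Coordinates S} (R : Relation 𝒱) where
      open Coordinates 𝒱
      open Relation R

      private
        lowered-≤ : ∀ i k → k < n i → ∀ l → updateAt n i (Function.const k) l ≤ n l
        lowered-≤ i k k<nᵢ l with l Fin.≟ i
        ... | yes ≡.refl = ℕ.≤-trans (ℕ.≤-reflexive (updateAt-updates i n)) (ℕ.<⇒≤ k<nᵢ)
        ... | no  l≢i    = ℕ.≤-reflexive (updateAt-minimal l i n l≢i)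

        lowered-< : ∀ i k → k < n i → total (updateAt n i (Function.const k)) < total n
        lowered-< i k k<nᵢ = total-< (lowered-≤ i k k<nᵢ) i (ℕ.≤-trans (ℕ.≤-reflexive (≡.cong suc (updateAt-updates i n))) k<nᵢ)

        lowered-PP : ∀ {g : Fin m → Carrier → Carrier} i k → PP k (g i) → (∀ l → l ≢ i → PP (n l) (g l)) → ∀ l → PP (updateAt n i (Function.const k) l) (g l)
        lowered-PP i k gᵢ g l with l Fin.≟ i
        ... | yes ≡.refl = ≡.subst (λ k → PP k _) (≡.sym (updateAt-updates i n)) gᵢ
        ... | no  l≢i    = ≡.subst (λ k → PP k _) (≡.sym (updateAt-minimal l i n l≢i)) (g l l≢i)

        lowered-outside : ∀ i k → k < n i → ∀ l → S l ≡ false → updateAt n i (Function.const k) l ≡ 0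
        lowered-outside i k k<nᵢ l Sl = ℕ.n≤0⇒n≡0 (ℕ.≤-trans (lowered-≤ i k k<nᵢ l) (ℕ.≤-reflexive (outside l Sl)))

      drop-leading : ∀ i → (L : Leading (n i) (λ t → f (axis i t))) → Leading.a L ≈ 0# → Smaller R
      drop-leading i (leading {d} nᵢ≡1+d a g′-PP eq) a≈0 = 𝒱 , record
        { f = f ; additive-form = additive-form ; nonzero = nonzero ; vanishes = vanishes
        ; n = updateAt n i (Function.const d)
        ; f-PP = lowered-PP i d (PP-resp (λ t → trans (eq t) (trans (+-congʳ (trans (*-congʳ a≈0) (zeroˡ _))) (+-identityˡ _))) g′-PP) (λ l _ → f-PP l)
        ; outside = lowered-outside i d d<nᵢ
        } , lowered-< i d d<nᵢ
        where
          d<nᵢ : d < n i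
          d<nᵢ = ℕ.≤-reflexive (≡.sym nᵢ≡1+d)

      -- A step of Euclid's algorithm: the shear by u cancels the leading term of f in the i-th coordinate.
      cancel-leading : ∀ i j → i ≢ j → (Lᵢ : Leading (n i) (λ t → f (axis i t))) (Lⱼ : Leading (n j) (λ t → f (axis j t))) →
        ¬ Leading.a Lⱼ ≈ 0# → n j ≤ n i → Smaller R
      cancel-leading i j i≢j (leading {d} {g} nᵢ≡ a g-PP f≈) (leading {d′} {g′} nⱼ≡ a′ g′-PP f≈′) a′≉0 nⱼ≤nᵢ =
        record
          { V = λ x → V (shear u x) ; W = λ z → shear (- u) (W z)
          ; V-AP = IsAP-∘ V-AP (shear-AP u) ; W-AP = IsAP-∘ (shear-AP (- u)) W-AP
          ; V-Pol = λ l → IsPol-∘ (V-Pol l) (shear-Pol u) ; W-Pol = λ l → IsPol-∘ (shear-Pol (- u) l) W-Pol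
          ; VW = λ z → ≋-trans (V-cong (shear-inverse (-‿inverseʳ u) (W z))) (VW z)
          ; WV = λ x → ≋-trans (AP-cong (proj₂ (shear-AP (- u))) (WV (shear u x))) (shear-inverse (-‿inverseˡ u) x)
          -- Since n j is positive, j lies in S, so the shear alters no coordinate outside S.
          ; supported = λ {z} z∈ l Sl → trans (+-congˡ (axis-other _ (j≢ l Sl))) (trans (+-identityʳ _) (supported z∈ l Sl))
          } , record
          { f = λ x → f (shear u x)
          ; additive-form = record
            { f-cong = λ eq → f-cong (AP-cong (proj₂ (shear-AP u)) eq)
            ; f-⊕ = λ x y → trans (f-cong (AP-additive (proj₂ (shear-AP u)) x y)) (f-⊕ _ _)
            }
          ; nonzero = shear (- u) (proj₁ nonzero) , λ eq → proj₂ nonzero (trans (f-cong (≋-sym (shear-inverse (-‿inverseʳ u) _))) eq)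
          ; vanishes = λ {z} z∈ → trans (f-cong (shear-inverse (-‿inverseʳ u) (W z))) (vanishes z∈)
          ; n = updateAt n i (Function.const d)
          ; f-PP = lowered-PP i d (PP-resp sheared-i (PP-+ g-PP (≡.subst (λ d → PP d (λ t → g′ (u * fold t φ s))) d′+s≡d (PP-twist u s g′-PP))))
              (λ l l≢i → PP-resp (sheared-other l l≢i) (f-PP l))
          ; outside = lowered-outside i d d<nᵢ
          } , lowered-< i d d<nᵢ
        where
          -- σˢ lifts the leading degree d′ of the j-th part to the leading degree d of the i-th.
          s = d ℕ.∸ d′
          open Shear i j i≢j s
          d<nᵢ : d < n i
          d<nᵢ = ℕ.≤-reflexive (≡.sym nᵢ≡)
          d′+s≡d : d′ ℕ.+ s ≡ d
          d′+s≡d = ℕ.m+[n∸m]≡n (ℕ.≤-pred (≡.subst₂ _≤_ nⱼ≡ nᵢ≡ nⱼ≤nᵢ))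
          a′⁻¹ = proj₁ (inverse a′≉0)
          -- The solution of a + a′ u^(p^d′) = 0, obtained by d′ successive p-th roots; without a
          -- perfect field the division step would be impossible.
          u = fold (- (a * a′⁻¹)) root d′
          j≢ : ∀ l → S l ≡ false → j ≢ l
          j≢ l Sl ≡.refl with ≡.trans (≡.sym (inside {j} (ℕ.≤-trans (s≤s z≤n) (ℕ.≤-reflexive (≡.sym nⱼ≡))))) Sl
          ... | ()

          a′u≈-a : a′ * fold u φ d′ ≈ - a
          a′u≈-a = begin
            a′ * fold u φ d′        ≈⟨ *-congˡ (fold-φ-root _ d′) ⟩
            a′ * - (a * a′⁻¹)       ≈⟨ solve 3 (λ a a′ a′⁻¹ → a′ :* (:- (a :* a′⁻¹)) := :- (a′ :* a′⁻¹ :* a)) refl a a′ a′⁻¹ ⟩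
            - (a′ * a′⁻¹ * a)       ≈⟨ -‿cong (trans (*-congʳ (proj₂ (inverse a′≉0))) (*-identityˡ a)) ⟩
            - a                     ∎

          sheared-i : ∀ t → f (shear u (axis i t)) ≈ g t + g′ (u * fold t φ s)
          sheared-i t = begin
            f (axis i t ⊕ axis j (u * fold (axis i t i) φ s))                  ≈⟨ f-⊕ _ _ ⟩
            f (axis i t) + f (axis j (u * fold (axis i t i) φ s))              ≈⟨ +-cong (f≈ t) (trans (f-cong (axis-cong j (*-congˡ (fold-φ-cong s (axis-same i t))))) (f≈′ w)) ⟩
            (a * fold t φ d + g t) + (a′ * fold w φ d′ + g′ w)                 ≈⟨ +-congˡ (+-congʳ (*-congˡ (fold-φ-* u (fold t φ s) d′))) ⟩
            (a * fold t φ d + g t) + (a′ * (fold u φ d′ * fold (fold t φ s) φ d′) + g′ w)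
              ≡⟨ ≡.cong (λ x → (a * fold t φ d + g t) + (a′ * (fold u φ d′ * x) + g′ w)) (≡.trans (≡.sym (fold-+ t φ d′)) (≡.cong (fold t φ) d′+s≡d)) ⟩
            (a * x + g t) + (a′ * (fold u φ d′ * x) + g′ w)                    ≈⟨ solve 6 (λ a x g a′ y g′ → (a :* x :+ g) :+ (a′ :* (y :* x) :+ g′) := (a :+ a′ :* y) :* x :+ (g :+ g′)) refl a x (g t) a′ (fold u φ d′) (g′ w) ⟩
            (a + a′ * fold u φ d′) * x + (g t + g′ w)                          ≈⟨ +-congʳ (trans (*-congʳ (trans (+-congˡ a′u≈-a) (-‿inverseʳ a))) (zeroˡ x)) ⟩
            0# + (g t + g′ w)                                                  ≈⟨ +-identityˡ _ ⟩
            g t + g′ w                                                         ∎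
            where
              w = u * fold t φ s
              x = fold t φ d

          sheared-other : ∀ l → l ≢ i → ∀ t → f (shear u (axis l t)) ≈ f (axis l t)
          sheared-other l l≢i t = f-cong (≋-trans (⊕-cong ≋-refl (axis-zero {j} (trans (*-congˡ (trans (fold-φ-cong s (axis-other t l≢i)) (fold-φ-0 s))) (zeroʳ u)))) (λ k → +-identityʳ _))

      shorten : ∀ i j → i ≢ j → 0 < n j → n j ≤ n i → Smaller R
      shorten i j i≢j 0<nⱼ nⱼ≤nᵢ = lemma (leadingTerm (f-PP i) (ℕ.<-≤-trans 0<nⱼ nⱼ≤nᵢ)) (leadingTerm (f-PP j) 0<nⱼ)
        where
          lemma : Leading (n i) (λ t → f (axis i t)) → Leading (n j) (λ t → f (axis j t)) → Smaller R
          lemma Lᵢ Lⱼ with 0? (Leading.a Lⱼ)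
          ... | yes a≈0 = drop-leading j Lⱼ a≈0
          ... | no  a≉0 = cancel-leading i j i≢j Lᵢ Lⱼ a≉0 nⱼ≤nᵢ

      -- On ℬ the only coordinate w occurring in f satisfies w^(p^k) (a + e w) = 0, so w = 0 by connectedness.
      eliminate : ∀ i → (∀ l → l ≢ i → n l ≡ 0) → ∃ λ S′ → size S′ < size S × Coordinates S′
      eliminate i n≡0 = lemma (PP-factor (f-PP i))
        where
          f-axis : ∀ x → f x ≈ f (axis i (x i))
          f-axis = concentrated i λ l l≢i t → PP0⇒zero (≡.subst (λ n → PP n _) (n≡0 l l≢i) (f-PP l)) t

          removed : ∀ {z} → z ∈ → W z i ≈ 0# → Supported (remove S i) (W z)
          removed {z} z∈ Wzi≈0 l Sl with i Fin.≟ l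
          ... | yes ≡.refl = Wzi≈0
          ... | no  i≢l    = supported z∈ l (lemma′ (S l) Sl)
            where
              lemma′ : ∀ b → (b ∧ true) ≡ false → b ≡ false
              lemma′ false _ = ≡.refl

          W-𝟘 : ∀ l → W 𝟘 l ≈ 0#
          W-𝟘 = AP-𝟘 (proj₂ W-AP)

          lemma : _ → ∃ λ S′ → size S′ < size S × Coordinates S′
          lemma (inj₁ f≈0) = contradiction (trans (f-axis _) (f≈0 _)) (proj₂ nonzero)
          lemma (inj₂ (k , a , e , k<nᵢ , a≉0 , e-Pol , e0 , factor)) = remove S i , size-remove (inside (ℕ.≤-<-trans z≤n k<nᵢ)) , record
            { V = V ; W = W ; V-AP = V-AP ; W-AP = W-AP ; V-Pol = V-Pol ; W-Pol = W-Pol ; VW = VW ; WV = WV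
            ; supported = λ {z} z∈ → removed z∈ (coordinate-zero z z∈)
            }
            where
              fold-zero : ∀ k {t} → fold t φ k ≈ 0# → t ≈ 0#
              fold-zero zero    t≈0 = t≈0
              fold-zero (suc k) t≈0 = fold-zero k (φ-injective (trans t≈0 (sym φ-0)))
              cover : ∀ z → z ∈ → W z i ≈ 0# ⊎ a + e (W z i) ≈ 0#
              cover z z∈ with 0? (W z i)
              ... | yes w≈0 = inj₁ w≈0
              ... | no  w≉0 = inj₂ (xy≈0⇒y≈0 (λ eq → w≉0 (fold-zero k eq)) (trans (sym (factor _)) (trans (sym (f-axis (W z))) (vanishes z∈))))
              apart : ∀ {t} → t ≈ 0# → ¬ a + e t ≈ 0#
              apart t≈0 eq = a≉0 (trans (sym (trans (+-congˡ (e0 t≈0)) (+-identityʳ a))) eq)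
              coordinate-zero : ∀ z → z ∈ → W z i ≈ 0#
              coordinate-zero with connected (W-Pol i) (IsPol-+ (IsPol-const a) (e-Pol (W-Pol i))) cover (λ z _ (w≈0 , eq) → apart w≈0 eq)
              ... | inj₁ zero-everywhere = zero-everywhere
              -- At the origin, which lies on ℬ, the second factor takes the value a ≠ 0.
              ... | inj₂ bad = contradiction (bad 𝟘 0∈) (apart (W-𝟘 i))

    -- `none` is the induction hypothesis of `reduce`. While f involves two coordinates, Euclid's
    -- algorithm lowers the total p-degree; with one coordinate left, ℬ loses a dimension of its
    -- ambient subspace, against `none`; with no coordinate left, f would be zero.
    euclid : ∀ {S} → (∀ S′ → size S′ < size S → ¬ Coordinates S′) →
      ∀ k {𝒱 : Coordinates S} (R : Relation 𝒱) → ¬ total (Relation.n R) < k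
    euclid {S} none (suc k) {𝒱} R (s≤s n≤k) = cases (Fin.any? λ i → Fin.any? λ j → ¬? (i Fin.≟ j) ×-dec (0 ℕ.<? n i ×-dec 0 ℕ.<? n j))
        (Fin.any? λ i → 0 ℕ.<? n i)
      where
        open Relation R
        recurse : Smaller R → ⊥
        recurse (𝒱′ , R′ , lt) = euclid none k R′ (ℕ.<-≤-trans lt n≤k)
        cases : Dec (∃ λ i → ∃ λ j → i ≢ j × 0 < n i × 0 < n j) → Dec (∃ λ i → 0 < n i) → ⊥
        cases (yes (i , j , i≢j , 0<nᵢ , 0<nⱼ)) _ with ℕ.≤-total (n j) (n i)
        ... | inj₁ nⱼ≤nᵢ = recurse (shorten R i j i≢j 0<nⱼ nⱼ≤nᵢ)
        ... | inj₂ nᵢ≤nⱼ = recurse (shorten R j i (λ j≡i → i≢j (≡.sym j≡i)) 0<nᵢ nᵢ≤nⱼ)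
        cases (no ¬two) (yes (i , 0<nᵢ)) =
          let S′ , lt , 𝒱′ = eliminate R i λ l l≢i → ℕ.n≤0⇒n≡0 (ℕ.≮⇒≥ λ 0<nₗ → ¬two (i , l , (λ i≡l → l≢i (≡.sym i≡l)) , 0<nᵢ , 0<nₗ))
          in none S′ lt 𝒱′
        cases (no ¬two) (no none-positive) = proj₂ nonzero (vanishes-on-axes _ λ l → PP0⇒zero (≡.subst (λ n → PP n _) (zero-degree l) (f-PP l)) _)
          where
            zero-degree : ∀ l → n l ≡ 0
            zero-degree l = ℕ.n≤0⇒n≡0 (ℕ.≮⇒≥ λ 0<nₗ → none-positive (l , 0<nₗ))

    -- A nonzero polynomial of least degree vanishing on ℬ is additive: its differences have smaller degree.
    module Minimal {S} (𝒱 : Coordinates S) where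
      open Coordinates 𝒱

      Vanishing : ℕ → Set (c ⊔ ℓ ⊔ r)
      Vanishing d = ∃ λ f → Pol d f × (∃ λ x → Supported S x × ¬ f x ≈ 0#) × (∀ z → z ∈ → f (W z) ≈ 0#)

      module _ {d f} (f-Pol : Pol d f) (nonzero : ∃ λ x → Supported S x × ¬ f x ≈ 0#)
          (vanishes : ∀ z → z ∈ → f (W z) ≈ 0#) (minimal : ∀ d′ → d′ < d → ¬ Vanishing d′) where

        vanishing⇒zero-on-S : ∀ {d′ g} → d′ < d → Pol d′ g → (∀ z → z ∈ → g (W z) ≈ 0#) → ∀ x → Supported S x → g x ≈ 0#
        vanishing⇒zero-on-S {g = g} d′<d g-Pol g-vanishes x x∈S with 0? (g x)
        ... | yes gx≈0 = gx≈0
        ... | no  gx≉0 = contradiction (g , g-Pol , (x , x∈S , gx≉0) , g-vanishes) (minimal _ d′<d)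

        f-cong : ∀ {x y} → x ≋ y → f x ≈ f y
        f-cong = Pol-cong f-Pol

        f-𝟘 : f 𝟘 ≈ 0#
        f-𝟘 = trans (f-cong (≋-sym (AP-𝟘 (proj₂ W-AP)))) (vanishes 𝟘 0∈)

        ⊕-comm : ∀ x y → (x ⊕ y) ≋ (y ⊕ x)
        ⊕-comm x y i = +-comm (x i) (y i)

        -- The difference f(x ⊕ W z) - f(x) has smaller degree and vanishes on ℬ, because ℬ is
        -- closed under addition and W is additive; by minimality it vanishes on the subspace S.
        periodic : ∀ z → z ∈ → ∀ x → Supported S x → f (x ⊕ W z) ≈ f x
        periodic z z∈ x x∈S = lemma d ≡.refl f-Pol
          where
            difference-vanishes : ∀ z′ → z′ ∈ → f (W z′ ⊕ W z) - f (W z′) ≈ 0#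
            difference-vanishes z′ z′∈ = x≈y⇒x-y≈0 (trans (f-cong (≋-sym (AP-additive (proj₂ W-AP) z′ z)))
              (trans (vanishes _ (+∈ z′∈ z∈)) (sym (vanishes z′ z′∈))))
            lemma : ∀ e → e ≡ d → Pol e f → f (x ⊕ W z) ≈ f x
            lemma zero    _      f-Pol = trans (Pol0⇒zero f-Pol _) (sym (Pol0⇒zero f-Pol x))
            lemma (suc e) ≡.refl f-Pol = x-y≈0⇒x≈y (vanishing⇒zero-on-S (ℕ.n<1+n e) (Pol-difference (W z) f-Pol) difference-vanishes x x∈S)

        -- As a function of x, f(x ⊕ y) - f(x) - f(y) has smaller degree, and `periodic` makes it
        -- vanish on ℬ. Minimality is used a second time.
        additive-on-S : ∀ x y → Supported S x → Supported S y → f (x ⊕ y) ≈ f x + f y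
        additive-on-S x y x∈S y∈S = lemma d ≡.refl f-Pol
          where
            difference-constant : ∀ z → z ∈ → (f (W z ⊕ y) - f (W z)) + - f y ≈ 0#
            difference-constant z z∈ = begin
              (f (W z ⊕ y) - f (W z)) - f y   ≈⟨ +-congʳ (+-cong (trans (f-cong (⊕-comm (W z) y)) (periodic z z∈ y y∈S)) (-‿cong (vanishes z z∈))) ⟩
              (f y - 0#) - f y                ≈⟨ solve 1 (λ a → (a :- con (ℤ.+ 0)) :- a := con (ℤ.+ 0)) refl (f y) ⟩
              0#                              ∎
            constant⇒zero : ∀ {e} → Pol (suc zero) f → ∀ x → f x ≈ 0#
            constant⇒zero f-Pol x = trans (f-cong (λ i → sym (+-identityˡ (x i))))
              (trans (x-y≈0⇒x≈y (Pol0⇒zero (Pol-difference x f-Pol) 𝟘)) f-𝟘)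
            lemma : ∀ e → e ≡ d → Pol e f → f (x ⊕ y) ≈ f x + f y
            -- Subtracting the constant f y needs a degree bound of at least 1 after the drop, so
            -- the bounds 0 and 1 are separate; there f is constant with f(0) = 0, contrary to
            -- `nonzero`.
            lemma zero          _      f-Pol = contradiction (Pol0⇒zero f-Pol _) (proj₂ (proj₂ nonzero))
            lemma (suc zero)    _      f-Pol = contradiction (constant⇒zero {0} f-Pol _) (proj₂ (proj₂ nonzero))
            lemma (suc (suc e)) ≡.refl f-Pol = x-y≈0⇒x≈y (trans
              (solve 3 (λ a b c → a :- (b :+ c) := (a :- b) :+ (:- c)) refl (f (x ⊕ y)) (f x) (f y))
              (vanishing⇒zero-on-S (ℕ.n<1+n (suc e)) (add (Pol-difference y f-Pol) (con (- f y) (λ _ → refl)) (λ _ → refl)) difference-constant x x∈S))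

        -- f is known to be additive only on the subspace S; composing with the projection onto S
        -- gives a form that is additive everywhere and agrees with f on S.
        g : Point → Carrier
        g x = f (mask S x)

        g-additive : AdditiveForm g
        g-additive = record
          { f-cong = λ eq → f-cong (mask-cong S eq)
          ; f-⊕ = λ x y → trans (f-cong (Linear.additive (mask-linear S) x y))
              (additive-on-S (mask S x) (mask S y) (mask-supported S x) (mask-supported S y))
          }

        axis-PP : ∀ l → ∃ λ n → PP n (λ t → g (axis l t)) × (S l ≡ false → n ≡ 0)
        axis-PP l = lemma (S l) ≡.refl
          where
            lemma : ∀ b → S l ≡ b → ∃ λ n → PP n (λ t → g (axis l t)) × (S l ≡ false → n ≡ 0)
            lemma false Sl = 0 , zer (λ t → trans (f-cong (masked t)) f-𝟘) , λ _ → ≡.refl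
              where
                masked : ∀ t → mask S (axis l t) ≋ 𝟘
                masked t k with l Fin.≟ k
                ... | yes ≡.refl = reflexive (≡.cong (λ b → if b then t else 0#) Sl)
                ... | no  _      = if-zero (S k) 0# refl
            lemma true Sl with Pol-axis l (Pol-mask S f-Pol)
            ... | as , g≈ = length as , PP-resp g≈ (list⇒PP as powers) , λ Sl′ → contradiction (≡.trans (≡.sym Sl) Sl′) λ ()
              where
                open AdditiveForm g-additive using () renaming (f-cong to g-cong; f-⊕ to g-⊕)
                eval-additive : ∀ s t → eval as (s + t) ≈ eval as s + eval as t
                eval-additive s t = trans (sym (g≈ (s + t))) (trans (g-cong (axis-+ l s t)) (trans (g-⊕ _ _) (+-cong (g≈ s) (g≈ t))))
                powers : ∀ i → _ → _
                powers i aᵢ≉0 = additive⇒power θ θ-powers _ (additive-coefficients as eval-additive i aᵢ≉0)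

        relation : Relation 𝒱
        relation = record
          { f = g
          ; additive-form = g-additive
          ; nonzero = let x , x∈S , fx≉0 = nonzero in x , λ gx≈0 → fx≉0 (trans (f-cong (≋-sym (mask-id x∈S))) gx≈0)
          ; vanishes = λ {z} z∈ → trans (f-cong (mask-id (supported z∈))) (vanishes z z∈)
          ; n = λ l → proj₁ (axis-PP l)
          ; f-PP = λ l → proj₁ (proj₂ (axis-PP l))
          ; outside = λ l → proj₂ (proj₂ (axis-PP l))
          }

    -- Induction on the number of coordinates in S. If every equation of ℬ vanishes on the subspace
    -- S, then ℬ fills it and splits. Otherwise an equation is a nonzero polynomial on S vanishing
    -- on ℬ; classically there is one of least degree, it yields an additive relation, and `euclid`
    -- removes a coordinate.
    reduce : (¬ Splitting) → ∀ k {S} → size S < k → ¬ Coordinates S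
    reduce ¬split (suc k) {S} (s≤s S≤k) 𝒱 = ¬split (full⇒splitting 𝒱 λ x x∈S → ⇒∈ (All.map (λ { {b} b-Pol → equation-on-S b-Pol x x∈S }) equations-Pol′))
      where
        open Coordinates 𝒱
        open Minimal 𝒱
        none : ∀ S′ → size S′ < size S → ¬ Coordinates S′
        none S′ lt = reduce ¬split k (ℕ.<-≤-trans lt S≤k)
        no-relation : ¬ Relation 𝒱
        no-relation R = euclid none _ R (ℕ.n<1+n _)
        no-vanishing : ∀ d → ¬ Vanishing d
        no-vanishing = ¬¬-least Vanishing λ d (f , f-Pol , nonzero , vanishes) minimal → no-relation (relation f-Pol nonzero vanishes minimal)
        equations-Pol′ : All (λ b → IsPol b × (∀ {z} → z ∈ → b z ≈ 0#)) equations
        equations-Pol′ = All.tabulate λ b∈ → All.lookup equations-Pol b∈ , λ z∈ → All.lookup (∈⇒ z∈) b∈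
        equation-on-S : ∀ {b} → IsPol b × (∀ {z} → z ∈ → b z ≈ 0#) → ∀ x → Supported S x → b (V x) ≈ 0#
        equation-on-S {b} (b-Pol , b-vanishes) x x∈S with 0? (b (V x))
        ... | yes bx≈0 = bx≈0
        ... | no  bx≉0 = ⊥-elim (no-vanishing _ (_ , proj₂ (IsPol-∘ b-Pol V-Pol) , (x , x∈S , bx≉0) ,
          λ z z∈ → trans (Pol-cong (proj₂ b-Pol) (VW z)) (b-vanishes z∈)))

    ¬¬splitting : ¬ ¬ Splitting
    ¬¬splitting ¬split = reduce ¬split _ {λ _ → true} (ℕ.n<1+n _) record
      { V = λ z → z ; W = λ z → z
      ; V-AP = linear⇒AP id-linear ; W-AP = linear⇒AP id-linear
      ; V-Pol = IsPol-coordinate ; W-Pol = IsPol-coordinate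
      ; VW = λ _ → ≋-refl ; WV = λ _ → ≋-refl
      ; supported = λ _ _ ()
      }

-- Linear maps, matrices, and p-powers of a scalar plus a nilpotent.

module LinearMaps {c ℓ} (𝒫 : PerfectField c ℓ) (m : ℕ) where
  open PerfectField 𝒫
  open Field K hiding (zero)
  open FieldProperties K
  open Exponents.Characteristic characteristic
  open ℤSolver commutativeRing
  open VectorSetoid setoid using (_≋_; ≋-setoid)
  open SemiringSum semiring using (sum-cong-≋; ∑-distrib-+; *-distribˡ-sum; ∑-comm; sum-replicate-zero; *-distribʳ-sum)
  open SemiringMult semiring using () renaming (_×_ to _×′_)
  open AdditiveMaps 𝒫 m
  open Linear

  -- Makes the binomial theorem available for a scalar and a linear map, which commute.
  End : Semiring (c ⊔ ℓ) (c ⊔ ℓ)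
  End = record
    { Carrier = ∃ Linear
    ; _≈_ = λ (M , _) (N , _) → ∀ z → M z ≋ N z
    ; _+_ = λ (M , lM) (N , lN) → (λ z → M z ⊕ N z) , ⊕-linear lM lN
    ; _*_ = λ (M , lM) (N , lN) → (λ z → M (N z)) , ∘-linear lM lN
    ; 0# = zeroMap , zeroMap-linear
    ; 1# = (λ z → z) , id-linear
    ; isSemiring = record
      { isSemiringWithoutAnnihilatingZero = record
        { +-isCommutativeMonoid = record
          { isMonoid = record
            { isSemigroup = record
              { isMagma = record
                { isEquivalence = record
                  { refl = λ _ → ≋-refl ; sym = λ eq z → ≋-sym (eq z) ; trans = λ eq₁ eq₂ z → ≋-trans (eq₁ z) (eq₂ z) }
                ; ∙-cong = λ eq₁ eq₂ z → ⊕-cong (eq₁ z) (eq₂ z)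
                }
              ; assoc = λ _ _ _ z i → +-assoc _ _ _
              }
            ; identity = (λ _ z i → +-identityˡ _) , (λ _ z i → +-identityʳ _)
            }
          ; comm = λ _ _ z i → +-comm _ _
          }
        ; *-cong = λ {(M , lM)} {_} {_} {_} eq₁ eq₂ z → ≋-trans (cong lM (eq₂ z)) (eq₁ _)
        ; *-assoc = λ _ _ _ z → ≋-refl
        ; *-identity = (λ _ z → ≋-refl) , (λ _ z → ≋-refl)
        ; distrib = (λ (M , lM) (N , _) (P , _) z → additive lM (N z) (P z)) , (λ _ _ _ z → ≋-refl)
        }
      ; zero = (λ _ z → ≋-refl) , (λ (M , lM) z → zero-homo lM)
      }
    }

  private
    module End = Semiring End
    module End× = SemiringMult End
    module End^ = SemiringExp End

  scalarMap : Carrier → End.Carrier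
  scalarMap a = (a ⊙_) , ⊙-linear a id-linear

  ×-scalar : ∀ n → n End×.× End.1# End.≈ scalarMap (n ×′ 1#)
  ×-scalar zero    z i = sym (zeroˡ _)
  ×-scalar (suc n) z i = trans (+-congˡ (×-scalar n z i)) (trans (+-congʳ (sym (*-identityˡ _))) (sym (distribʳ _ _ _)))

  ^-scalar : ∀ a n → scalarMap a End^.^ n End.≈ scalarMap (a ^ n)
  ^-scalar a zero    z i = sym (*-identityˡ _)
  ^-scalar a (suc n) z i = trans (*-congˡ (^-scalar a n z i)) (sym (*-assoc _ _ _))

  End-middleVanishes : Binomial.MiddleVanishes End p
  End-middleVanishes k 0<k k<p = End.trans {(p C k) End×.× End.1#} {scalarMap ((p C k) ×′ 1#)} {End.0#} (×-scalar (p C k))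
    (λ z i → trans (*-congʳ (middleVanishes k 0<k k<p)) (zeroˡ _))

  scalar-plus-^p^e : ∀ e a (N : End.Carrier) → (scalarMap a End.+ N) End^.^ (p ℕ.^ e) End.≈ scalarMap (fold a φ e) End.+ N End^.^ (p ℕ.^ e)
  scalar-plus-^p^e zero    a N z i = refl
  scalar-plus-^p^e (suc e) a N = begin
    (scalarMap a End.+ N) End^.^ (p ℕ.* p ℕ.^ e)                          ≈⟨ End^.^-assocʳ (scalarMap a End.+ N) p (p ℕ.^ e) ⟨
    ((scalarMap a End.+ N) End^.^ p) End^.^ (p ℕ.^ e)                     ≈⟨ End^.^-congˡ (p ℕ.^ e) (Binomial.^-additive End {scalarMap a} {N} positive End-middleVanishes (λ z → ≋-sym {x = proj₁ N (a ⊙ z)} (homogeneous (proj₂ N) a z))) ⟩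
    (scalarMap a End^.^ p End.+ N End^.^ p) End^.^ (p ℕ.^ e)              ≈⟨ End^.^-congˡ (p ℕ.^ e) (End.+-congʳ {N End^.^ p} {scalarMap a End^.^ p} {scalarMap (φ a)} (^-scalar a p)) ⟩
    (scalarMap (φ a) End.+ N End^.^ p) End^.^ (p ℕ.^ e)                   ≈⟨ scalar-plus-^p^e e (φ a) (N End^.^ p) ⟩
    scalarMap (fold (φ a) φ e) End.+ (N End^.^ p) End^.^ (p ℕ.^ e)        ≈⟨ End.+-cong {scalarMap (fold (φ a) φ e)} {scalarMap (fold a φ (suc e))} {(N End^.^ p) End^.^ (p ℕ.^ e)} {N End^.^ (p ℕ.* p ℕ.^ e)} (λ z i → *-congʳ (reflexive (fold-comm φ e a))) (End^.^-assocʳ N p (p ℕ.^ e)) ⟩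
    scalarMap (fold a φ (suc e)) End.+ N End^.^ (p ℕ.* p ℕ.^ e)           ∎
    where
      open import Relation.Binary.Reasoning.Setoid End.setoid

  End-^≡fold : ∀ (N : End.Carrier) n z → proj₁ (N End^.^ n) z ≡ fold z (proj₁ N) n
  End-^≡fold N zero    z = ≡.refl
  End-^≡fold N (suc n) z = ≡.cong (proj₁ N) (End-^≡fold N n z)

  -- The exponent pⁿ does two things: as a power of p it removes the mixed terms, leaving a^(pⁿ) +
  -- N^(pⁿ), and as n < pⁿ it removes N^(pⁿ).
  fold-scalar-plus-nilpotent : ∀ {a} {N M : Map} n → Linear N → Linear M → (∀ z → M z ≋ a ⊙ z ⊕ N z) →
    (∀ z → fold z N n ≋ 𝟘) → ∀ z → fold z M (p ℕ.^ n) ≋ fold a φ n ⊙ z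
  fold-scalar-plus-nilpotent {a} {N} {M} n lN lM M≋ Nⁿ≋𝟘 z = begin
    fold z M (p ℕ.^ n)                                            ≈⟨ fold-respects (proj₂ a+N) M≋ (p ℕ.^ n) z ⟩
    fold z (proj₁ a+N) (p ℕ.^ n)                                  ≡⟨ End-^≡fold a+N (p ℕ.^ n) z ⟨
    proj₁ (a+N End^.^ (p ℕ.^ n)) z                                ≈⟨ scalar-plus-^p^e n a (N , lN) z ⟩
    fold a φ n ⊙ z ⊕ proj₁ ((N , lN) End^.^ (p ℕ.^ n)) z          ≡⟨ ≡.cong (fold a φ n ⊙ z ⊕_) (End-^≡fold (N , lN) (p ℕ.^ n) z) ⟩
    fold a φ n ⊙ z ⊕ fold z N (p ℕ.^ n)                           ≈⟨ ⊕-cong ≋-refl N^≋𝟘 ⟩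
    fold a φ n ⊙ z ⊕ 𝟘                                            ≈⟨ (λ i → +-identityʳ _) ⟩
    fold a φ n ⊙ z                                                ∎
    where
      open import Relation.Binary.Reasoning.Setoid (≋-setoid m)
      open Intertwining 𝒫 m using (fold-respects)
      a+N : End.Carrier
      a+N = scalarMap a End.+ (N , lN)
      N^≋𝟘 : fold z N (p ℕ.^ n) ≋ 𝟘
      N^≋𝟘 = begin
        fold z N (p ℕ.^ n)                        ≡⟨ ≡.cong (fold z N) (ℕ.m∸n+n≡m (ℕ.<⇒≤ (n<p^n n))) ⟨
        fold z N (p ℕ.^ n ℕ.∸ n ℕ.+ n)            ≡⟨ fold-+ z N (p ℕ.^ n ℕ.∸ n) ⟩
        fold (fold z N n) N (p ℕ.^ n ℕ.∸ n)       ≈⟨ cong (fold-linear lN (p ℕ.^ n ℕ.∸ n)) (Nⁿ≋𝟘 z) ⟩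
        fold 𝟘 N (p ℕ.^ n ℕ.∸ n)                  ≈⟨ zero-homo (fold-linear lN (p ℕ.^ n ℕ.∸ n)) ⟩
        𝟘                                         ∎

  private
    Matrix : Set c
    Matrix = Fin m → Fin m → Carrier

  mulVec-cong : ∀ {M N : Matrix} {x y} → (∀ i j → M i j ≈ N i j) → x ≋ y → mulVec K M x ≋ mulVec K N y
  mulVec-cong M≈N x≋y i = sum-cong-≋ λ j → *-cong (M≈N i j) (x≋y j)

  mulVec-linear : ∀ M → Linear (mulVec K M)
  mulVec-linear M = record
    { cong        = mulVec-cong (λ _ _ → refl)
    ; additive    = λ x y i → trans (sum-cong-≋ (λ j → distribˡ (M i j) (x j) (y j))) (∑-distrib-+ (λ j → M i j * x j) (λ j → M i j * y j))
    ; homogeneous = λ a x i → trans (sum-cong-≋ (λ j → solve 3 (λ a m x → m :* (a :* x) := a :* (m :* x)) refl a (M i j) (x j)))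
        (sym (*-distribˡ-sum a (λ j → M i j * x j)))
    }

  mulVec-0 : ∀ {M : Matrix} → (∀ i j → M i j ≈ 0#) → ∀ z → mulVec K M z ≋ 𝟘
  mulVec-0 M≈0 z i = trans (sum-cong-≋ (λ j → trans (*-congʳ (M≈0 i j)) (zeroˡ (z j)))) (sum-replicate-zero m)

  mulVec-⊕ : ∀ (M N : Matrix) z → mulVec K (λ i j → M i j + N i j) z ≋ mulVec K M z ⊕ mulVec K N z
  mulVec-⊕ M N z i = trans (sum-cong-≋ (λ j → distribʳ (z j) (M i j) (N i j))) (∑-distrib-+ (λ j → M i j * z j) (λ j → N i j * z j))

  mulVec-∘ : ∀ (M N : Matrix) z → mulVec K (λ i j → sum (λ l → M i l * N l j)) z ≋ mulVec K M (mulVec K N z)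
  mulVec-∘ M N z i = begin
    sum (λ j → sum (λ l → M i l * N l j) * z j)          ≈⟨ sum-cong-≋ (λ j → *-distribʳ-sum (z j) (λ l → M i l * N l j)) ⟩
    sum (λ j → sum (λ l → M i l * N l j * z j))          ≈⟨ ∑-comm (λ j l → M i l * N l j * z j) ⟩
    sum (λ l → sum (λ j → M i l * N l j * z j))          ≈⟨ sum-cong-≋ (λ l → trans (sum-cong-≋ {m} (λ j → *-assoc (M i l) (N l j) (z j))) (sym (*-distribˡ-sum (M i l) (λ j → N l j * z j)))) ⟩
    sum (λ l → M i l * sum (λ j → N l j * z j))          ∎
    where open import Relation.Binary.Reasoning.Setoid setoid

  δ-sum : ∀ {k} (x : Fin k → Carrier) i → sum (λ j → δ K i j * x j) ≈ x i
  δ-sum {suc k} x zero    = trans (+-cong (*-identityˡ _) (trans (sum-cong-≋ {k} (λ j → zeroˡ _)) (sum-replicate-zero k))) (+-identityʳ _)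
  δ-sum {suc k} x (suc i) = trans (+-cong (zeroˡ _) (δ-sum (λ j → x (suc j)) i)) (+-identityˡ _)

-- The ring 𝔽q[T] of coefficient lists.

module CoefficientPolynomials {c ℓ} (F : Field c ℓ) where
  open Field F hiding (zero)
  open FieldProperties F using (0?)
  open Skew rawRing (λ x → x) renaming (rawRing to A)
  private module A = RawRing A

  coeff-+ : ∀ f g i → coeff (f +ₚ g) i ≈ coeff f i + coeff g i
  coeff-+ []      g       i       = sym (+-identityˡ _)
  coeff-+ (a ∷ f) []      i       = sym (+-identityʳ _)
  coeff-+ (a ∷ f) (b ∷ g) zero    = refl
  coeff-+ (a ∷ f) (b ∷ g) (suc i) = coeff-+ f g i

  coeff-map : ∀ (h : Carrier → Carrier) → h 0# ≈ 0# → ∀ f i → coeff (mapᴸ h f) i ≈ h (coeff f i)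
  coeff-map h h0 []      i       = sym h0
  coeff-map h h0 (a ∷ f) zero    = refl
  coeff-map h h0 (a ∷ f) (suc i) = coeff-map h h0 f i

  X : Poly
  X = 0# ∷ 1# ∷ []

  X* : ∀ f → (X *ₚ f) A.≈ (0# ∷ f)
  X* f i = trans (coeff-+ (mapᴸ (0# *_) f) _ i) (trans (+-cong (trans (coeff-map (0# *_) (zeroˡ 0#) f i) (zeroˡ _)) (shifted i)) (+-identityˡ _))
    where
      shifted : ∀ i → coeff (mapᴸ (1# *_) (0# ∷ mapᴸ (λ x → x) f) +ₚ []) i ≈ coeff (0# ∷ f) i
      shifted i = trans (coeff-+ (mapᴸ (1# *_) (0# ∷ mapᴸ (λ x → x) f)) [] i) (trans (+-identityʳ _)
        (trans (coeff-map (1# *_) (zeroʳ 1#) (0# ∷ mapᴸ (λ x → x) f) i) (trans (*-identityˡ _) (unmapped i))))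
        where
          unmapped : ∀ i → coeff (0# ∷ mapᴸ (λ x → x) f) i ≈ coeff (0# ∷ f) i
          unmapped zero    = refl
          unmapped (suc i) = coeff-map (λ x → x) refl f i

  -- The recursion along which Φ(a), its differential and a(T) are all computed from T and the
  -- constants.
  horner : ∀ a f → (a ∷ f) A.≈ ((a ∷ []) A.+ (X A.* f))
  horner a f i = sym (trans (coeff-+ (a ∷ []) (X *ₚ f) i) (trans (+-congˡ (X* f i)) (split i)))
    where
      split : ∀ i → coeff (a ∷ []) i + coeff (0# ∷ f) i ≈ coeff (a ∷ f) i
      split zero    = +-identityʳ a
      split (suc i) = +-identityˡ _

  const-X : ∀ a → ((a ∷ []) A.* X) A.≈ (X A.* (a ∷ []))
  const-X a i = trans (swap i) (sym (X* (a ∷ []) i))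
    where
      swap : ∀ i → coeff (a * 0# ∷ a * 1# ∷ []) i ≈ coeff (0# ∷ a ∷ []) i
      swap zero          = zeroʳ a
      swap (suc zero)    = *-identityʳ a
      swap (suc (suc i)) = refl

  normalise : ∀ f → f A.≈ [] ⊎ ∃₂ λ as b → ¬ b ≈ 0# × f A.≈ (as ∷ʳ b)
  normalise [] = inj₁ λ _ → refl
  normalise (a ∷ f) with normalise f | 0? a
  ... | inj₂ (as , b , b≉0 , f≈) | _ = inj₂ (a ∷ as , b , b≉0 , λ { zero → refl ; (suc i) → f≈ i })
  ... | inj₁ f≈[] | yes a≈0 = inj₁ λ { zero → a≈0 ; (suc i) → f≈[] i }
  ... | inj₁ f≈[] | no  a≉0 = inj₂ ([] , a , a≉0 , λ { zero → refl ; (suc i) → f≈[] i })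

-- The action of A on 𝒞^m and its differential.

module Action {c ℓ} {𝒦 : FunctionFieldTower c ℓ} (𝓓 : FieldOfDefinition 𝒦) {m : ℕ} (𝒜 : TModule 𝓓 m) where
  open FunctionFieldTower 𝒦 hiding (module 𝒞)
  open FieldOfDefinition 𝓓
  open TModule 𝒜
  open TowerProperties 𝒦 using (𝒞-perfect; q-power)
  open PerfectField 𝒞-perfect using (characteristic)
  open Exponents.Characteristic characteristic
  open Field 𝒞 hiding (zero)
  open ℤSolver commutativeRing
  open CommutativeSemiringExp commutativeSemiring using (^-congˡ; ^-distrib-*; ^-congʳ)
  open AdditiveMaps 𝒞-perfect m
  open LinearMaps 𝒞-perfect m
  open Intertwining 𝒞-perfect m using (shifted; fold-respects)
  open Polynomials 𝒞-perfect m using (fold-φ-+; fold-φ-0)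
  open Linear
  open VectorSetoid setoid using (_≋_; ≋-setoid)
  open SemiringSum semiring using (sum-cong-≋)
  open import Relation.Binary.Reasoning.Setoid (≋-setoid m)
  module ι = Homomorphism ℱ→𝒞
  module k→ℱ = Homomorphism k→ℱ
  module A→k = RingMorphisms.IsRingMonomorphism A→k-mono
  module Φ = RingMorphisms.IsRingHomomorphism isRingHomomorphism
  private
    module ℱ = Field ℱ
    module Mat = RawRing (Matℱ 𝓓 m)
    module Mτ = Matℱ[τ] 𝓓 m
    module MτR = RawRing Mτ.rawRing

  ⟦_⟧ᴹ : Mat.Carrier → Fin m → Fin m → Carrier
  ⟦ M ⟧ᴹ = Mat→𝒞 𝓓 𝒜 M

  _·ᵥ_ : Mat.Carrier → Map
  M ·ᵥ z = mulVec 𝒞 ⟦ M ⟧ᴹ z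

  ·ᵥ-linear : ∀ M → Linear (M ·ᵥ_)
  ·ᵥ-linear M = mulVec-linear ⟦ M ⟧ᴹ

  ·ᵥ-cong : ∀ {M N} → M Mat.≈ N → ∀ z → M ·ᵥ z ≋ N ·ᵥ z
  ·ᵥ-cong M≈N z = mulVec-cong (λ i j → ι.⟦⟧-cong (M≈N i j)) ≋-refl

  ·ᵥ-0 : ∀ {M} → M Mat.≈ Mat.0# → ∀ z → M ·ᵥ z ≋ 𝟘
  ·ᵥ-0 M≈0 = mulVec-0 λ i j → trans (ι.⟦⟧-cong (M≈0 i j)) ι.0#-homo

  ·ᵥ-+ : ∀ M N z → (M Mat.+ N) ·ᵥ z ≋ M ·ᵥ z ⊕ N ·ᵥ z
  ·ᵥ-+ M N z = ≋-trans (mulVec-cong (λ i j → ι.+-homo (M i j) (N i j)) ≋-refl) (mulVec-⊕ ⟦ M ⟧ᴹ ⟦ N ⟧ᴹ z)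

  ·ᵥ-* : ∀ M N z → (M Mat.* N) ·ᵥ z ≋ M ·ᵥ (N ·ᵥ z)
  ·ᵥ-* M N z = ≋-trans (mulVec-cong (λ i j → trans (ι.sum-homo (λ l → M i l ℱ.* N l j)) (sum-cong-≋ {m} (λ l → ι.*-homo (M i l) (N l j)))) ≋-refl)
    (mulVec-∘ ⟦ M ⟧ᴹ ⟦ N ⟧ᴹ z)

  ι-δ : ∀ (i j : Fin m) → ι.⟦ δ ℱ i j ⟧ ≈ δ 𝒞 i j
  ι-δ i j with does (i Fin.≟ j)
  ... | true  = ι.1#-homo
  ... | false = ι.0#-homo

  ·ᵥ-scalar : ∀ a z → scalar ℱ a ·ᵥ z ≋ ι.⟦ a ⟧ ⊙ z
  ·ᵥ-scalar a z i = trans (sum-cong-≋ (λ j → trans (*-congʳ (trans (ι.*-homo a _) (*-congˡ (ι-δ i j)))) (*-assoc ι.⟦ a ⟧ (δ 𝒞 i j) (z j))))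
    (trans (sym (SemiringSum.*-distribˡ-sum semiring ι.⟦ a ⟧ (λ j → δ 𝒞 i j * z j))) (*-congˡ (δ-sum z i)))

  ·ᵥ-1 : ∀ z → Mat.1# ·ᵥ z ≋ z
  ·ᵥ-1 z i = trans (sum-cong-≋ (λ j → *-congʳ (ι-δ i j))) (δ-sum z i)

  τ : Map
  τ z j = z j ^ q

  τ≈ : ∀ x → x ^ q ≈ fold x φ (suc (proj₁ q-power))
  τ≈ x = trans (^-congʳ x (proj₂ q-power)) (sym (fold-φ x (suc (proj₁ q-power))))

  τ-cong : ∀ {x y} → x ≋ y → τ x ≋ τ y
  τ-cong eq i = ^-congˡ q (eq i)

  q-additive : ∀ x y → (x + y) ^ q ≈ x ^ q + y ^ q
  q-additive x y = trans (τ≈ _) (trans (fold-φ-+ x y (suc (proj₁ q-power))) (+-cong (sym (τ≈ x)) (sym (τ≈ y))))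

  0^q : 0# ^ q ≈ 0#
  0^q = trans (τ≈ 0#) (fold-φ-0 (suc (proj₁ q-power)))

  τ-⊕ : ∀ x y → τ (x ⊕ y) ≋ τ x ⊕ τ y
  τ-⊕ x y i = q-additive (x i) (y i)

  sum^q : ∀ {k} (x : Fin k → Carrier) → sum x ^ q ≈ sum (λ i → x i ^ q)
  sum^q {zero}  x = 0^q
  sum^q {suc k} x = trans (q-additive _ _) (+-congˡ (sum^q (λ i → x (suc i))))

  σ : Mat.Carrier → Mat.Carrier
  σ M i j = M i j ℱ.^ q

  τ-·ᵥ : ∀ M z → σ M ·ᵥ τ z ≋ τ (M ·ᵥ z)
  τ-·ᵥ M z i = trans (sum-cong-≋ (λ j → trans (*-congʳ (ι.^-homo (M i j) q)) (sym (^-distrib-* ι.⟦ M i j ⟧ (z j) q))))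
    (sym (sum^q (λ j → ι.⟦ M i j ⟧ * z j)))

  ⟪_⟫ : Mτ.Poly → Map
  ⟪ P ⟫ = act 𝓓 𝒜 P

  ⟪⟫-cong : ∀ P {x y} → x ≋ y → ⟪ P ⟫ x ≋ ⟪ P ⟫ y
  ⟪⟫-cong []      x≋y = ≋-refl
  ⟪⟫-cong (M ∷ P) x≋y = ⊕-cong (cong (·ᵥ-linear M) x≋y) (⟪⟫-cong P (τ-cong x≋y))

  ⟪⟫-zero : ∀ P → (∀ i → Mτ.coeff P i Mat.≈ Mat.0#) → ∀ z → ⟪ P ⟫ z ≋ 𝟘
  ⟪⟫-zero []      P≈0 z = ≋-refl
  ⟪⟫-zero (M ∷ P) P≈0 z = ≋-trans (⊕-cong (·ᵥ-0 (P≈0 0) z) (⟪⟫-zero P (λ i → P≈0 (suc i)) (τ z))) (λ i → +-identityʳ 0#)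

  ⟪⟫-resp : ∀ P Q → P MτR.≈ Q → ∀ z → ⟪ P ⟫ z ≋ ⟪ Q ⟫ z
  ⟪⟫-resp []      Q       P≈Q z = ≋-sym (⟪⟫-zero Q (λ n i j → ℱ.sym (P≈Q n i j)) z)
  ⟪⟫-resp (M ∷ P) []      P≈Q z = ⟪⟫-zero (M ∷ P) P≈Q z
  ⟪⟫-resp (M ∷ P) (N ∷ Q) P≈Q z = ⊕-cong (·ᵥ-cong (P≈Q 0) z) (⟪⟫-resp P Q (λ n → P≈Q (suc n)) (τ z))

  ⟪⟫-+ : ∀ P Q z → ⟪ P MτR.+ Q ⟫ z ≋ ⟪ P ⟫ z ⊕ ⟪ Q ⟫ z
  ⟪⟫-+ []      Q       z i = sym (+-identityˡ _)
  ⟪⟫-+ (M ∷ P) []      z i = sym (+-identityʳ _)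
  ⟪⟫-+ (M ∷ P) (N ∷ Q) z   = ≋-trans (⊕-cong (·ᵥ-+ M N z) (⟪⟫-+ P Q (τ z)))
    (⊕-interchange (M ·ᵥ z) (N ·ᵥ z) (⟪ P ⟫ (τ z)) (⟪ Q ⟫ (τ z)))

  ⟪⟫-map-* : ∀ M Q z → ⟪ mapᴸ (M Mat.*_) Q ⟫ z ≋ M ·ᵥ ⟪ Q ⟫ z
  ⟪⟫-map-* M []      z = ≋-sym (zero-homo (·ᵥ-linear M))
  ⟪⟫-map-* M (N ∷ Q) z = ≋-trans (⊕-cong (·ᵥ-* M N z) (⟪⟫-map-* M Q (τ z))) (≋-sym (additive (·ᵥ-linear M) _ _))

  ⟪⟫-map-σ : ∀ Q z → ⟪ mapᴸ σ Q ⟫ (τ z) ≋ τ (⟪ Q ⟫ z)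
  ⟪⟫-map-σ []      z i = sym 0^q
  ⟪⟫-map-σ (N ∷ Q) z   = ≋-trans (⊕-cong (τ-·ᵥ N z) (⟪⟫-map-σ Q (τ z))) (≋-sym (τ-⊕ _ _))

  ⟪⟫-* : ∀ P Q z → ⟪ P MτR.* Q ⟫ z ≋ ⟪ P ⟫ (⟪ Q ⟫ z)
  ⟪⟫-* []      Q z = ≋-refl
  ⟪⟫-* (M ∷ P) Q z = begin
    ⟪ mapᴸ (M Mat.*_) Q MτR.+ (P MτR.* (Mat.0# ∷ mapᴸ σ Q)) ⟫ z        ≈⟨ ⟪⟫-+ (mapᴸ (M Mat.*_) Q) (P MτR.* (Mat.0# ∷ mapᴸ σ Q)) z ⟩
    ⟪ mapᴸ (M Mat.*_) Q ⟫ z ⊕ ⟪ P MτR.* (Mat.0# ∷ mapᴸ σ Q) ⟫ z        ≈⟨ ⊕-cong (⟪⟫-map-* M Q z) (⟪⟫-* P (Mat.0# ∷ mapᴸ σ Q) z) ⟩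
    M ·ᵥ ⟪ Q ⟫ z ⊕ ⟪ P ⟫ (Mat.0# ·ᵥ z ⊕ ⟪ mapᴸ σ Q ⟫ (τ z))            ≈⟨ ⊕-cong ≋-refl (⟪⟫-cong P (≋-trans (⊕-cong (·ᵥ-0 (λ _ _ → ℱ.refl) z) (⟪⟫-map-σ Q z)) (λ i → +-identityˡ _))) ⟩
    M ·ᵥ ⟪ Q ⟫ z ⊕ ⟪ P ⟫ (τ (⟪ Q ⟫ z))                                 ∎

  private
    e = proj₁ q-power

  -- τ is the power `F`^(e+1), because q = p^(e+1).
  IsAP-τ : ∀ {G} → IsAP G → IsAP (λ z → G (τ z))
  IsAP-τ (n , g) = IsAP-resp (λ z → AP-cong g (λ i → trans (τ≈ (z i)) (reflexive (≡.sym (fold-F (suc e) z i)))))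
    (IsAP-Fᵏ (suc e) (n , g))

  ⟪⟫-AP : ∀ P → IsAP ⟪ P ⟫
  ⟪⟫-AP []      = 0 , nil λ _ → ≋-refl
  ⟪⟫-AP (M ∷ P) = IsAP-⊕ (linear⇒AP (·ᵥ-linear M)) (IsAP-τ (⟪⟫-AP P))

  -- τ contains at least one factor `F`, so every coefficient after the first falls into the tail.
  ⟪⟫∼ : ∀ P → ⟪ P ⟫ ∼ (Mτ.coeff P 0 ·ᵥ_)
  ⟪⟫∼ []      = linearPart (·ᵥ-linear Mat.0#) (0 , nil λ _ → ≋-refl) λ z i → sym (trans (+-identityʳ _) (·ᵥ-0 (λ _ _ → ℱ.refl) z i))
  ⟪⟫∼ (M ∷ P) = linearPart (·ᵥ-linear M) (IsAP-Fᵏ e (⟪⟫-AP P)) λ z → ⊕-cong ≋-refl (⟪⟫-cong P λ i →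
    trans (τ≈ (z i)) (reflexive (≡.trans (≡.sym (fold-comm φ e (z i))) (≡.sym (fold-F e (F z) i)))))

  α : A.Carrier → Map
  α a = ⟪ Φ a ⟫

  α-AP : ∀ a → IsAP (α a)
  α-AP a = ⟪⟫-AP (Φ a)

  α-cong : ∀ a {x y} → x ≋ y → α a x ≋ α a y
  α-cong a = ⟪⟫-cong (Φ a)

  α-resp : ∀ {a b} → a A.≈ b → ∀ z → α a z ≋ α b z
  α-resp {a} {b} a≈b = ⟪⟫-resp (Φ a) (Φ b) (Φ.⟦⟧-cong a≈b)

  α-+ : ∀ a b z → α (a A.+ b) z ≋ α a z ⊕ α b z
  α-+ a b z = ≋-trans (⟪⟫-resp (Φ (a A.+ b)) (Φ a MτR.+ Φ b) (Φ.+-homo a b) z) (⟪⟫-+ (Φ a) (Φ b) z)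

  α-* : ∀ a b z → α (a A.* b) z ≋ α a (α b z)
  α-* a b z = ≋-trans (⟪⟫-resp (Φ (a A.* b)) (Φ a MτR.* Φ b) (Φ.*-homo a b) z) (⟪⟫-* (Φ a) (Φ b) z)

  α-0 : ∀ z → α A.0# z ≋ 𝟘
  α-0 = ⟪⟫-resp (Φ A.0#) [] Φ.0#-homo

  α-1 : ∀ z → α A.1# z ≋ z
  α-1 z = ≋-trans (⟪⟫-resp (Φ A.1#) MτR.1# Φ.1#-homo z) (≋-trans (⊕-cong (·ᵥ-1 z) ≋-refl) (λ i → +-identityʳ _))

  -- a(T) ∈ 𝒞.
  ev : A.Carrier → Carrier
  ev a = ι.⟦ A→ℱ a ⟧

  α-const : ∀ x z → α (const x) z ≋ ev (const x) ⊙ z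
  α-const x z = ≋-trans (⟪⟫-resp (Φ (const x)) (scalar ℱ (A→ℱ (const x)) ∷ []) (𝔽q-linear x) z) (≋-trans (⊕-cong (·ᵥ-scalar _ z) ≋-refl) (λ i → +-identityʳ _))

  α-^ : ∀ j z → α (RawSemiringOps._^_ A.rawSemiring T j) z ≋ fold z (α T) j
  α-^ zero    z = α-1 z
  α-^ (suc j) z = ≋-trans (α-* T (T^ j) z) (α-cong T (α-^ j z))
    where T^ = RawSemiringOps._^_ A.rawSemiring T

  open CoefficientPolynomials 𝔽q using (horner; const-X)

  α-horner : ∀ x f z → α (x ∷ f) z ≋ ev (const x) ⊙ z ⊕ α T (α f z)
  α-horner x f z = begin
    α (x ∷ f) z                              ≈⟨ α-resp (horner x f) z ⟩
    α (const x A.+ (T A.* f)) z              ≈⟨ α-+ (const x) (T A.* f) z ⟩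
    α (const x) z ⊕ α (T A.* f) z            ≈⟨ ⊕-cong (α-const x z) (α-* T f z) ⟩
    ev (const x) ⊙ z ⊕ α T (α f z)           ∎

  -- Constants commute with T in A, and Φ transports this. As constants act by scalars, Horner's
  -- scheme then makes all of Φ(A) commute with Φ(T).
  const-T-commute : ∀ x z → ev (const x) ⊙ α T z ≋ α T (ev (const x) ⊙ z)
  const-T-commute x z = begin
    ev (const x) ⊙ α T z       ≈⟨ α-const x (α T z) ⟨
    α (const x) (α T z)        ≈⟨ α-* (const x) T z ⟨
    α (const x A.* T) z        ≈⟨ α-resp (const-X x) z ⟩
    α (T A.* const x) z        ≈⟨ α-* T (const x) z ⟩
    α T (α (const x) z)        ≈⟨ α-cong T (α-const x z) ⟩
    α T (ev (const x) ⊙ z)     ∎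

  α-T-commute : ∀ a z → α a (α T z) ≋ α T (α a z)
  α-T-commute []      z = ≋-trans (α-0 _) (≋-sym (≋-trans (α-cong T (α-0 z)) (AP-𝟘 (proj₂ (α-AP T)))))
  α-T-commute (x ∷ f) z = begin
    α (x ∷ f) (α T z)                                ≈⟨ α-horner x f (α T z) ⟩
    ev (const x) ⊙ α T z ⊕ α T (α f (α T z))         ≈⟨ ⊕-cong (const-T-commute x z) (α-cong T (α-T-commute f z)) ⟩
    α T (ev (const x) ⊙ z) ⊕ α T (α T (α f z))       ≈⟨ AP-additive (proj₂ (α-AP T)) _ _ ⟨
    α T (ev (const x) ⊙ z ⊕ α T (α f z))             ≈⟨ α-cong T (α-horner x f z) ⟨
    α T (α (x ∷ f) z)                                ∎

  α-T^-commute : ∀ j a z → α a (fold z (α T) j) ≋ fold (α a z) (α T) j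
  α-T^-commute zero    a z = ≋-refl
  α-T^-commute (suc j) a z = ≋-trans (α-T-commute a _) (α-cong T (α-T^-commute j a z))

  Nᵛ : Map
  Nᵛ = N ·ᵥ_

  N-linear : Linear Nᵛ
  N-linear = ·ᵥ-linear N

  N-nilpotent′ : ∃ λ n → ∀ z → fold z Nᵛ n ≋ 𝟘
  N-nilpotent′ = proj₁ N-nilpotent , λ z → ≋-trans (≋-sym (power (proj₁ N-nilpotent) z)) (·ᵥ-0 (proj₂ N-nilpotent) z)
    where
      open RawSemiringOps Mat.rawSemiring using () renaming (_^_ to _^ᴹ_)
      power : ∀ n z → (N ^ᴹ n) ·ᵥ z ≋ fold z Nᵛ n
      power zero    z = ·ᵥ-1 z
      power (suc n) z = ≋-trans (·ᵥ-* N (N ^ᴹ n) z) (cong N-linear (power n z))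

  T₀ : Map
  T₀ z = ev T ⊙ z ⊕ Nᵛ z

  T₀-linear : Linear T₀
  T₀-linear = ⊕-linear (⊙-linear (ev T) id-linear) N-linear

  αT∼ : α T ∼ T₀
  αT∼ = ∼-respʳ (λ z → ≋-trans (·ᵥ-cong a₀-form z) (≋-trans (·ᵥ-+ _ N z) (⊕-cong (·ᵥ-scalar _ z) ≋-refl))) T₀-linear (⟪⟫∼ (Φ T))

  αT^∼ : ∀ j → (λ z → fold z (α T) j) ∼ (λ z → fold z T₀ j)
  αT^∼ zero    = linear∼ id-linear
  αT^∼ (suc j) = ∼-∘ αT∼ (αT^∼ j)

  ev-horner : ∀ x f → ev (x ∷ f) ≈ ev (const x) + ev T * ev f
  ev-horner x f = trans (ι.⟦⟧-cong (k→ℱ.⟦⟧-cong (A→k.⟦⟧-cong (horner x f)))) (trans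
    (ι.⟦⟧-cong (ℱ.trans (k→ℱ.⟦⟧-cong (A→k.+-homo (const x) (T A.* f))) (ℱ.trans (k→ℱ.+-homo _ _)
      (ℱ.+-congˡ (ℱ.trans (k→ℱ.⟦⟧-cong (A→k.*-homo T f)) (k→ℱ.*-homo _ _))))))
    (trans (ι.+-homo _ _) (+-congˡ (ι.*-homo _ _))))

  ev-[] : ev [] ≈ 0#
  ev-[] = trans (ι.⟦⟧-cong (ℱ.trans (k→ℱ.⟦⟧-cong A→k.0#-homo) k→ℱ.0#-homo)) ι.0#-homo

  -- W is the divided difference (a(T + N) - a(T)) / N, evaluated as a polynomial in N; it exhibits
  -- the nilpotent part of dΦ(a) as a multiple of N by a map commuting with N.
  record Differential (a : A.Carrier) : Set (c ⊔ ℓ) where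
    field
      W          : Map
      W-linear   : Linear W
      WN         : ∀ z → W (Nᵛ z) ≋ Nᵛ (W z)
      α∼         : α a ∼ (λ z → ev a ⊙ z ⊕ Nᵛ (W z))

  differential : ∀ a → Differential a
  differential [] = record
    { W = zeroMap
    ; W-linear = zeroMap-linear
    ; WN = λ z → ≋-sym (zero-homo N-linear)
    ; α∼ = ∼-resp α-0 (∼-respʳ (λ z i → sym (trans (+-cong (trans (*-congʳ ev-[]) (zeroˡ _)) (zero-homo N-linear i)) (+-identityʳ 0#)))
        (⊕-linear (⊙-linear (ev []) id-linear) (∘-linear N-linear zeroMap-linear)) (linear∼ zeroMap-linear))
    }
  differential (x ∷ f) = record
    { W = W′
    ; W-linear = W′-linear
    ; WN = λ z → ≋-sym (begin
        Nᵛ (W′ z)                                                      ≈⟨ additive N-linear _ _ ⟩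
        Nᵛ (ev T ⊙ W z ⊕ ev f ⊙ z) ⊕ Nᵛ (Nᵛ (W z))                    ≈⟨ ⊕-cong (≋-trans (additive N-linear _ _) (⊕-cong (homogeneous N-linear _ _) (homogeneous N-linear _ _))) ≋-refl ⟩
        (ev T ⊙ Nᵛ (W z) ⊕ ev f ⊙ Nᵛ z) ⊕ Nᵛ (Nᵛ (W z))               ≈⟨ ⊕-cong (⊕-cong (⊙-cong refl (WN z)) ≋-refl) (cong N-linear (WN z)) ⟨
        W′ (Nᵛ z)                                                      ∎)
    ; α∼ = ∼-resp (α-horner x f) (∼-respʳ linear-equation (⊕-linear (⊙-linear (ev (x ∷ f)) id-linear) (∘-linear N-linear W′-linear))
        (∼-⊕ (linear∼ (⊙-linear (ev (const x)) id-linear)) (∼-∘ αT∼ α∼)))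
    }
    where
      open Differential (differential f)
      W′ : Map
      -- Read off from (T + N)(f(T) + N W) = T f(T) + N (T W + f(T) + N W).
      W′ z = (ev T ⊙ W z ⊕ ev f ⊙ z) ⊕ Nᵛ (W z)
      W′-linear : Linear W′
      W′-linear = ⊕-linear (⊕-linear (⊙-linear (ev T) W-linear) (⊙-linear (ev f) id-linear)) (∘-linear N-linear W-linear)
      linear-equation : ∀ z → ev (const x) ⊙ z ⊕ T₀ (ev f ⊙ z ⊕ Nᵛ (W z)) ≋ ev (x ∷ f) ⊙ z ⊕ Nᵛ (W′ z)
      linear-equation z = begin
        ev (const x) ⊙ z ⊕ (ev T ⊙ (ev f ⊙ z ⊕ NW) ⊕ Nᵛ (ev f ⊙ z ⊕ NW))
          ≈⟨ ⊕-cong ≋-refl (⊕-cong ≋-refl (≋-trans (additive N-linear _ _) (⊕-cong (homogeneous N-linear _ _) ≋-refl))) ⟩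
        ev (const x) ⊙ z ⊕ (ev T ⊙ (ev f ⊙ z ⊕ NW) ⊕ (ev f ⊙ Nᵛ z ⊕ Nᵛ NW))
          ≈⟨ (λ i → solve 7 (λ x t f z nw nz nnw → x :* z :+ (t :* (f :* z :+ nw) :+ (f :* nz :+ nnw)) := (x :+ t :* f) :* z :+ ((t :* nw :+ f :* nz) :+ nnw)) refl
               (ev (const x)) (ev T) (ev f) (z i) (NW i) (Nᵛ z i) (Nᵛ NW i)) ⟩
        (ev (const x) + ev T * ev f) ⊙ z ⊕ ((ev T ⊙ NW ⊕ ev f ⊙ Nᵛ z) ⊕ Nᵛ NW)
          ≈⟨ ⊕-cong (⊙-cong (ev-horner x f) ≋-refl) (≋-trans (additive N-linear _ _) (⊕-cong (≋-trans (additive N-linear _ _) (⊕-cong (homogeneous N-linear _ _) (homogeneous N-linear _ _))) ≋-refl)) ⟨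
        ev (x ∷ f) ⊙ z ⊕ Nᵛ (W′ z)                                     ∎
        where NW = Nᵛ (W z)

  -- (N W)ⁿ = Nⁿ Wⁿ, as W commutes with N; the nilpotency exponent of N thus serves for every a.
  differential-nilpotent : ∀ {a} (d : Differential a) z →
    fold z (shifted (λ z → ev a ⊙ z ⊕ Nᵛ (Differential.W d z)) (ev a)) (proj₁ N-nilpotent′) ≋ 𝟘
  differential-nilpotent {a} d z = begin
    fold z (shifted (λ z → ev a ⊙ z ⊕ Nᵛ (W z)) (ev a)) n   ≈⟨ fold-respects (∘-linear N-linear W-linear) (λ v i → solve 2 (λ x y → (x :+ y) :- x := y) refl ((ev a ⊙ v) i) (Nᵛ (W v) i)) n z ⟩
    fold z (λ v → Nᵛ (W v)) n                               ≈⟨ fold-product n ⟩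
    fold (fold z W n) Nᵛ n                                  ≈⟨ proj₂ N-nilpotent′ _ ⟩
    𝟘                                                       ∎
    where
      open Differential d
      n = proj₁ N-nilpotent′
      W-fold : ∀ k u → W (fold u Nᵛ k) ≋ fold (W u) Nᵛ k
      W-fold zero    u = ≋-refl
      W-fold (suc k) u = ≋-trans (WN _) (cong N-linear (W-fold k u))
      fold-product : ∀ k → fold z (λ v → Nᵛ (W v)) k ≋ fold (fold z W k) Nᵛ k
      fold-product zero    = ≋-refl
      fold-product (suc k) = cong N-linear (≋-trans (cong W-linear (fold-product k)) (W-fold k _))

-- Zero sets of formal polynomials and polynomial functions.

module Subgroups {c ℓ} {𝒦 : FunctionFieldTower c ℓ} (𝓓 : FieldOfDefinition 𝒦) {m : ℕ} (𝒜 : TModule 𝓓 m) where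
  open FunctionFieldTower 𝒦 hiding (module 𝒞)
  open TowerProperties 𝒦 using (𝒞-perfect)
  open Field 𝒞 hiding (zero)
  open FieldProperties 𝒞 using (0?)
  open ℤSolver commutativeRing
  open Polynomials 𝒞-perfect m
  open NormalForm 𝒞-perfect m using (ConnectedSubgroup)

  private
    Pt = Defs.Point 𝓓 𝒜
    Mv = MvPoly 𝓓 𝒜
    ⟦_⟧ : Mv → Pt → Carrier
    ⟦_⟧ = evalMv 𝓓 𝒜

  product-Pol : ∀ {k} (f : Fin k → Pt → Carrier) → (∀ i → IsPol (f i)) → IsPol (λ z → product (λ i → f i z))
  product-Pol {zero}  f f-Pol = IsPol-const 1#
  product-Pol {suc k} f f-Pol = IsPol-* (f-Pol zero) (product-Pol (λ i → f (suc i)) (λ i → f-Pol (suc i)))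

  Mv-Pol : ∀ g → IsPol ⟦ g ⟧
  Mv-Pol []            = IsPol-const 0#
  Mv-Pol ((a , α) ∷ g) = IsPol-+ (IsPol-scale a (product-Pol (λ i z → z i ^ Vec.lookup α i) (λ i → IsPol-^ (IsPol-coordinate i) (Vec.lookup α i)))) (Mv-Pol g)

  product-one : ∀ {k} (x : Fin k → Carrier) → product (λ i → x i ^ Vec.lookup (Vec.replicate k 0) i) ≈ 1#
  product-one {zero}  x = refl
  product-one {suc k} x = trans (*-identityˡ _) (product-one (λ i → x (suc i)))

  product-suc : ∀ {k} (x : Fin k → Carrier) (α : Vec ℕ k) i →
    product (λ j → x j ^ Vec.lookup (α [ i ]%= suc) j) ≈ x i * product (λ j → x j ^ Vec.lookup α j)
  product-suc x (n ∷ⱽ α) zero    = *-assoc _ _ _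
  product-suc x (n ∷ⱽ α) (suc i) = trans (*-congˡ (product-suc (λ j → x (suc j)) α i))
    (solve 3 (λ a b c → a :* (b :* c) := b :* (a :* c)) refl (x zero ^ n) (x (suc i)) (product (λ j → x (suc j) ^ Vec.lookup α j)))

  ⟦⟧-++ : ∀ g h z → ⟦ g ++ h ⟧ z ≈ ⟦ g ⟧ z + ⟦ h ⟧ z
  ⟦⟧-++ []      h z = sym (+-identityˡ _)
  ⟦⟧-++ (t ∷ g) h z = trans (+-congˡ (⟦⟧-++ g h z)) (sym (+-assoc _ _ _))

  times : Fin m → Mv → Mv
  times i = mapᴸ λ (a , α) → a , α [ i ]%= suc

  ⟦⟧-times : ∀ i g z → ⟦ times i g ⟧ z ≈ z i * ⟦ g ⟧ z
  ⟦⟧-times i []            z = sym (zeroʳ _)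
  ⟦⟧-times i ((a , α) ∷ g) z = trans (+-cong (*-congˡ (product-suc z α i)) (⟦⟧-times i g z))
    (solve 4 (λ a x u v → a :* (x :* u) :+ x :* v := x :* (a :* u :+ v)) refl a (z i) (Defs.monomial 𝓓 𝒜 z α) (⟦ g ⟧ z))

  -- `Connected` quantifies over formal polynomials, so the factors found as polynomial functions
  -- have to be written out as such.
  Pol⇒Mv : ∀ {d f} → Pol d f → ∃ λ g → ∀ z → ⟦ g ⟧ z ≈ f z
  Pol⇒Mv (zer f≈)     = [] , λ z → sym (f≈ z)
  Pol⇒Mv (con a f≈)   = (a , Vec.replicate m 0) ∷ [] , λ z → trans (+-identityʳ _) (trans (*-congˡ (product-one z)) (trans (*-identityʳ a) (sym (f≈ z))))
  Pol⇒Mv (var i f f≈) = let g , g≈ = Pol⇒Mv f in times i g , λ z → trans (⟦⟧-times i g z) (trans (*-congˡ (g≈ z)) (sym (f≈ z)))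
  Pol⇒Mv (add f h f≈) = let g , g≈ = Pol⇒Mv f ; g′ , g′≈ = Pol⇒Mv h
    in g ++ g′ , λ z → trans (⟦⟧-++ g g′ z) (trans (+-cong (g≈ z) (g′≈ z)) (sym (f≈ z)))

  connectedSubgroup : ConnectedAlgebraicSubgroup 𝓓 𝒜 → ConnectedSubgroup _
  connectedSubgroup ℬ = record
    { _∈            = ℬ._∋_
    ; equations     = mapᴸ ⟦_⟧ ℬ.equations
    ; equations-Pol = All.map⁺ (All.universal Mv-Pol ℬ.equations)
    ; ∈⇒            = All.map⁺
    ; ⇒∈            = All.map⁻
    ; 0∈            = ℬ.0∈
    ; +∈            = ℬ.+∈
    ; connected     = λ (_ , g-Pol) (_ , h-Pol) cover disjoint →
        let g , g≈ = Pol⇒Mv g-Pol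
            h , h≈ = Pol⇒Mv h-Pol
        in Sum.map
          (λ on-g z z∈ → trans (sym (g≈ z)) (All.head (on-g z z∈)))
          (λ on-h z z∈ → trans (sym (h≈ z)) (All.head (on-h z z∈)))
          (ℬ.connected (g ∷ []) (h ∷ [])
            (λ z z∈ → Sum.map (λ eq → trans (g≈ z) eq ∷ []) (λ eq → trans (h≈ z) eq ∷ []) (cover z z∈))
            (λ { z z∈ (eq ∷ [] , eq′ ∷ []) → disjoint z z∈ (trans (sym (g≈ z)) eq , trans (sym (h≈ z)) eq′) }))
    }
    where module ℬ = ConnectedAlgebraicSubgroup ℬ

  ∈? : ∀ (ℬ : ConnectedAlgebraicSubgroup 𝓓 𝒜) z → Dec (ConnectedAlgebraicSubgroup._∋_ ℬ z)
  ∈? ℬ z = All.all? (λ g → 0? (⟦ g ⟧ z)) (ConnectedAlgebraicSubgroup.equations ℬ)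

-- Stability under Φ(Tʲ).

module _ {c ℓ} {𝒦 : FunctionFieldTower c ℓ} (𝓓 : FieldOfDefinition 𝒦) {m : ℕ} (𝒜 : TModule 𝓓 m) where
  open FunctionFieldTower 𝒦 hiding (module 𝒞)
  open FieldOfDefinition 𝓓
  open TowerProperties 𝒦 using (𝒞-perfect; nonconstant-powers)
  open PerfectField 𝒞-perfect using (p; characteristic)
  open Exponents.Characteristic characteristic
  open Field 𝒞 hiding (zero)
  open CommutativeSemiringExp commutativeSemiring using (^-congˡ)
  open VectorSetoid setoid using (_≋_)
  open AdditiveMaps 𝒞-perfect m
  open LinearMaps 𝒞-perfect m using (fold-scalar-plus-nilpotent)
  open Intertwining 𝒞-perfect m using (kernel-stable)
  open NormalForm 𝒞-perfect m using (ConnectedSubgroup; module Reduction)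
  open Action 𝓓 𝒜
  open Subgroups 𝓓 𝒜
  open CoefficientPolynomials 𝔽q using (normalise)

  Nonconstant : A.Carrier → Set _
  Nonconstant a = ∃₂ λ x as → ∃ λ b → ¬ b 𝔽q.≈ 𝔽q.0# × a A.≈ ((x ∷ as) ∷ʳ b)

  constant⊎nonconstant : ∀ a → (∃ λ x → a A.≈ const x) ⊎ Nonconstant a
  constant⊎nonconstant a with normalise a
  ... | inj₁ a≈[]                    = inj₁ (𝔽q.0# , λ { zero → a≈[] 0 ; (suc i) → a≈[] (suc i) })
  ... | inj₂ ([] , b , _ , a≈b)      = inj₁ (b , a≈b)
  ... | inj₂ (x ∷ as , b , b≉0 , a≈) = inj₂ (x , as , b , b≉0 , a≈)

  -- a(T) has a pole at infinity, so its powers are pairwise distinct in k, and the embedding of k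
  -- into 𝒞 through ℱ keeps them so.
  ev-not-fixed : ∀ {a} → Nonconstant a → ∀ i → ¬ ev a ≈ fold (ev a) φ (suc i)
  ev-not-fixed {a} (x , as , b , b≉0 , a≈) = not-fixed λ i j eq → nonconstant-powers x as b b≉0 i j
    (k→ℱ→𝒞.injective (trans (power i) (trans eq (sym (power j)))))
    where
      module k→ℱ→𝒞 = Homomorphism (ℱ→𝒞 ∘ʰ k→ℱ)
      power : ∀ i → k→ℱ→𝒞.⟦ A→k ((x ∷ as) ∷ʳ b) k.^ i ⟧ ≈ ev a ^ i
      power i = trans (k→ℱ→𝒞.^-homo _ i) (^-congˡ i (k→ℱ→𝒞.⟦⟧-cong (A→k.⟦⟧-cong λ n → 𝔽q.sym (a≈ n))))

  exponent : ℕ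
  exponent = p ℕ.^ proj₁ N-nilpotent′

  D : Map
  D z = fold z (α T) exponent

  D∼ : D ∼ (fold (ev T) φ (proj₁ N-nilpotent′) ⊙_)
  D∼ = ∼-respʳ (fold-scalar-plus-nilpotent (proj₁ N-nilpotent′) N-linear T₀-linear (λ _ → ≋-refl) (proj₂ N-nilpotent′))
    (⊙-linear _ id-linear) (αT^∼ exponent)

  module _ (ℬ : ConnectedAlgebraicSubgroup 𝓓 𝒜) {a} (nonconstant : Nonconstant a) (stable : StableUnder 𝓓 𝒜 ℬ a) where
    open ConnectedSubgroup (connectedSubgroup ℬ)
    open Reduction (connectedSubgroup ℬ)

    -- For every w the point w - E w lies in ker E = ℬ, so stability of ℬ under a is exactly E α (1
    -- - E) = 0. For z in ℬ one has z = z - E z, which brings the conclusion of `kernel-stable` back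
    -- to z.
    splitting⇒stable : Splitting → ∀ {z} → z ∈ → D z ∈
    splitting⇒stable split {z} z∈ = E⇒∈ (≋-trans (E-cong (D-cong (≋-sym z⊖Ez≋z)))
      (kernel-stable {n = proj₁ N-nilpotent′} {e = ev a} E-AP α∼ D∼ E-idempotent (λ w → ∈⇒E (stable _ (E⇒∈ (E[w⊖Ew]≋𝟘 w))))
        (λ w → α-T^-commute exponent a w) (differential-nilpotent (differential a)) (ev-not-fixed {a} nonconstant) z))
      where
        open Splitting split
        open Differential (differential a)
        E-cong : ∀ {x y} → x ≋ y → E x ≋ E y
        E-cong = AP-cong (proj₂ E-AP)
        D-cong : ∀ {x y} → x ≋ y → D x ≋ D y
        D-cong = AP-cong (proj₂ (∼⇒IsAP D∼))
        z⊖Ez≋z : z ⊖ E z ≋ z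
        z⊖Ez≋z i = trans (+-congˡ (trans (-‿cong (∈⇒E z∈ i)) ε⁻¹≈ε)) (+-identityʳ _)
          where open import Algebra.Properties.Group +-group using (ε⁻¹≈ε)
        E[w⊖Ew]≋𝟘 : ∀ w → E (w ⊖ E w) ≋ 𝟘
        E[w⊖Ew]≋𝟘 w = ≋-trans (Intertwining.AP-subtractive 𝒞-perfect m (proj₂ E-AP) w (E w))
          (λ i → FieldProperties.x≈y⇒x-y≈0 𝒞 (sym (E-idempotent w i)))

    nonconstant⇒T^-stable : IsSub-T^[_]-module 𝓓 𝒜 exponent ℬ
    nonconstant⇒T^-stable z z∈ = ∈-resp (≋-sym (α-^ exponent z)) (decidable-stable (∈? ℬ (D z))
      λ Dz∉ → ¬¬splitting λ split → Dz∉ (splitting⇒stable split z∈))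

theorem7 : ∀ {c ℓ p} (𝒦 : FunctionFieldTower c ℓ) (𝓓 : FieldOfDefinition 𝒦) (m : ℕ) (𝒜 : TModule 𝓓 m) →
    Abelian 𝓓 𝒜 → Uniformizable 𝓓 𝒜 →
    ∃ λ (j : ℕ) → 0 < j ×
    (∀ (B : Subring 𝒦 p) → ¬ (_⊆𝔽q 𝒦 B) →
    ∀ (ℬ : ConnectedAlgebraicSubgroup 𝓓 𝒜) →
    IsSub-[_]-module 𝓓 𝒜 B ℬ → IsSub-T^[_]-module 𝓓 𝒜 j ℬ)
theorem7 𝒦 𝓓 m 𝒜 _ _ = exponent 𝓓 𝒜 , ℕ.m^n>0 _ {{ℕ.>-nonZero positive}} (proj₁ (Action.N-nilpotent′ 𝓓 𝒜)) , λ B B⊈𝔽q ℬ sub z z∈ →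
  -- The negated inclusion provides no explicit nonconstant element of B. Instead, if the image of z
  -- under Φ(Tʲ) were outside ℬ, every a in B would have to be constant.
  decidable-stable (Subgroups.∈? 𝓓 𝒜 ℬ _) λ T^z∉ → B⊈𝔽q λ a a∈B →
    Sum.fromInj₁ (λ nonconstant → ⊥-elim (T^z∉ (nonconstant⇒T^-stable 𝓓 𝒜 ℬ nonconstant (sub a a∈B) z z∈))) (constant⊎nonconstant 𝓓 𝒜 a)
  where open Exponents.Characteristic (PerfectField.characteristic (TowerProperties.𝒞-perfect 𝒦)) using (positive)
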